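{- Let $G$ be a finite abelian group, let $S=s_1\cdot\ldots\cdot s_n$ be a sequence of terms from $G$ whose terms are not all contained in a coset of a proper subgroup of $G$, and let $W$ be a sequence of $n=|S|$ consecutive integers. Then: \begin{itemize} \item $|W\odot S|\geq \min\{|G|-1,\,|S|\}$. \item If $|S|\geq |G|+1$, then $W\odot S=G$. Indeed, $W'\odot S'=G$ for some subsequence $S'$ of $S$ with $|S'|=|G|$, where $W'=(0)(1)\cdot\ldots\cdot(|G|-1)$ is the sequence of the integers $0,1,\ldots,|G|-1$. \item If $|S|=|G|$ and $W\odot S\neq G$, then $|G|\geq 3$ and either \begin{itemize} \item[(i)] $G\cong C_2\oplus C_2$, the four terms of $S$ are the four distinct elements of $G$ (so $|S|=|G|=4$), and $W\odot S=G\setminus\{0\}$; or \item[(ii)] $G$ is cyclic and there exist $g,g'\in G$ with $\operatorname{ord}(g)=|G|$ such that $S$ consists of the term $g'$ with multiplicity $|G|-2$ together with the two terms $g'+g$ and $g'-g$, and $W\odot S=G\setminus\{\tfrac12(|G|-1)|G|\,g'\}$. In particular, $W\odot S$ contains every generator of $G$. \end{itemize} \end{itemize}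
   Context: A sequence over an abelian group $G$ is a finite unordered list of elements of $G$ with repetition allowed (a finite multiset); its length $|S|$ is the number of terms counted with multiplicity, and a subsequence is a sub-multiset. For a sequence of integers $W=w_1\cdot\ldots\cdot w_n$ and a sequence $S=s_1\cdot\ldots\cdot s_n$ over $G$ of the same length, $W\odot S=\{w_{\tau(1)}s_1+\ldots+w_{\tau(n)}s_n:\ \tau \text{ a permutation of } 1,\ldots,n\}$. $C_k$ denotes the cyclic group of order $k$, and $\operatorname{ord}(g)$ is the order of $g$. -}

module Defs where

open import Level using (0ℓ)
open import Algebra.Bundles using (AbelianGroup)
open import Data.Nat using (ℕ; zero; suc; _≤_; _<_; _∸_; _*_; _/_)
open import Data.Integer using (ℤ; +_; -[1+_]) renaming (_+_ to _+ℤ_)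
open import Data.Fin using (Fin; toℕ)
open import Data.Fin.Permutation using (Permutation′; _⟨$⟩ʳ_)
open import Data.Bool using (Bool; _xor_)
open import Data.Product using (Σ; ∃; _×_; _,_)
open import Relation.Binary.PropositionalEquality using (_≡_)
open import Relation.Nullary using (¬_)
import Algebra.Definitions.RawMonoid as RM

record IsFinite (G : AbelianGroup 0ℓ 0ℓ) : Set where
  open AbelianGroup G
  field
    size     : ℕ
    enum     : Fin size → Carrier
    enum-inj : ∀ i j → enum i ≈ enum j → i ≡ j
    enum-sur : ∀ x → ∃ λ i → enum i ≈ x

module Notions (G : AbelianGroup 0ℓ 0ℓ) where
  open AbelianGroup G
  open RM rawMonoid using (sum) renaming (_×_ to _×ₘ_)

  _·_ : ℤ → Carrier → Carrier
  (+ n) · x = n ×ₘ x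
  -[1+ n ] · x = (suc n ×ₘ x) ⁻¹

  record IsSubgroup (H : Carrier → Set) : Set where
    field
      resp   : ∀ {x y} → x ≈ y → H x → H y
      has-ε  : H ε
      closed : ∀ {x y} → H x → H y → H (x ∙ y)
      inv    : ∀ {x} → H x → H (x ⁻¹)

  Proper : (Carrier → Set) → Set
  Proper H = ∃ λ x → ¬ H x

  InCosetOfProperSubgroup : ∀ {n} → (Fin n → Carrier) → Set₁
  InCosetOfProperSubgroup {n} S =
    Σ (Carrier → Set) λ H → IsSubgroup H × Proper H ×
      (∃ λ g → ∀ i → H (S i ∙ g ⁻¹))

  consec : ∀ {n} → ℤ → Fin n → ℤ
  consec a i = a +ℤ (+ toℕ i)

  _∈⊙_ : ∀ {n} → Carrier → (Fin n → ℤ) × (Fin n → Carrier) → Set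
  _∈⊙_ {n} x (W , S) =
    ∃ λ (τ : Permutation′ n) → x ≈ sum (λ i → W (τ ⟨$⟩ʳ i) · S i)

  AtLeast : ℕ → (Carrier → Set) → Set
  AtLeast k A = ∃ λ (f : Fin k → Carrier) →
    (∀ i j → f i ≈ f j → i ≡ j) × (∀ i → A (f i))

  HasOrder : Carrier → ℕ → Set
  HasOrder g k = (0 < k) × ((+ k) · g ≈ ε) ×
    (∀ j → 0 < j → (+ j) · g ≈ ε → k ≤ j)

  IsGenerator : Carrier → Set
  IsGenerator g = ∀ y → ∃ λ z → y ≈ z · g

  Cyclic : Set
  Cyclic = ∃ λ g → IsGenerator g

  IsoC2⊕C2 : Set
  IsoC2⊕C2 = ∃ λ (φ : Carrier → Bool × Bool) →
    (∀ x y → x ≈ y → φ x ≡ φ y) ×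
    (∀ x y → φ x ≡ φ y → x ≈ y) ×
    (∀ b → ∃ λ x → φ x ≡ b) ×
    (∀ x y → φ (x ∙ y) ≡ add (φ x) (φ y))
    where
    add : Bool × Bool → Bool × Bool → Bool × Bool
    add (a , b) (c , d) = (a xor c , b xor d)

{-# OPTIONS --safe #-}
-- Up to translation, W ⊙ S is the set X(S) of the sums Σ i s_τ(i) with the weights 0, …, n − 1. If a term s is essential,
-- that is, the others span only a coset of a proper subgroup H, then the weight of s selects a coset of H, and the
-- theorem for H fills enough of these cosets. Otherwise every term can be removed, and
-- placing s first or last gives two translates of X(S \ s) inside X(S): either |X(S)| > |X(S \ s)|, or X(S) has
-- the period σ(S) − n s, which is handled in a quotient of G. If all these periods vanish, removing two terms u, v shows that X(S)
-- is invariant under u − v up to a single element, for all u ≠ v. Such a set is G without a point, or it has an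
-- isolated point, which exchanging two terms with consecutive weights excludes.
-- For |S| = |G| and X(S) ≠ G, sums of small blocks of terms, with X(B) + X(S \ B) ⊆ X(S) up to translation, leave
-- only the two exceptional sequences.
module Submission where

open import Defs
open import Level using (0ℓ)
open import Algebra.Bundles using (AbelianGroup)
open import Data.Nat using (ℕ; zero; suc; _+_; _*_; _∸_; _≤_; _<_; _⊓_; z≤n; s≤s; _%_; _/_; NonZero; >-nonZero)
open import Data.Nat.Properties using (*-comm; *-distribʳ-+; *-distribˡ-+; *-identityʳ; +-cancelˡ-≤; +-comm; +-commutativeSemigroup; +-distribʳ-⊓; +-identityʳ; +-mono-≤; +-monoʳ-≤; +-monoˡ-≤; +-suc; <-irrefl; <-≤-trans; _<?_; <⇒≤; <⇒≱; m+1+n≰m; m+[n∸m]≡n; m<n⇒0<n∸m; m∸n≤m; m≤m+n; m≤n+m; m≤n+m∸n; m≤n⇒m≤1+n; m≤n⇒m⊓n≡m; m≥n⇒m⊓n≡n; m⊓n≤m; m⊓n≤n; n≢0⇒n>0; n≤1+n; ∸-monoˡ-≤; ≤-<-trans; ≤-antisym; ≤-pred; ≤-refl; ≤-reflexive; ≤-trans; _≤?_; ≤⇒≯; ≮⇒≥; ≰⇒>; ⊓-glb; ⊓-idem; module ≤-Reasoning; _≟_)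
open import Data.Nat.DivMod using (m≡m%n+[m/n]*n; m%n<n; m*n/n≡m)
open import Data.Fin using (Fin; zero; suc; toℕ; cast; inject≤)
open import Data.Fin.Properties as Finₚ using ()
open import Data.Fin.Permutation using (Permutation; Permutation′; permutation; _⟨$⟩ʳ_)
open import Data.Integer as ℤ using (ℤ; +_; -[1+_])
open import Data.Integer.Properties as ℤₚ using ()
open import Data.Bool using (Bool; true; false; _xor_)
open import Data.Bool.Properties using (xor-same)
import Algebra.Properties.CommutativeMonoid.Sum
open import Data.Vec as Vec using (Vec; []; _∷_)
open import Data.Vec.Properties using (≡-dec)
open import Data.List using (List; []; _∷_; _++_; [_]; length; map; replicate; foldr; concatMap; filter; upTo; take; drop; applyUpTo; allFin; tabulate; lookup)
open import Data.List.Properties using (length-++; length-map; ∷-injectiveˡ; ∷-injectiveʳ; length-upTo; length-applyUpTo; length-take; take++drop≡id; map-++; ++-assoc; length-tabulate; map-tabulate; tabulate-lookup)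
open import Data.List.Membership.Propositional using () renaming (_∈_ to _∈ₚ_)
open import Data.List.Membership.Propositional.Properties using (∈-∃++; ∈-upTo⁺; ∈-lookup; ∈-allFin; ∈-map⁺)
open import Data.List.Membership.Setoid.Properties using (∈-filter⁺)
open import Data.List.Relation.Unary.All as All using (All; []; _∷_)
open import Data.List.Relation.Unary.All.Properties as Allₚ using ()
open import Data.List.Relation.Unary.AllPairs as AllPairs using (AllPairs; []; _∷_)
open import Data.List.Relation.Unary.AllPairs.Properties as AllPairsₚ using ()
open import Data.List.Relation.Unary.Any as Any using (Any; here; there)
open import Data.List.Relation.Unary.Any.Properties as Anyₚ using ()
open import Data.List.Relation.Binary.Pointwise using (Pointwise; []; _∷_)
open import Data.List.Relation.Binary.Permutation.Propositional using (_↭_; ↭-sym; ↭-trans; ↭-refl; ↭-reflexive; prep; swap; refl; trans)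
open import Data.List.Relation.Binary.Permutation.Propositional.Properties as Perm using (↭-length; shift; ↭-map-inv; All-resp-↭; Any-resp-↭)
open import Data.Product using (Σ; ∃; _×_; _,_; proj₁; proj₂)
open import Data.Sum using (_⊎_; inj₁; inj₂)
open import Data.Empty using (⊥; ⊥-elim)
open import Function using (_∘_; id)
open import Relation.Binary.PropositionalEquality as ≡ using (_≡_; _≢_; cong; cong₂; subst; subst₂; sym)
open import Relation.Nullary using (¬_; Dec; yes; no; contradiction)
open import Relation.Nullary.Decidable using (map′; _→-dec_; _×-dec_; ¬?; decidable-stable; True; toWitness)
import Algebra.Properties.CommutativeMonoid.Mult as Mult
import Algebra.Properties.AbelianGroup as AbelianGroupProperties

-- Two assertions are carried through one induction on the order of the group: the lower bound
-- (`Bound`) and the filling of G by |G| suitable terms of a longer sequence (`Full`). The bound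
-- stops at |G| - 1, so over a subgroup or quotient it can leave every coset one element short;
-- `Full` closes this gap as soon as enough terms are available. The obstacle is the small cases.
-- When an essential term is split off, one wants one sum more than there are terms, so that a
-- further term can be prepended without loss. Unless everything is filled, this surplus fails only
-- for a constant remainder and for a remainder of two terms in a group of order at most 4. These
-- two failures are the origin of the cyclic and of the Klein exception. Membership in X(S) and
-- lower bounds for |X(S)| are decided by finite search, so a counterexample may be assumed and
-- refuted. A failure to span is always produced together with an explicit coset of a proper
-- subgroup.

module GroupSolver (G : AbelianGroup 0ℓ 0ℓ) where
  open AbelianGroup G hiding (refl; trans; sym)
  open AbelianGroup G using () renaming (refl to ≈-refl; trans to ≈-trans; sym to ≈-sym)
  open Mult commutativeMonoid using (×-homo-+; ×-assocˡ; ×-congʳ; ×-congˡ) renaming (_×_ to _⋆_; ×-distrib-+ to ⋆-distrib) public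
  open AbelianGroupProperties G using (∙-cancelʳ)
  open import Relation.Binary.Reasoning.Setoid setoid
  open import Algebra.Properties.CommutativeSemigroup commutativeSemigroup using (interchange)

  infixl 7 _⊕_ _⊖_
  infix 8 ⊝_
  infixr 9 _⊛_

  data Expr (n : ℕ) : Set where
    var  : Fin n → Expr n
    ∅    : Expr n
    _⊕_ : Expr n → Expr n → Expr n
    ⊝_   : Expr n → Expr n
    _⊛_ : ℕ → Expr n → Expr n

  _⊖_ : ∀ {n} → Expr n → Expr n → Expr n
  e ⊖ f = e ⊕ ⊝ f

  ⟦_⟧ : ∀ {n} → Expr n → Vec Carrier n → Carrier
  ⟦ var i ⟧ ρ = Vec.lookup ρ i
  ⟦ ∅ ⟧ ρ = ε
  ⟦ e ⊕ f ⟧ ρ = ⟦ e ⟧ ρ ∙ ⟦ f ⟧ ρ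
  ⟦ ⊝ e ⟧ ρ = ⟦ e ⟧ ρ ⁻¹
  ⟦ k ⊛ e ⟧ ρ = k ⋆ ⟦ e ⟧ ρ

  Coeffs : ℕ → Set
  Coeffs = Vec ℕ

  _⊞_ : ∀ {n} → Coeffs n → Coeffs n → Coeffs n
  _⊞_ = Vec.zipWith _+_

  unit : ∀ {n} → Fin n → Coeffs n
  unit zero = 1 ∷ Vec.replicate _ 0
  unit (suc i) = 0 ∷ unit i

  -- An expression is normalised to a difference of two vectors of natural coefficients, and
  -- equations are compared crosswise, `pos e ⊞ neg f` against `pos f ⊞ neg e`; this avoids an
  -- integer normal form.
  pos neg : ∀ {n} → Expr n → Coeffs n
  pos (var i) = unit i
  pos ∅ = Vec.replicate _ 0
  pos (e ⊕ f) = pos e ⊞ pos f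
  pos (⊝ e) = neg e
  pos (k ⊛ e) = Vec.map (k *_) (pos e)
  neg (var i) = Vec.replicate _ 0
  neg ∅ = Vec.replicate _ 0
  neg (e ⊕ f) = neg e ⊞ neg f
  neg (⊝ e) = pos e
  neg (k ⊛ e) = Vec.map (k *_) (neg e)

  ev : ∀ {n} → Coeffs n → Vec Carrier n → Carrier
  ev [] [] = ε
  ev (k ∷ ks) (x ∷ ρ) = k ⋆ x ∙ ev ks ρ

  ev-0 : ∀ {n} (ρ : Vec Carrier n) → ev (Vec.replicate n 0) ρ ≈ ε
  ev-0 [] = ≈-refl
  ev-0 (x ∷ ρ) = ≈-trans (identityˡ _) (ev-0 ρ)

  ev-unit : ∀ {n} (i : Fin n) ρ → ev (unit i) ρ ≈ Vec.lookup ρ i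
  ev-unit zero (x ∷ ρ) = ≈-trans (∙-cong (identityʳ x) (ev-0 ρ)) (identityʳ x)
  ev-unit (suc i) (x ∷ ρ) = ≈-trans (identityˡ _) (ev-unit i ρ)

  ev-⊞ : ∀ {n} (u v : Coeffs n) ρ → ev (u ⊞ v) ρ ≈ ev u ρ ∙ ev v ρ
  ev-⊞ [] [] [] = ≈-sym (identityʳ ε)
  ev-⊞ (k ∷ u) (l ∷ v) (x ∷ ρ) =
    ≈-trans (∙-cong (×-homo-+ x k l) (ev-⊞ u v ρ)) (interchange _ _ _ _)

  ev-scale : ∀ {n} k (u : Coeffs n) ρ → ev (Vec.map (k *_) u) ρ ≈ k ⋆ ev u ρ
  ev-scale k [] [] = ≈-sym (⋆-ε k)
    where
    ⋆-ε : ∀ k → k ⋆ ε ≈ ε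
    ⋆-ε zero = ≈-refl
    ⋆-ε (suc k) = ≈-trans (identityˡ _) (⋆-ε k)
  ev-scale k (l ∷ u) (x ∷ ρ) = begin
    (k * l) ⋆ x ∙ ev (Vec.map (k *_) u) ρ ≈⟨ ∙-cong (≈-sym (×-assocˡ x k l)) (ev-scale k u ρ) ⟩
    k ⋆ (l ⋆ x) ∙ k ⋆ ev u ρ              ≈⟨ ⋆-distrib _ _ k ⟨
    k ⋆ (l ⋆ x ∙ ev u ρ)                  ∎

  sound : ∀ {n} (e : Expr n) ρ → ⟦ e ⟧ ρ ∙ ev (neg e) ρ ≈ ev (pos e) ρ
  sound (var i) ρ = ≈-trans (∙-congˡ (ev-0 ρ)) (≈-trans (identityʳ _) (≈-sym (ev-unit i ρ)))
  sound ∅ ρ = identityˡ _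
  sound (e ⊕ f) ρ = begin
    ⟦ e ⟧ ρ ∙ ⟦ f ⟧ ρ ∙ ev (neg e ⊞ neg f) ρ             ≈⟨ ∙-congˡ (ev-⊞ (neg e) (neg f) ρ) ⟩
    ⟦ e ⟧ ρ ∙ ⟦ f ⟧ ρ ∙ (ev (neg e) ρ ∙ ev (neg f) ρ)    ≈⟨ interchange _ _ _ _ ⟩
    ⟦ e ⟧ ρ ∙ ev (neg e) ρ ∙ (⟦ f ⟧ ρ ∙ ev (neg f) ρ)    ≈⟨ ∙-cong (sound e ρ) (sound f ρ) ⟩
    ev (pos e) ρ ∙ ev (pos f) ρ                          ≈⟨ ev-⊞ (pos e) (pos f) ρ ⟨
    ev (pos e ⊞ pos f) ρ                                 ∎
  sound (⊝ e) ρ = begin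
    ⟦ e ⟧ ρ ⁻¹ ∙ ev (pos e) ρ                 ≈⟨ ∙-congˡ (sound e ρ) ⟨
    ⟦ e ⟧ ρ ⁻¹ ∙ (⟦ e ⟧ ρ ∙ ev (neg e) ρ)     ≈⟨ assoc _ _ _ ⟨
    ⟦ e ⟧ ρ ⁻¹ ∙ ⟦ e ⟧ ρ ∙ ev (neg e) ρ       ≈⟨ ∙-congʳ (inverseˡ _) ⟩
    ε ∙ ev (neg e) ρ                          ≈⟨ identityˡ _ ⟩
    ev (neg e) ρ                              ∎
  sound (k ⊛ e) ρ = begin
    k ⋆ ⟦ e ⟧ ρ ∙ ev (Vec.map (k *_) (neg e)) ρ ≈⟨ ∙-congˡ (ev-scale k (neg e) ρ) ⟩
    k ⋆ ⟦ e ⟧ ρ ∙ k ⋆ ev (neg e) ρ              ≈⟨ ⋆-distrib _ _ k ⟨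
    k ⋆ (⟦ e ⟧ ρ ∙ ev (neg e) ρ)                ≈⟨ ×-congʳ k (sound e ρ) ⟩
    k ⋆ ev (pos e) ρ                            ≈⟨ ev-scale k (pos e) ρ ⟨
    ev (Vec.map (k *_) (pos e)) ρ               ∎

  solve : ∀ {n} (e f : Expr n) {_ : True (≡-dec _≟_ (pos e ⊞ neg f) (pos f ⊞ neg e))} → ∀ ρ → ⟦ e ⟧ ρ ≈ ⟦ f ⟧ ρ
  solve e f {eq} ρ = ∙-cancelʳ (ev (neg e) ρ ∙ ev (neg f) ρ) _ _ (begin
    ⟦ e ⟧ ρ ∙ (ev (neg e) ρ ∙ ev (neg f) ρ)   ≈⟨ assoc _ _ _ ⟨
    ⟦ e ⟧ ρ ∙ ev (neg e) ρ ∙ ev (neg f) ρ     ≈⟨ ∙-congʳ (sound e ρ) ⟩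
    ev (pos e) ρ ∙ ev (neg f) ρ               ≈⟨ ev-⊞ (pos e) (neg f) ρ ⟨
    ev (pos e ⊞ neg f) ρ                      ≡⟨ cong (λ c → ev c ρ) (toWitness eq) ⟩
    ev (pos f ⊞ neg e) ρ                      ≈⟨ ev-⊞ (pos f) (neg e) ρ ⟩
    ev (pos f) ρ ∙ ev (neg e) ρ               ≈⟨ ∙-congʳ (sound f ρ) ⟨
    ⟦ f ⟧ ρ ∙ ev (neg f) ρ ∙ ev (neg e) ρ     ≈⟨ assoc _ _ _ ⟩
    ⟦ f ⟧ ρ ∙ (ev (neg f) ρ ∙ ev (neg e) ρ)   ≈⟨ ∙-congˡ (comm _ _) ⟩
    ⟦ f ⟧ ρ ∙ (ev (neg e) ρ ∙ ev (neg f) ρ)   ∎)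

  pattern v0 = var zero
  pattern v1 = var (suc zero)
  pattern v2 = var (suc (suc zero))
  pattern v3 = var (suc (suc (suc zero)))
  pattern v4 = var (suc (suc (suc (suc zero))))
  pattern v5 = var (suc (suc (suc (suc (suc zero)))))

-- Weighted sums of lists and their translates.

module WeightedSums (G : AbelianGroup 0ℓ 0ℓ) where
  open AbelianGroup G hiding (refl; trans; sym; _-_) public
  open AbelianGroup G using () renaming (refl to ≈-refl; trans to ≈-trans; sym to ≈-sym) public
  open GroupSolver G public
  open import Relation.Binary.Reasoning.Setoid setoid

  infixl 7 _-_
  _-_ : Carrier → Carrier → Carrier
  x - y = x ∙ y ⁻¹

  -‿cong : ∀ {x x′ y y′} → x ≈ x′ → y ≈ y′ → x - y ≈ x′ - y′
  -‿cong p q = ∙-cong p (⁻¹-cong q)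

  x-y≈ε⇒x≈y : ∀ {x y} → x - y ≈ ε → x ≈ y
  x-y≈ε⇒x≈y {x} {y} p = begin
    x           ≈⟨ solve v0 (v0 ⊖ v1 ⊕ v1) (x ∷ y ∷ []) ⟩
    x - y ∙ y   ≈⟨ ∙-congʳ p ⟩
    ε ∙ y       ≈⟨ identityˡ y ⟩
    y           ∎

  x≈y⇒x-y≈ε : ∀ {x y} → x ≈ y → x - y ≈ ε
  x≈y⇒x-y≈ε {x} {y} p = ≈-trans (∙-congʳ p) (inverseʳ y)

  cancelʳ : ∀ {x y} z → x ∙ z ≈ y ∙ z → x ≈ y
  cancelʳ {x} {y} z p = begin
    x           ≈⟨ solve v0 (v0 ⊕ v1 ⊖ v1) (x ∷ z ∷ []) ⟩
    x ∙ z - z   ≈⟨ ∙-congʳ p ⟩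
    y ∙ z - z   ≈⟨ solve (v0 ⊕ v1 ⊖ v1) v0 (y ∷ z ∷ []) ⟩
    y           ∎

  cancelˡ : ∀ {x y} z → z ∙ x ≈ z ∙ y → x ≈ y
  cancelˡ {x} {y} z p = cancelʳ z (≈-trans (comm x z) (≈-trans p (comm z y)))

  -- Derives one equation from another by an identity between differences, which `solve` can check;
  -- most small computations below have this form.
  via : ∀ {x y x′ y′} → x - y ≈ x′ - y′ → x ≈ y → x′ ≈ y′
  via p q = x-y≈ε⇒x≈y (≈-trans (≈-sym p) (x≈y⇒x-y≈ε q))

  sumL : List Carrier → Carrier
  sumL = foldr _∙_ ε

  -- The i-th term, counted from 0, has weight i.
  wsum : List Carrier → Carrier
  wsum [] = ε
  wsum (x ∷ xs) = wsum xs ∙ sumL xs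

  X : List Carrier → Carrier → Set
  X L x = ∃ λ L′ → L′ ↭ L × wsum L′ ≈ x

  sumL-↭ : ∀ {xs ys} → xs ↭ ys → sumL xs ≈ sumL ys
  sumL-↭ refl = ≈-refl
  sumL-↭ (prep x p) = ∙-congˡ (sumL-↭ p)
  sumL-↭ (swap {xs} {ys} x y p) = begin
    x ∙ (y ∙ sumL xs) ≈⟨ solve (v0 ⊕ (v1 ⊕ v2)) (v1 ⊕ (v0 ⊕ v2)) (x ∷ y ∷ sumL xs ∷ []) ⟩
    y ∙ (x ∙ sumL xs) ≈⟨ ∙-congˡ (∙-congˡ (sumL-↭ p)) ⟩
    y ∙ (x ∙ sumL ys) ∎
  sumL-↭ (trans p q) = ≈-trans (sumL-↭ p) (sumL-↭ q)

  sumL-++ : ∀ A B → sumL (A ++ B) ≈ sumL A ∙ sumL B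
  sumL-++ [] B = ≈-sym (identityˡ _)
  sumL-++ (x ∷ A) B = ≈-trans (∙-congˡ (sumL-++ A B)) (≈-sym (assoc _ _ _))

  -- The contribution to `wsum (A ++ T)` besides `wsum T`. It depends on `T` only through
  -- length-free data, its sum, and so stays constant while `T` is rearranged.
  prefix : List Carrier → List Carrier → Carrier
  prefix A T = wsum A ∙ (length A ⋆ sumL T)

  wsum-++ : ∀ A B → wsum (A ++ B) ≈ prefix A B ∙ wsum B
  wsum-++ [] B = solve v0 (∅ ⊕ ∅ ⊕ v0) (wsum B ∷ [])
  wsum-++ (x ∷ A) B = begin
    wsum (A ++ B) ∙ sumL (A ++ B) ≈⟨ ∙-cong (wsum-++ A B) (sumL-++ A B) ⟩
    wsum A ∙ (length A ⋆ sumL B) ∙ wsum B ∙ (sumL A ∙ sumL B)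
      ≈⟨ solve (v0 ⊕ v1 ⊕ v2 ⊕ (v3 ⊕ v4)) (v0 ⊕ v3 ⊕ (v4 ⊕ v1) ⊕ v2)
           (wsum A ∷ length A ⋆ sumL B ∷ wsum B ∷ sumL A ∷ sumL B ∷ []) ⟩
    wsum A ∙ sumL A ∙ (sumL B ∙ length A ⋆ sumL B) ∙ wsum B ∎

  X-resp : ∀ {L x y} → x ≈ y → X L x → X L y
  X-resp p (L′ , q , e) = L′ , q , ≈-trans e p

  X-↭ : ∀ {L M x} → L ↭ M → X L x → X M x
  X-↭ p (L′ , q , e) = L′ , ↭-trans q p , e

  X-wsum : ∀ L → X L (wsum L)
  X-wsum L = L , ↭-refl , ≈-refl

  -- The two lists can be arranged independently: standing behind `A` raises every weight in `B` by
  -- |A|, which adds a constant.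
  X-++ : ∀ {A B a b} → X A a → X B b → X (A ++ B) (a ∙ (length A ⋆ sumL B) ∙ b)
  X-++ {A} {B} {a} {b} (A′ , p , e) (B′ , q , f) = A′ ++ B′ , Perm.++⁺ p q , (begin
    wsum (A′ ++ B′)                                ≈⟨ wsum-++ A′ B′ ⟩
    wsum A′ ∙ (length A′ ⋆ sumL B′) ∙ wsum B′      ≈⟨ ∙-cong (∙-cong e (≈-trans (×-congˡ (↭-length p)) (×-congʳ (length A) (sumL-↭ q)))) f ⟩
    a ∙ (length A ⋆ sumL B) ∙ b                    ∎)

  X-prefix : ∀ A {T x} → X T x → X (A ++ T) (prefix A T ∙ x)
  X-prefix A = X-++ (X-wsum A)

  ⋆-ε : ∀ k → k ⋆ ε ≈ ε
  ⋆-ε zero = ≈-refl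
  ⋆-ε (suc k) = ≈-trans (identityˡ _) (⋆-ε k)

  ⋆-⁻¹ : ∀ k x → k ⋆ (x ⁻¹) ≈ (k ⋆ x) ⁻¹
  ⋆-⁻¹ zero x = solve ∅ (⊝ ∅) []
  ⋆-⁻¹ (suc k) x = ≈-trans (∙-congˡ (⋆-⁻¹ k x))
    (solve (⊝ v0 ⊖ v1) (⊝ (v0 ⊕ v1)) (x ∷ k ⋆ x ∷ []))

  sumL-translate : ∀ g L → sumL L ≈ sumL (map (_- g) L) ∙ length L ⋆ g
  sumL-translate g [] = ≈-sym (identityˡ ε)
  sumL-translate g (x ∷ L) = ≈-trans (∙-congˡ (sumL-translate g L))
    (solve (v0 ⊕ (v1 ⊕ v2)) (v0 ⊖ v3 ⊕ v1 ⊕ (v3 ⊕ v2)) (x ∷ sumL (map (_- g) L) ∷ length L ⋆ g ∷ g ∷ []))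

  -- This is the multiple n (n - 1) / 2 of `g`; written as a `wsum` it obeys the recursion of the
  -- sums that it is compared with.
  triangle : ℕ → Carrier → Carrier
  triangle n g = wsum (replicate n g)

  sumL-replicate : ∀ n g → sumL (replicate n g) ≈ n ⋆ g
  sumL-replicate zero g = ≈-refl
  sumL-replicate (suc n) g = ∙-congˡ (sumL-replicate n g)

  wsum-translate : ∀ g L → wsum L ≈ wsum (map (_- g) L) ∙ triangle (length L) g
  wsum-translate g [] = ≈-sym (identityˡ ε)
  wsum-translate g (x ∷ L) = begin
    wsum L ∙ sumL L ≈⟨ ∙-cong (wsum-translate g L) (sumL-translate g L) ⟩
    wsum (map (_- g) L) ∙ triangle n g ∙ (sumL (map (_- g) L) ∙ n ⋆ g)
      ≈⟨ solve (v0 ⊕ v1 ⊕ (v2 ⊕ v3)) (v0 ⊕ v2 ⊕ (v1 ⊕ v3))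
           (wsum (map (_- g) L) ∷ triangle n g ∷ sumL (map (_- g) L) ∷ n ⋆ g ∷ []) ⟩
    wsum (map (_- g) L) ∙ sumL (map (_- g) L) ∙ (triangle n g ∙ n ⋆ g)
      ≈⟨ ∙-congˡ (∙-congˡ (sumL-replicate n g)) ⟨
    wsum (map (_- g) L) ∙ sumL (map (_- g) L) ∙ (triangle n g ∙ sumL (replicate n g)) ∎
    where n = length L

  -- The exchanged terms carry consecutive weights, so one unit of weight passes from `b` to `a`.
  wsum-swap : ∀ A a b B → wsum (A ++ b ∷ a ∷ B) ≈ wsum (A ++ a ∷ b ∷ B) ∙ (a - b)
  wsum-swap A a b B = begin
    wsum (A ++ b ∷ a ∷ B) ≈⟨ wsum-++ A (b ∷ a ∷ B) ⟩
    wsum A ∙ length A ⋆ (b ∙ (a ∙ sumL B)) ∙ (wsum B ∙ sumL B ∙ (a ∙ sumL B))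
      ≈⟨ ∙-congʳ (∙-congˡ (×-congʳ (length A) (solve (v1 ⊕ (v0 ⊕ v2)) (v0 ⊕ (v1 ⊕ v2)) (a ∷ b ∷ sumL B ∷ [])))) ⟩
    wsum A ∙ length A ⋆ (a ∙ (b ∙ sumL B)) ∙ (wsum B ∙ sumL B ∙ (a ∙ sumL B))
      ≈⟨ solve (v0 ⊕ v1 ⊕ (v2 ⊕ v3 ⊕ (v4 ⊕ v3))) (v0 ⊕ v1 ⊕ (v2 ⊕ v3 ⊕ (v5 ⊕ v3)) ⊕ (v4 ⊖ v5))
          (wsum A ∷ length A ⋆ (a ∙ (b ∙ sumL B)) ∷ wsum B ∷ sumL B ∷ a ∷ b ∷ []) ⟩
    wsum A ∙ length A ⋆ (a ∙ (b ∙ sumL B)) ∙ (wsum B ∙ sumL B ∙ (b ∙ sumL B)) ∙ (a - b)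
      ≈⟨ ∙-congʳ (wsum-++ A (a ∷ b ∷ B)) ⟨
    wsum (A ++ a ∷ b ∷ B) ∙ (a - b) ∎

  wsum₃ : ∀ x y z → wsum (x ∷ y ∷ z ∷ []) ≈ y ∙ 2 ⋆ z
  wsum₃ x y z = solve (∅ ⊕ ∅ ⊕ (v1 ⊕ ∅) ⊕ (v0 ⊕ (v1 ⊕ ∅))) (v0 ⊕ 2 ⊛ v1) (y ∷ z ∷ [])

  wsum₄ : ∀ w x y z → wsum (w ∷ x ∷ y ∷ z ∷ []) ≈ x ∙ 2 ⋆ y ∙ 3 ⋆ z
  wsum₄ w x y z = solve (∅ ⊕ ∅ ⊕ (v2 ⊕ ∅) ⊕ (v1 ⊕ (v2 ⊕ ∅)) ⊕ (v0 ⊕ (v1 ⊕ (v2 ⊕ ∅)))) (v0 ⊕ 2 ⊛ v1 ⊕ 3 ⊛ v2) (x ∷ y ∷ z ∷ [])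

-- Lists: rearrangements and pairwise relations.

extract : ∀ {A : Set} {P : A → Set} {xs} → Any P xs → ∃ λ y → ∃ λ zs → P y × xs ↭ y ∷ zs
extract (here p) = _ , _ , p , refl
extract (there {x} i) with extract i
... | y , zs , p , π = y , x ∷ zs , p , trans (prep x π) (swap x y refl)

insertions : ∀ {A : Set} → A → List A → List (List A)
insertions x [] = [ [ x ] ]
insertions x (y ∷ ys) = (x ∷ y ∷ ys) ∷ map (y ∷_) (insertions x ys)

-- A complete finite list of rearrangements turns membership in `X`, and statements about all orders
-- of a sequence, into searches.
arrangements : ∀ {A : Set} → List A → List (List A)
arrangements [] = [ [] ]
arrangements (x ∷ xs) = concatMap (insertions x) (arrangements xs)

insertions-complete : ∀ {A : Set} (x : A) as bs → (as ++ x ∷ bs) ∈ₚ insertions x (as ++ bs)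
insertions-complete x [] [] = here ≡.refl
insertions-complete x [] (_ ∷ _) = here ≡.refl
insertions-complete x (a ∷ as) bs = there (Anyₚ.map⁺ (Any.map (cong (a ∷_)) (insertions-complete x as bs)))

insertions-sound : ∀ {A : Set} (x : A) ys → All (_↭ x ∷ ys) (insertions x ys)
insertions-sound x [] = refl ∷ []
insertions-sound x (y ∷ ys) =
  refl ∷ Allₚ.map⁺ (All.map (λ p → trans (prep y p) (swap y x refl)) (insertions-sound x ys))

arrangements-complete : ∀ {A : Set} (xs : List A) {ys} → ys ↭ xs → ys ∈ₚ arrangements xs
arrangements-complete [] p with Perm.↭-empty-inv p
... | ≡.refl = here ≡.refl
arrangements-complete (x ∷ xs) p with ∈-∃++ (Any-resp-↭ (↭-sym p) (here ≡.refl))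
... | as , bs , ≡.refl = Anyₚ.concat⁺ (Anyₚ.map⁺ (Any.map (λ { ≡.refl → insertions-complete x as bs })
        (arrangements-complete xs (Perm.drop-mid as [] p))))

arrangements-sound : ∀ {A : Set} (xs : List A) → All (_↭ xs) (arrangements xs)
arrangements-sound [] = refl ∷ []
arrangements-sound (x ∷ xs) = Allₚ.concat⁺ (Allₚ.map⁺ (All.map
  (λ p → All.map (λ q → trans q (prep x p)) (insertions-sound x _)) (arrangements-sound xs)))

module _ {A : Set} {R : A → A → Set} where

  AllPairs-↭ : (∀ {x y} → R x y → R y x) → ∀ {xs ys} → xs ↭ ys → AllPairs R xs → AllPairs R ys
  AllPairs-↭ s refl d = d
  AllPairs-↭ s (prep x p) (a ∷ d) = All-resp-↭ p a ∷ AllPairs-↭ s p d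
  AllPairs-↭ s (swap x y p) ((r ∷ a) ∷ b ∷ d) = (s r ∷ All-resp-↭ p b) ∷ All-resp-↭ p a ∷ AllPairs-↭ s p d
  AllPairs-↭ s (trans p q) d = AllPairs-↭ s q (AllPairs-↭ s p d)

  AllPairs-lookup : (∀ {x y} → R x y → R y x) → ∀ {xs} → AllPairs R xs → ∀ i j → i ≢ j → R (lookup xs i) (lookup xs j)
  AllPairs-lookup s (a ∷ d) zero zero ne = contradiction ≡.refl ne
  AllPairs-lookup s (a ∷ d) zero (suc j) ne = All.lookup a (∈-lookup j)
  AllPairs-lookup s (a ∷ d) (suc i) zero ne = s (All.lookup a (∈-lookup i))
  AllPairs-lookup s (a ∷ d) (suc i) (suc j) ne = AllPairs-lookup s d i j (λ e → ne (cong suc e))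

-- Finite abelian groups with decidable equality: counting and generated subgroups.

record FinGroup : Set₁ where
  field
    G : AbelianGroup 0ℓ 0ℓ
  open WeightedSums G public
  infix 4 _≈?_
  field
    _≈?_     : ∀ x y → Dec (x ≈ y)
    elems    : List Carrier
    distinct : AllPairs _≉_ elems
    complete : ∀ x → Any (x ≈_) elems

  size : ℕ
  size = length elems

module Finite (F : FinGroup) where
  open FinGroup F
  open import Relation.Binary.Reasoning.Setoid setoid

  infix 4 _∈_
  _∈_ : Carrier → List Carrier → Set
  x ∈ xs = Any (x ≈_) xs

  _∈?_ : ∀ x xs → Dec (x ∈ xs)
  x ∈? xs = Any.any? (x ≈?_) xs

  Distinct : List Carrier → Set
  Distinct = AllPairs _≉_

  Distinct-↭ : ∀ {xs ys} → xs ↭ ys → Distinct xs → Distinct ys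
  Distinct-↭ = AllPairs-↭ λ ne e → ne (≈-sym e)

  Respects : (Carrier → Set) → Set
  Respects P = ∀ {x y} → x ≈ y → P x → P y

  embed : ∀ {xs ys} → Distinct xs → All (_∈ ys) xs →
          ∃ λ ws → ∃ λ zs → ys ↭ ws ++ zs × Pointwise _≈_ xs ws
  embed {ys = ys} [] [] = [] , ys , refl , []
  embed {x ∷ xs} (x≉ ∷ d) (i ∷ is) with extract i
  ... | y , ys′ , x≈y , π with embed d (All.zipWith others (x≉ , is))
    where
    others : ∀ {z} → (x ≉ z) × (z ∈ _) → z ∈ ys′
    others (x≉z , j) with Any-resp-↭ π j
    ... | here z≈y = contradiction (≈-trans x≈y (≈-sym z≈y)) x≉z
    ... | there k = k
  ... | ws , zs , ρ , pw = y ∷ ws , zs , trans π (prep y ρ) , x≈y ∷ pw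

  pw-length : ∀ {xs ys} → Pointwise _≈_ xs ys → length xs ≡ length ys
  pw-length [] = ≡.refl
  pw-length (_ ∷ p) = cong suc (pw-length p)

  pw-sum : ∀ {xs ys} → Pointwise _≈_ xs ys → sumL xs ≈ sumL ys
  pw-sum [] = ≈-refl
  pw-sum (e ∷ p) = ∙-cong e (pw-sum p)

  pw-∈ : ∀ {x xs ys} → Pointwise _≈_ xs ys → x ∈ ys → x ∈ xs
  pw-∈ (e ∷ p) (here q) = here (≈-trans q (≈-sym e))
  pw-∈ (e ∷ p) (there i) = there (pw-∈ p i)

  distinct-length : ∀ {xs ys} → Distinct xs → All (_∈ ys) xs → length xs ≤ length ys
  distinct-length {xs} {ys} d s with embed d s
  ... | ws , zs , π , pw = begin′
    where
    begin′ : length xs ≤ length ys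
    begin′ rewrite pw-length pw | ↭-length π | length-++ ws {zs} = m≤m+n _ _

  distinct-≤-size : ∀ {xs} → Distinct xs → length xs ≤ size
  distinct-≤-size d = distinct-length d (All.universal complete _)

  module _ {xs ys} (d : Distinct xs) (s : All (_∈ ys) xs) (l : length ys ≤ length xs) where
    private
      exhaust : ∃ λ ws → ys ↭ ws × Pointwise _≈_ xs ws
      exhaust with embed d s
      ... | ws , [] , π , pw = ws , trans π (Perm.++-identityʳ ws) , pw
      ... | ws , z ∷ zs , π , pw = contradiction
              (≤-trans (≤-reflexive (≡.trans (sym (length-++ ws)) (sym (↭-length π))))
                (≤-trans l (≤-reflexive (pw-length pw))))
              (m+1+n≰m (length ws))

    distinct-cover : ∀ {y} → y ∈ ys → y ∈ xs
    distinct-cover i with exhaust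
    ... | ws , π , pw = pw-∈ pw (Any-resp-↭ π i)

    distinct-sum : sumL ys ≈ sumL xs
    distinct-sum with exhaust
    ... | ws , π , pw = ≈-trans (sumL-↭ π) (≈-sym (pw-sum pw))

  ∀? : ∀ {P} → Respects P → (∀ x → Dec (P x)) → Dec (∀ x → P x)
  ∀? r P? = map′ (λ ps x → All.lookupWith (λ p e → r (≈-sym e) p) ps (complete x)) (λ f → All.universal f elems) (All.all? P? elems)

  ∃? : ∀ {P} → Respects P → (∀ x → Dec (P x)) → Dec (∃ P)
  ∃? r P? = map′ Any.satisfied (λ { (x , p) → Any.map (λ e → r e p) (complete x) }) (Any.any? P? elems)

  ¬∀⇒∃¬ : ∀ {P} → Respects P → (∀ x → Dec (P x)) → ¬ (∀ x → P x) → ∃ λ x → ¬ P x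
  ¬∀⇒∃¬ r P? ¬f with ∃? (λ e ¬p p → ¬p (r (≈-sym e) p)) (λ x → ¬? (P? x))
  ... | yes w = w
  ... | no ¬w = contradiction (λ x → decidable-stable (P? x) (λ ¬p → ¬w (x , ¬p))) ¬f

  Has : ℕ → (Carrier → Set) → Set
  Has k P = ∃ λ xs → k ≤ length xs × Distinct xs × All P xs

  Has-≤ : ∀ {k l P} → k ≤ l → Has l P → Has k P
  Has-≤ p (xs , q , d , a) = xs , ≤-trans p q , d , a

  Has-map : ∀ {k P Q} (f : Carrier → Carrier) → (∀ {x y} → f x ≈ f y → x ≈ y) →
            (∀ {x} → P x → Q (f x)) → Has k P → Has k Q
  Has-map f inj h (xs , l , d , a) = map f xs , ≤-trans l (≤-reflexive (sym (length-map f xs))) ,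
    AllPairsₚ.map⁺ (AllPairs.map (λ ne e → ne (inj e)) d) , Allₚ.map⁺ (All.map h a)

  Has? : ∀ {P} → Respects P → (∀ x → Dec (P x)) → ∀ k → Dec (Has k P)
  Has? {P} r P? k with k ≤? length (filter P? elems)
  ... | yes l = yes (_ , l , AllPairsₚ.filter⁺ P? distinct , Allₚ.all-filter P? elems)
  ... | no ¬l = no λ { (xs , l , d , a) → ¬l (≤-trans l (distinct-length d (All.map in-filter a))) }
    where
    in-filter : ∀ {x} → P x → x ∈ filter P? elems
    in-filter {x} p = ∈-filter⁺ setoid P? r (complete x) p

  Has-size⇒all : ∀ {P} → Respects P → Has size P → ∀ x → P x
  Has-size⇒all r (xs , l , d , a) x =
    All.lookupWith (λ p e → r (≈-sym e) p) a (distinct-cover d (All.universal complete xs) l (complete x))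

  all⇒Has : ∀ {P} → (∀ x → P x) → Has size P
  all⇒Has f = elems , ≤-refl , distinct , All.universal f elems

  ¬Has⇒exact : ∀ {P} xs → ¬ Has (suc (length xs)) P → Distinct xs → All P xs → ∀ {x} → P x → x ∈ xs
  ¬Has⇒exact xs ¬h d a {x} p with x ∈? xs
  ... | yes i = i
  ... | no ¬i = contradiction (x ∷ xs , ≤-refl , Allₚ.¬Any⇒All¬ xs ¬i ∷ d , p ∷ a) ¬h

  X? : ∀ L x → Dec (X L x)
  X? L x = map′ found (λ { (L′ , p , e) → Any.map (λ { ≡.refl → e }) (arrangements-complete L p) })
                (Any.any? (λ L′ → wsum L′ ≈? x) (arrangements L))
    where
    found : Any (λ L′ → wsum L′ ≈ x) (arrangements L) → X L x
    found i = All.lookupWith (λ {L′} p e → L′ , p , e) (arrangements-sound L) i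

  Has-↭ : ∀ {k L M} → L ↭ M → Has k (X L) → Has k (X M)
  Has-↭ p (xs , l , d , a) = xs , l , d , All.map (X-↭ p) a

  Has-prefix : ∀ {k} A {T} → Has k (X T) → Has k (X (A ++ T))
  Has-prefix A {T} = Has-map (prefix A T ∙_) (cancelˡ _) (X-prefix A)

  X-prefix-all : ∀ A {T} → (∀ x → X T x) → ∀ x → X (A ++ T) x
  X-prefix-all A {T} f x = X-resp (solve (v0 ⊕ (v1 ⊖ v0)) v1 (prefix A T ∷ x ∷ [])) (X-prefix A (f (x - prefix A T)))

  sumL-map-∙ : ∀ x L → sumL (map (_∙ x) L) ≈ sumL L ∙ length L ⋆ x
  sumL-map-∙ x [] = ≈-sym (identityˡ ε)
  sumL-map-∙ x (y ∷ L) = ≈-trans (∙-congˡ (sumL-map-∙ x L))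
    (solve (v0 ⊕ v1 ⊕ (v2 ⊕ v3)) (v0 ⊕ v2 ⊕ (v1 ⊕ v3)) (y ∷ x ∷ sumL L ∷ length L ⋆ x ∷ []))

  -- Translation by `x` permutes the group, so the sum of all elements does not change when
  -- `size ⋆ x` is added to it.
  lagrange : ∀ x → size ⋆ x ≈ ε
  lagrange x = ≈-sym (cancelˡ (sumL elems) (≈-trans (identityʳ _)
    (≈-trans (distinct-sum {map (_∙ x) elems} {elems} (AllPairsₚ.map⁺ (AllPairs.map (λ ne e → ne (cancelʳ x e)) distinct))
      (All.universal complete _) (≤-reflexive (sym (length-map _ elems)))) (sumL-map-∙ x elems))))

  0<size : 0 < size
  0<size with elems | complete ε
  ... | _ ∷ _ | _ = s≤s z≤n

  size-nonZero : NonZero size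
  size-nonZero = >-nonZero 0<size

  ⋆-mod : ∀ n .{{_ : NonZero n}} {x} → n ⋆ x ≈ ε → ∀ k → k ⋆ x ≈ (k % n) ⋆ x
  ⋆-mod n {x} p k = begin
    k ⋆ x                              ≡⟨ cong (_⋆ x) (m≡m%n+[m/n]*n k n) ⟩
    (k % n + k / n * n) ⋆ x            ≈⟨ ×-homo-+ x (k % n) (k / n * n) ⟩
    (k % n) ⋆ x ∙ (k / n * n) ⋆ x      ≈⟨ ∙-congˡ (×-assocˡ x (k / n) n) ⟨
    (k % n) ⋆ x ∙ (k / n) ⋆ (n ⋆ x)    ≈⟨ ∙-congˡ (≈-trans (×-congʳ (k / n) p) (⋆-ε (k / n))) ⟩
    (k % n) ⋆ x ∙ ε                    ≈⟨ identityʳ _ ⟩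
    (k % n) ⋆ x                        ∎

  -- In a finite group the inverse of x is the multiple (size - 1) x, so closure under sums already
  -- describes a subgroup.
  record Closed (P : Carrier → Set) : Set where
    field
      resp : Respects P
      ε∈   : P ε
      ∙∈   : ∀ {x y} → P x → P y → P (x ∙ y)

    ⋆∈ : ∀ k {x} → P x → P (k ⋆ x)
    ⋆∈ zero p = ε∈
    ⋆∈ (suc k) p = ∙∈ p (⋆∈ k p)

    ⁻¹∈ : ∀ {x} → P x → P (x ⁻¹)
    ⁻¹∈ {x} p = resp (≈-sym (multiple size 0<size (lagrange x))) (⋆∈ (size ∸ 1) p)
      where
      multiple : ∀ n → 0 < n → n ⋆ x ≈ ε → x ⁻¹ ≈ (n ∸ 1) ⋆ x
      multiple (suc n) _ e = ≈-sym (via (solve (v0 ⊕ v1 ⊖ ∅) (v1 ⊖ ⊝ v0) (x ∷ n ⋆ x ∷ [])) e)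

    -∈ : ∀ {x y} → P x → P y → P (x - y)
    -∈ p q = ∙∈ p (⁻¹∈ q)

    sum∈ : ∀ {L} → All P L → P (sumL L)
    sum∈ [] = ε∈
    sum∈ (p ∷ ps) = ∙∈ p (sum∈ ps)

    wsum∈ : ∀ {L} → All P L → P (wsum L)
    wsum∈ [] = ε∈
    wsum∈ (p ∷ ps) = ∙∈ (wsum∈ ps) (sum∈ ps)

  order-two-closed : ∀ {d} → 2 ⋆ d ≈ ε → Closed (λ x → x ≈ ε ⊎ x ≈ d)
  order-two-closed {d} 2d≈ε = record
    { resp = λ { e (inj₁ p) → inj₁ (≈-trans (≈-sym e) p) ; e (inj₂ p) → inj₂ (≈-trans (≈-sym e) p) }
    ; ε∈ = inj₁ ≈-refl
    ; ∙∈ = λ { (inj₁ p) (inj₁ q) → inj₁ (≈-trans (∙-cong p q) (identityˡ ε))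
             ; (inj₁ p) (inj₂ q) → inj₂ (≈-trans (∙-cong p q) (identityˡ d))
             ; (inj₂ p) (inj₁ q) → inj₂ (≈-trans (∙-cong p q) (identityʳ d))
             ; (inj₂ p) (inj₂ q) → inj₁ (≈-trans (∙-cong p q) (≈-trans (∙-congˡ (≈-sym (identityʳ d))) 2d≈ε)) } }

  InCoset : (Carrier → Set) → Carrier → List Carrier → Set
  InCoset P g = All (λ s → P (s - g))

  -- The positive form of the hypothesis on cosets: a subgroup with a coset containing all terms is
  -- everything. It is used by choosing a suitable `P`, for instance the multiples of one element.
  Spanning : List Carrier → Set₁
  Spanning L = ∀ P → Closed P → ∀ g → InCoset P g L → ∀ x → P x

  Spanning-↭ : ∀ {L M} → L ↭ M → Spanning L → Spanning M
  Spanning-↭ p s P c g i = s P c g (All-resp-↭ (↭-sym p) i)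

  -- The generated subgroup, with natural coefficients because all orders are finite. Peeling off
  -- one generator at a time makes membership decidable by a bounded search.
  Gen : List Carrier → Carrier → Set
  Gen [] x = x ≈ ε
  Gen (d ∷ ds) x = ∃ λ k → Gen ds (x - k ⋆ d)

  Gen-resp : ∀ ds → Respects (Gen ds)
  Gen-resp [] e p = ≈-trans (≈-sym e) p
  Gen-resp (d ∷ ds) e (k , p) = k , Gen-resp ds (∙-congʳ e) p

  Gen-ε : ∀ ds → Gen ds ε
  Gen-ε [] = ≈-refl
  Gen-ε (d ∷ ds) = 0 , Gen-resp ds (solve ∅ (∅ ⊖ ∅) []) (Gen-ε ds)

  Gen-∙ : ∀ ds {x y} → Gen ds x → Gen ds y → Gen ds (x ∙ y)
  Gen-∙ [] p q = ≈-trans (∙-cong p q) (identityʳ ε)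
  Gen-∙ (d ∷ ds) {x} {y} (k , p) (l , q) = k + l , Gen-resp ds
    (≈-trans (solve (v0 ⊖ v1 ⊕ (v2 ⊖ v3)) (v0 ⊕ v2 ⊖ (v1 ⊕ v3)) (x ∷ k ⋆ d ∷ y ∷ l ⋆ d ∷ []))
      (-‿cong ≈-refl (≈-sym (×-homo-+ d k l)))) (Gen-∙ ds p q)

  Gen-closed : ∀ ds → Closed (Gen ds)
  Gen-closed ds = record { resp = Gen-resp ds ; ε∈ = Gen-ε ds ; ∙∈ = Gen-∙ ds }

  Gen-∷ : ∀ d ds {x} → Gen ds x → Gen (d ∷ ds) x
  Gen-∷ d ds {x} p = 0 , Gen-resp ds (solve v0 (v0 ⊖ ∅) (x ∷ [])) p

  Gen-gens : ∀ ds → All (Gen ds) ds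
  Gen-gens [] = []
  Gen-gens (d ∷ ds) = (1 , Gen-resp ds (solve ∅ (v0 ⊖ (v0 ⊕ ∅)) (d ∷ [])) (Gen-ε ds)) ∷ All.map (Gen-∷ d ds) (Gen-gens ds)

  Gen-min : ∀ {P} → Closed P → ∀ ds → All P ds → ∀ {x} → Gen ds x → P x
  Gen-min c [] [] p = Closed.resp c (≈-sym p) (Closed.ε∈ c)
  Gen-min c (d ∷ ds) (a ∷ as) {x} (k , p) = Closed.resp c (solve (v0 ⊖ v1 ⊕ v1) v0 (x ∷ k ⋆ d ∷ []))
    (Closed.∙∈ c (Gen-min c ds as p) (Closed.⋆∈ c k a))

  Gen? : ∀ ds x → Dec (Gen ds x)
  Gen? [] x = x ≈? ε
  Gen? (d ∷ ds) x = map′ Any.satisfied bounded (Any.any? (λ k → Gen? ds (x - k ⋆ d)) (upTo size))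
    where
    instance _ = size-nonZero
    bounded : Gen (d ∷ ds) x → Any (λ k → Gen ds (x - k ⋆ d)) (upTo size)
    -- The coefficient is reduced modulo the group order, which annihilates `d`.
    bounded (k , p) = Any.map (λ { ≡.refl → Gen-resp ds (-‿cong ≈-refl (⋆-mod size (lagrange d) k)) p }) (∈-upTo⁺ (m%n<n k size))

  record DecSubgroup : Set₁ where
    field
      Mem    : Carrier → Set
      Mem?   : ∀ x → Dec (Mem x)
      closed : Closed Mem
    open Closed closed public

  generated : List Carrier → DecSubgroup
  generated ds = record { Mem = Gen ds ; Mem? = Gen? ds ; closed = Gen-closed ds }

-- Subgroups and quotients as finite groups.

module Subquotients (F : FinGroup) where
  open FinGroup F
  open Finite F
  open import Relation.Binary.Reasoning.Setoid setoid

  module _ (H : DecSubgroup) where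
    open DecSubgroup H

    private
      collect : List Carrier → List (Σ Carrier Mem)
      collect [] = []
      collect (x ∷ xs) with Mem? x
      ... | yes m = (x , m) ∷ collect xs
      ... | no _ = collect xs

      collect-All : ∀ {P : Carrier → Set} {xs} → All P xs → All (P ∘ proj₁) (collect xs)
      collect-All [] = []
      collect-All {xs = x ∷ xs} (p ∷ ps) with Mem? x
      ... | yes m = p ∷ collect-All ps
      ... | no _ = collect-All ps

      collect-distinct : ∀ {xs} → Distinct xs → AllPairs (λ a b → ¬ proj₁ a ≈ proj₁ b) (collect xs)
      collect-distinct [] = []
      collect-distinct {x ∷ xs} (p ∷ ps) with Mem? x
      ... | yes m = collect-All p ∷ collect-distinct ps
      ... | no _ = collect-distinct ps

      collect-complete : ∀ {x xs} → Mem x → x ∈ xs → Any (λ b → x ≈ proj₁ b) (collect xs)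
      collect-complete {x} {y ∷ xs} m i with Mem? y | i
      ... | yes _ | here e = here e
      ... | yes _ | there j = there (collect-complete m j)
      ... | no ¬m | here e = contradiction (resp e m) ¬m
      ... | no ¬m | there j = collect-complete m j

    subgroupᴳ : AbelianGroup 0ℓ 0ℓ
    subgroupᴳ .AbelianGroup.Carrier = Σ Carrier Mem
    subgroupᴳ .AbelianGroup._≈_ a b = proj₁ a ≈ proj₁ b
    subgroupᴳ .AbelianGroup._∙_ a b = proj₁ a ∙ proj₁ b , ∙∈ (proj₂ a) (proj₂ b)
    subgroupᴳ .AbelianGroup.ε = ε , ε∈
    subgroupᴳ .AbelianGroup._⁻¹ a = proj₁ a ⁻¹ , ⁻¹∈ (proj₂ a)
    subgroupᴳ .AbelianGroup.isAbelianGroup = record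
      { isGroup = record
        { isMonoid = record
          { isSemigroup = record
            { isMagma = record
              { isEquivalence = record { refl = ≈-refl ; sym = ≈-sym ; trans = ≈-trans }
              ; ∙-cong = ∙-cong }
            ; assoc = λ _ _ _ → assoc _ _ _ }
          ; identity = (λ _ → identityˡ _) , (λ _ → identityʳ _) }
        ; inverse = (λ _ → inverseˡ _) , (λ _ → inverseʳ _)
        ; ⁻¹-cong = ⁻¹-cong }
      ; comm = λ _ _ → comm _ _ }

    subgroup : FinGroup
    subgroup .FinGroup.G = subgroupᴳ
    subgroup .FinGroup._≈?_ a b = proj₁ a ≈? proj₁ b
    subgroup .FinGroup.elems = collect elems
    subgroup .FinGroup.distinct = collect-distinct distinct
    subgroup .FinGroup.complete a = collect-complete (proj₂ a) (complete (proj₁ a))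

    subgroup-size : ∀ {z} → ¬ Mem z → FinGroup.size subgroup < size
    subgroup-size {z} z∉ = subst (_< size) (length-map proj₁ (FinGroup.elems subgroup))
      (distinct-≤-size {z ∷ map proj₁ (FinGroup.elems subgroup)}
        (Allₚ.map⁺ (All.universal (λ b e → z∉ (resp (≈-sym e) (proj₂ b))) _)
          ∷ AllPairsₚ.map⁺ (FinGroup.distinct subgroup)))

    private
      _≡?_ : ∀ x y → Dec (Mem (x - y))
      x ≡? y = Mem? (x - y)

      reps : List Carrier → List Carrier
      reps [] = []
      reps (x ∷ xs) with Any.any? (x ≡?_) (reps xs)
      ... | yes _ = reps xs
      ... | no _ = x ∷ reps xs

      reps-distinct : ∀ xs → AllPairs (λ a b → ¬ Mem (a - b)) (reps xs)
      reps-distinct [] = []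
      reps-distinct (x ∷ xs) with Any.any? (x ≡?_) (reps xs)
      ... | yes _ = reps-distinct xs
      ... | no ¬i = Allₚ.¬Any⇒All¬ _ ¬i ∷ reps-distinct xs

      ≡-sym : ∀ {x y} → Mem (x - y) → Mem (y - x)
      ≡-sym {x} {y} p = resp (solve (⊝ (v0 ⊖ v1)) (v1 ⊖ v0) (x ∷ y ∷ [])) (⁻¹∈ p)

      ≡-trans : ∀ {x y z} → Mem (x - y) → Mem (y - z) → Mem (x - z)
      ≡-trans {x} {y} {z} p q = resp (solve (v0 ⊖ v1 ⊕ (v1 ⊖ v2)) (v0 ⊖ v2) (x ∷ y ∷ z ∷ [])) (∙∈ p q)

      ≈⇒≡ : ∀ {x y} → x ≈ y → Mem (x - y)
      ≈⇒≡ e = resp (≈-sym (x≈y⇒x-y≈ε e)) ε∈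

      reps-complete : ∀ {x} xs → x ∈ xs → Any (λ y → Mem (x - y)) (reps xs)
      reps-complete (y ∷ xs) i with Any.any? (y ≡?_) (reps xs) | i
      ... | yes j | here e = Any.map (≡-trans (≈⇒≡ e)) j
      ... | yes _ | there k = reps-complete xs k
      ... | no _ | here e = here (≈⇒≡ e)
      ... | no _ | there k = there (reps-complete xs k)

    -- The carrier stays the same and only the equality becomes coarser, so a sequence over the
    -- group is already a sequence over the quotient.
    quotientᴳ : AbelianGroup 0ℓ 0ℓ
    quotientᴳ .AbelianGroup.Carrier = Carrier
    quotientᴳ .AbelianGroup._≈_ x y = Mem (x - y)
    quotientᴳ .AbelianGroup._∙_ = _∙_
    quotientᴳ .AbelianGroup.ε = ε
    quotientᴳ .AbelianGroup._⁻¹ = _⁻¹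
    quotientᴳ .AbelianGroup.isAbelianGroup = record
      { isGroup = record
        { isMonoid = record
          { isSemigroup = record
            { isMagma = record
              { isEquivalence = record { refl = ≈⇒≡ ≈-refl ; sym = ≡-sym ; trans = ≡-trans }
              ; ∙-cong = λ {x} {y} {u} {v} p q → resp (solve (v0 ⊖ v1 ⊕ (v2 ⊖ v3)) (v0 ⊕ v2 ⊖ (v1 ⊕ v3)) (x ∷ y ∷ u ∷ v ∷ [])) (∙∈ p q) }
            ; assoc = λ _ _ _ → ≈⇒≡ (assoc _ _ _) }
          ; identity = (λ _ → ≈⇒≡ (identityˡ _)) , (λ _ → ≈⇒≡ (identityʳ _)) }
        ; inverse = (λ _ → ≈⇒≡ (inverseˡ _)) , (λ _ → ≈⇒≡ (inverseʳ _))
        ; ⁻¹-cong = λ {x} {y} p → resp (solve (⊝ (v0 ⊖ v1)) (⊝ v0 ⊖ ⊝ v1) (x ∷ y ∷ [])) (⁻¹∈ p) }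
      ; comm = λ _ _ → ≈⇒≡ (comm _ _) }

    quotient : FinGroup
    quotient .FinGroup.G = quotientᴳ
    quotient .FinGroup._≈?_ = _≡?_
    quotient .FinGroup.elems = reps elems
    quotient .FinGroup.distinct = reps-distinct elems
    quotient .FinGroup.complete x = reps-complete elems (complete x)

    -- From representatives of different cosets one more element is gained by translating one of
    -- them inside its own coset. This makes a proper quotient strictly smaller, and it supplies the
    -- missing sum in `periodic-bound`.
    distinct-mod : ∀ {xs k} → AllPairs (λ a b → ¬ Mem (a - b)) xs → Mem k → k ≉ ε → 0 < length xs →
                   ∃ λ x → x ∈ xs × Distinct (x ∙ k ∷ xs)
    distinct-mod {x ∷ xs} {k} (p ∷ ps) m k≉ _ = x , here ≈-refl ,
      (((λ e → k≉ (via (solve (v0 ⊕ v1 ⊖ v0) (v1 ⊖ ∅) (x ∷ k ∷ [])) e)) ∷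
        All.map (λ {y} x≢y e → x≢y (resp (≈-sym (via (solve (v0 ⊕ v1 ⊖ v2) (v0 ⊖ v2 ⊖ ⊝ v1) (x ∷ k ∷ y ∷ [])) e)) (⁻¹∈ m))) p)
       ∷ AllPairs.map (λ ne e → ne (≈⇒≡ e)) (p ∷ ps))

    quotient-size : ∀ {k} → Mem k → k ≉ ε → FinGroup.size quotient < size
    quotient-size m k≉ with distinct-mod (FinGroup.distinct quotient) m k≉ (Finite.0<size quotient)
    ... | _ , _ , d = distinct-≤-size d

    Spanning-quotient : ∀ {L} → Spanning L → Finite.Spanning quotient L
    Spanning-quotient s P c g i = s P (record { resp = λ e → C.resp (≈⇒≡ e) ; ε∈ = C.ε∈ ; ∙∈ = C.∙∈ }) g i
      where module C = Finite.Closed c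

-- The two assertions of the induction, and inverting a map on a permuted list.

Bound : FinGroup → Set₁
Bound F = ∀ L → Spanning L → Has ((size ∸ 1) ⊓ length L) (X L)
  where open FinGroup F ; open Finite F

-- The filling subsequence `T` has exactly |G| terms, so that when this is applied in a subgroup the
-- terms in `R` remain free to be placed around an essential term.
Full : FinGroup → Set₁
Full F = ∀ L → Spanning L → size < length L →
  ∃ λ R → ∃ λ T → L ↭ R ++ T × length T ≡ size × (∀ x → X T x)
  where open FinGroup F ; open Finite F

map-++-inv : ∀ {A B : Set} (f : A → B) xs as {bs} → map f xs ≡ as ++ bs →
  ∃ λ ys → ∃ λ zs → xs ≡ ys ++ zs × length ys ≡ length as × map f zs ≡ bs
map-++-inv f xs [] e = [] , xs , ≡.refl , ≡.refl , e
map-++-inv f (x ∷ xs) (a ∷ as) e with map-++-inv f xs as (∷-injectiveʳ e)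
... | ys , zs , ≡.refl , l , s = x ∷ ys , zs , ≡.refl , cong suc l , s

↭-map-++-inv : ∀ {A B : Set} (f : A → B) xs as {bs} → map f xs ↭ as ++ bs →
  ∃ λ ys → ∃ λ zs → xs ↭ ys ++ zs × length ys ≡ length as × map f zs ≡ bs
↭-map-++-inv f xs as p with ↭-map-inv f p
... | vs , e , q with map-++-inv f vs as (sym e)
... | ys , zs , ≡.refl , l , s = ys , zs , q , l , s

-- Affine hulls, and the passage to the subgroup that they span.

module Hulls (F : FinGroup) where
  open FinGroup F
  open Finite F
  open Subquotients F
  open import Relation.Binary.Reasoning.Setoid setoid

  module Lift (H : DecSubgroup) (g : Carrier) where
    open DecSubgroup H
    private
      module FH = FinGroup (subgroup H)
      module SH = Finite (subgroup H)

    -- Made total by the default value ε outside the coset, so that it can be mapped over lists and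
    -- inverted on permutations; the lemmas about it assume membership in the coset.
    lift : Carrier → Σ Carrier Mem
    lift s with Mem? (s - g)
    ... | yes m = s - g , m
    ... | no _ = ε , ε∈

    lift-≈ : ∀ {s} → Mem (s - g) → proj₁ (lift s) ≈ s - g
    lift-≈ {s} m with Mem? (s - g)
    ... | yes _ = ≈-refl
    ... | no ¬m = contradiction m ¬m

    sumL-lift : ∀ {L} → InCoset Mem g L → proj₁ (FH.sumL (map lift L)) ≈ sumL (map (_- g) L)
    sumL-lift [] = ≈-refl
    sumL-lift (m ∷ ms) = ∙-cong (lift-≈ m) (sumL-lift ms)

    wsum-lift : ∀ {L} → InCoset Mem g L → proj₁ (FH.wsum (map lift L)) ≈ wsum (map (_- g) L)
    wsum-lift [] = ≈-refl
    wsum-lift (m ∷ ms) = ∙-cong (wsum-lift ms) (sumL-lift ms)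

    X-lift : ∀ {T} → InCoset Mem g T → ∀ {x} → FH.X (map lift T) x → X T (proj₁ x ∙ triangle (length T) g)
    X-lift {T} i {x} (L̂ , p , e) with ↭-map-inv lift (↭-sym p)
    ... | L , ≡.refl , q = L , ↭-sym q , (begin
      wsum L                                              ≈⟨ wsum-translate g L ⟩
      wsum (map (_- g) L) ∙ triangle (length L) g         ≈⟨ ∙-congʳ (wsum-lift (All-resp-↭ q i)) ⟨
      proj₁ (FH.wsum (map lift L)) ∙ triangle (length L) g ≈⟨ ∙-congʳ e ⟩
      proj₁ x ∙ triangle (length L) g                     ≡⟨ cong (λ n → proj₁ x ∙ triangle n g) (↭-length q) ⟨
      proj₁ x ∙ triangle (length T) g                     ∎)

    Has-lift : ∀ {T k} → InCoset Mem g T → SH.Has k (FH.X (map lift T)) → Has k (X T)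
    Has-lift {T} i (xs , l , d , a) = map f xs , subst (_ ≤_) (sym (length-map f xs)) l ,
      AllPairsₚ.map⁺ (AllPairs.map (λ ne e → ne (cancelʳ _ e)) d) , Allₚ.map⁺ (All.map (λ {x} → X-lift i {x}) a)
      where
      f : Σ Carrier Mem → Carrier
      f x = proj₁ x ∙ triangle (length T) g

    Bound-lift : Bound (subgroup H) → ∀ {T} → InCoset Mem g T → SH.Spanning (map lift T) →
                 Has ((FH.size ∸ 1) ⊓ length T) (X T)
    Bound-lift b {T} i s = Has-lift i (subst (λ n → SH.Has ((FH.size ∸ 1) ⊓ n) (FH.X (map lift T))) (length-map lift T) (b (map lift T) s))

    Full-lift : Full (subgroup H) → ∀ {T} → InCoset Mem g T → SH.Spanning (map lift T) → FH.size < length T →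
      ∃ λ R → ∃ λ U → T ↭ R ++ U × length U ≡ FH.size × (∀ x → Mem (x - triangle (length U) g) → X U x)
    Full-lift f {T} i s l =
      let R̂ , Û , p , lU , all = f (map lift T) s (subst (FH.size <_) (sym (length-map lift T)) l)
          R , U , q , _ , eU = ↭-map-++-inv lift T R̂ p
      in R , U , q , ≡.trans (sym (length-map lift U)) (≡.trans (cong length eU) lU) ,
         λ x m → X-resp (solve (v0 ⊖ v1 ⊕ v1) v0 (x ∷ triangle (length U) g ∷ []))
           (X-lift (proj₂ (Allₚ.++⁻ R (All-resp-↭ q i))) {x - triangle (length U) g , m}
             (subst (λ V → FH.X V (x - triangle (length U) g , m)) (sym eU) (all (x - triangle (length U) g , m))))

    size-≤ : ∀ ys → (∀ x → Mem x → x ∈ ys) → FH.size ≤ length ys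
    size-≤ ys f = subst (_≤ length ys) (length-map proj₁ FH.elems)
      (distinct-length (AllPairsₚ.map⁺ FH.distinct) (Allₚ.map⁺ (All.universal (λ x → f (proj₁ x) (proj₂ x)) FH.elems)))

    subgroup-lagrange : ∀ {d} → Mem d → FH.size ⋆ d ≈ ε
    subgroup-lagrange {d} m = ≈-trans (≈-sym (proj-⋆ FH.size)) (SH.lagrange (d , m))
      where
      proj-⋆ : ∀ k → proj₁ (k FH.⋆ (d , m)) ≈ k ⋆ d
      proj-⋆ zero = ≈-refl
      proj-⋆ (suc k) = ∙-congˡ (proj-⋆ k)

    lift-difference : ∀ {y v} → Mem (y - g) → Mem (v - g) → proj₁ (lift y) - proj₁ (lift v) ≈ y - v
    lift-difference {y} {v} m m′ = ≈-trans (-‿cong (lift-≈ m) (lift-≈ m′))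
      (solve (v0 ⊖ v2 ⊖ (v1 ⊖ v2)) (v0 ⊖ v1) (y ∷ v ∷ g ∷ []))

    span-relative : ∀ {T v} → InCoset Mem g T → SH.Spanning (map lift T) → Mem (v - g) →
                    ∀ P → Closed P → InCoset P v T → ∀ x → Mem x → P x
    span-relative {T} {v} i s mv P cl a x m = s Q cQ (lift v) (Allₚ.map⁺ (All.zipWith step (i , a))) (x , m)
      where
      Q : FH.Carrier → Set
      Q y = P (proj₁ y)
      cQ : SH.Closed Q
      cQ = record { resp = λ e p → Closed.resp cl e p ; ε∈ = Closed.ε∈ cl ; ∙∈ = λ p q → Closed.∙∈ cl p q }
      step : ∀ {y} → Mem (y - g) × P (y - v) → P (proj₁ (lift y) - proj₁ (lift v))
      step (my , p) = Closed.resp cl (≈-sym (lift-difference my mv)) p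

  -- The smallest coset `g` + `H` containing `T`, in the case where `H` is proper. Since the lifted
  -- terms span `H`, the induction hypothesis applies to them inside `H`.
  record ProperHull (T : List Carrier) : Set₁ where
    field
      H : DecSubgroup
      g : Carrier
    open DecSubgroup H public
    open Lift H g public
    field
      inCoset : InCoset Mem g T
      spans   : Finite.Spanning (subgroup H) (map lift T)
      outside : Carrier
      ∉H      : ¬ Mem outside

    h : ℕ
    h = FinGroup.size (subgroup H)

  module _ (p : Carrier) (ps : List Carrier) where
    private
      ds = map (_- p) (p ∷ ps)

      in-coset : InCoset (Gen ds) p (p ∷ ps)
      in-coset = Allₚ.map⁻ (Gen-gens ds)

      open Lift (generated ds) p

      spans : Finite.Spanning (subgroup (generated ds)) (map lift (p ∷ ps))
      -- `Q` speaks of pairs with a membership proof; it is pushed to a predicate on the whole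
      -- group, to which minimality of the generated subgroup applies.
      spans Q c ĝ i (x , m) = C.resp ≈-refl (proj₂ (Gen-min {λ x → ∃ λ m → Q (x , m)}
        (record { resp = λ e (m , q) → Gen-resp ds e m , C.resp e q ; ε∈ = Gen-ε ds , C.ε∈ ; ∙∈ = λ (m , q) (m′ , q′) → Gen-∙ ds m m′ , C.∙∈ q q′ })
        ds (Allₚ.map⁺ (All.zipWith (λ {s} (m , q) → m , C.resp (difference s m) (C.-∈ q (All.head î))) (in-coset , î))) m))
        where
        module C = Finite.Closed c
        î = Allₚ.map⁻ i
        difference : ∀ s → Gen ds (s - p) → (proj₁ (lift s) - proj₁ ĝ) - (proj₁ (lift p) - proj₁ ĝ) ≈ s - p
        difference s m = begin
          (proj₁ (lift s) - proj₁ ĝ) - (proj₁ (lift p) - proj₁ ĝ)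
            ≈⟨ solve (v0 ⊖ v2 ⊖ (v1 ⊖ v2)) (v0 ⊖ v1) (proj₁ (lift s) ∷ proj₁ (lift p) ∷ proj₁ ĝ ∷ []) ⟩
          proj₁ (lift s) - proj₁ (lift p) ≈⟨ -‿cong (lift-≈ m) (lift-≈ (All.head in-coset)) ⟩
          s - p - (p - p) ≈⟨ solve (v0 ⊖ v1 ⊖ (v1 ⊖ v1)) (v0 ⊖ v1) (s ∷ p ∷ []) ⟩
          s - p ∎

      all-generated⇒Spanning : (∀ x → Gen ds x) → Spanning (p ∷ ps)
      all-generated⇒Spanning f P c g i x = Gen-min c ds (Allₚ.map⁺ (All.map (λ {s} q →
        Closed.resp c (solve (v0 ⊖ v2 ⊖ (v1 ⊖ v2)) (v0 ⊖ v1) (s ∷ p ∷ g ∷ [])) (Closed.-∈ c q (All.head i))) i)) (f x)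

    spanning-or-hull : Spanning (p ∷ ps) ⊎ ProperHull (p ∷ ps)
    spanning-or-hull with ∀? (Gen-resp ds) (Gen? ds)
    ... | yes f = inj₁ (all-generated⇒Spanning f)
    ... | no ¬f = inj₂ (record
      { H = generated ds ; g = p ; inCoset = in-coset ; spans = spans
      ; outside = proj₁ (¬∀⇒∃¬ (Gen-resp ds) (Gen? ds) ¬f) ; ∉H = proj₂ (¬∀⇒∃¬ (Gen-resp ds) (Gen? ds) ¬f) })

-- Generators, nearly constant sequences, and removable terms.

module Cyclicity (F : FinGroup) where
  open FinGroup F
  open Finite F
  open import Relation.Binary.Reasoning.Setoid setoid

  Generates : Carrier → Set
  Generates w = ∀ x → ∃ λ k → x ≈ k ⋆ w

  multiples-closed : ∀ w → Closed (λ x → ∃ λ k → x ≈ k ⋆ w)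
  multiples-closed w = record
    { resp = λ e (k , p) → k , ≈-trans (≈-sym e) p
    ; ε∈ = 0 , ≈-refl
    ; ∙∈ = λ (k , p) (l , q) → k + l , ≈-trans (∙-cong p q) (≈-sym (×-homo-+ w k l)) }

  -- The multiples of `w` with coefficient below `k` already cover the group. Many contradictions
  -- below consist in a small annihilator of a generator.
  order-≥-size : ∀ {w} → Generates w → ∀ k → 0 < k → k ⋆ w ≈ ε → size ≤ k
  order-≥-size {w} gen k 0<k e = subst (size ≤_) (≡.trans (length-map (_⋆ w) (upTo k)) (length-upTo k))
    (distinct-length distinct (All.universal covered elems))
    where
    instance _ = >-nonZero 0<k
    covered : ∀ x → x ∈ map (_⋆ w) (upTo k)
    covered x with gen x
    ... | l , p = Anyₚ.map⁺ (Any.map (λ { ≡.refl → ≈-trans p (⋆-mod k e l) }) (∈-upTo⁺ (m%n<n l k)))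

  ⋆-∸ : ∀ w {i j} → i ≤ j → j ⋆ w - i ⋆ w ≈ (j ∸ i) ⋆ w
  ⋆-∸ w {i} {j} i≤j = begin
    j ⋆ w - i ⋆ w                   ≡⟨ cong (λ k → k ⋆ w - i ⋆ w) (m+[n∸m]≡n i≤j) ⟨
    (i + (j ∸ i)) ⋆ w - i ⋆ w       ≈⟨ ∙-congʳ (×-homo-+ w i (j ∸ i)) ⟩
    i ⋆ w ∙ (j ∸ i) ⋆ w - i ⋆ w     ≈⟨ solve (v0 ⊕ v1 ⊖ v0) v1 (i ⋆ w ∷ (j ∸ i) ⋆ w ∷ []) ⟩
    (j ∸ i) ⋆ w                     ∎

  ⋆-injective : ∀ {w n} → (∀ k → 0 < k → k ⋆ w ≈ ε → n ≤ k) → ∀ {i j} → i < j → j < n → i ⋆ w ≉ j ⋆ w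
  ⋆-injective {w} {n} order {i} {j} i<j j<n e = <⇒≱ (≤-<-trans (m∸n≤m j i) j<n)
    (order (j ∸ i) (m<n⇒0<n∸m i<j) (≈-trans (≈-sym (⋆-∸ w (<⇒≤ i<j))) (x≈y⇒x-y≈ε (≈-sym e))))

  constant-generates : ∀ {s T x} → Spanning (s ∷ T) → All (_≈ x) T → Generates (s - x)
  constant-generates {s} {T} {x} sp a = sp _ (multiples-closed (s - x)) x
    ((1 , ≈-sym (identityʳ _)) ∷ All.map (λ e → 0 , x≈y⇒x-y≈ε e) a)

  constant-sum : ∀ {L x} → All (_≈ x) L → sumL L ≈ length L ⋆ x
  constant-sum [] = ≈-refl
  constant-sum (e ∷ a) = ∙-cong e (constant-sum a)

  constant-wsum : ∀ {L x} → All (_≈ x) L → wsum L ≈ triangle (length L) x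
  constant-wsum [] = ≈-refl
  constant-wsum {y ∷ L} {x} (e ∷ a) = ∙-cong (constant-wsum a) (≈-trans (constant-sum a) (≈-sym (sumL-replicate (length L) x)))

  constant-shift : ∀ {s x} A B → All (_≈ x) A → wsum (A ++ s ∷ B) ≈ wsum (s ∷ A ++ B) ∙ length A ⋆ (s - x)
  constant-shift {s} [] B [] = solve v0 (v0 ⊕ ∅) (wsum (s ∷ B) ∷ [])
  constant-shift {s} {x} (y ∷ A) B (e ∷ a) = begin
    wsum (A ++ s ∷ B) ∙ sumL (A ++ s ∷ B) ≈⟨ ∙-cong (constant-shift A B a) (sumL-↭ (shift s A B)) ⟩
    wsum (A ++ B) ∙ sumL (A ++ B) ∙ length A ⋆ (s - x) ∙ (s ∙ sumL (A ++ B))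
      ≈⟨ solve (v0 ⊕ v1 ⊕ v2 ⊕ (v3 ⊕ v1)) (v0 ⊕ v1 ⊕ (v4 ⊕ v1) ⊕ (v3 ⊖ v4 ⊕ v2))
           (wsum (A ++ B) ∷ sumL (A ++ B) ∷ length A ⋆ (s - x) ∷ s ∷ y ∷ []) ⟩
    wsum (A ++ B) ∙ sumL (A ++ B) ∙ (y ∙ sumL (A ++ B)) ∙ (s - y ∙ length A ⋆ (s - x))
      ≈⟨ ∙-congˡ (∙-congʳ (-‿cong ≈-refl e)) ⟩
    wsum (A ++ B) ∙ sumL (A ++ B) ∙ (y ∙ sumL (A ++ B)) ∙ (s - x ∙ length A ⋆ (s - x)) ∎

  -- Each term `x` that `s` moves past adds one more `s - x`, so these sums form an arithmetic
  -- progression.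
  constant-X : ∀ {s x} T → All (_≈ x) T → ∀ j → j ≤ length T → X (s ∷ T) (wsum (s ∷ T) ∙ j ⋆ (s - x))
  constant-X {s} {x} T a j l = A ++ s ∷ B , trans (shift s A B) (prep s (↭-reflexive e)) ,
    (begin
      wsum (A ++ s ∷ B) ≈⟨ constant-shift A B (Allₚ.take⁺ j a) ⟩
      wsum (s ∷ A ++ B) ∙ length A ⋆ (s - x) ≡⟨ cong₂ (λ L n → wsum (s ∷ L) ∙ n ⋆ (s - x)) e (≡.trans (length-take j T) (m≤n⇒m⊓n≡m l)) ⟩
      wsum (s ∷ T) ∙ j ⋆ (s - x) ∎)
    where
    A = take j T
    B = drop j T
    e : A ++ B ≡ T
    e = take++drop≡id j T

  constant-Has : ∀ {s x T} → Spanning (s ∷ T) → All (_≈ x) T → Has (size ⊓ suc (length T)) (X (s ∷ T))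
  constant-Has {s} {x} {T} sp a = applyUpTo f n , ≤-reflexive (sym (length-applyUpTo f n)) ,
    AllPairsₚ.applyUpTo⁺₁ f n (λ i<j j<n e → ⋆-injective (order-≥-size (constant-generates sp a)) i<j
      (<-≤-trans j<n (m⊓n≤m size _)) (cancelˡ _ e)) ,
    Allₚ.applyUpTo⁺₁ f n (λ {i} i<n → constant-X T a i (≤-pred (<-≤-trans i<n (m⊓n≤n size _))))
    where
    n = size ⊓ suc (length T)
    f : ℕ → Carrier
    f j = wsum (s ∷ T) ∙ j ⋆ (s - x)

  constant-or-pair : ∀ p ps → All (_≈ p) ps ⊎ ∃ λ v → ∃ λ T → p ∷ ps ↭ p ∷ v ∷ T × p ≉ v
  constant-or-pair p ps with All.all? (_≈? p) ps
  ... | yes a = inj₁ a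
  ... | no ¬a with extract (Allₚ.¬All⇒Any¬ (_≈? p) ps ¬a)
  ... | v , T , ne , π = inj₂ (v , T , prep p π , λ e → ne (≈-sym e))

  duplicate-or-distinct : ∀ L → Distinct L ⊎ ∃ λ u → ∃ λ u′ → ∃ λ T → L ↭ u ∷ u′ ∷ T × u ≈ u′
  duplicate-or-distinct [] = inj₁ []
  duplicate-or-distinct (x ∷ L) with x ∈? L
  ... | yes i with extract i
  ... | y , T , e , π = inj₂ (x , y , T , prep x π , e)
  duplicate-or-distinct (x ∷ L) | no ¬i with duplicate-or-distinct L
  ... | inj₁ d = inj₁ (Allₚ.¬Any⇒All¬ L ¬i ∷ d)
  ... | inj₂ (u , u′ , T , π , e) = inj₂ (u , u′ , x ∷ T , trans (prep x π) (trans (swap x u refl) (prep u (swap x u′ refl))) , e)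

  Spanning-dup : ∀ {u u′ T} → u ≈ u′ → Spanning (u ∷ u′ ∷ T) → Spanning (u′ ∷ T)
  Spanning-dup e s P c g (i ∷ is) = s P c g (Closed.resp c (∙-congʳ (≈-sym e)) i ∷ i ∷ is)

  Spanning-∷ : ∀ {s T} → Spanning T → Spanning (s ∷ T)
  Spanning-∷ sp P c g (_ ∷ i) = sp P c g i

  -- L lists all of G, so t + (p − r) is one of the remaining terms.
  distinct-removable : ∀ {t p r L} → Distinct (t ∷ p ∷ r ∷ L) → size ≤ length (t ∷ p ∷ r ∷ L) →
                       Spanning (t ∷ p ∷ r ∷ L) → Spanning (p ∷ r ∷ L)
  distinct-removable {t} {p} {r} {L} (t≉ ∷ d@((p≉r ∷ _) ∷ _)) l sp P c g i@(ip ∷ ir ∷ _) =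
    sp P c g (P-t (distinct-cover (t≉ ∷ d) (All.universal complete _) l (complete (t ∙ (p - r)))) ∷ i)
    where
    P-t : t ∙ (p - r) ∈ t ∷ p ∷ r ∷ L → P (t - g)
    P-t (here e) = contradiction (via (solve (v0 ⊕ (v1 ⊖ v2) ⊖ v0) (v1 ⊖ v2) (t ∷ p ∷ r ∷ [])) e) p≉r
    P-t (there j) = All.lookupWith (λ {y} q e → Closed.resp c (begin
        y - g - (p - g - (r - g)) ≈⟨ ∙-congʳ (∙-congʳ (≈-sym e)) ⟩
        t ∙ (p - r) - g - (p - g - (r - g))
          ≈⟨ solve (v0 ⊕ (v1 ⊖ v2) ⊖ v3 ⊖ (v1 ⊖ v3 ⊖ (v2 ⊖ v3))) (v0 ⊖ v3) (t ∷ p ∷ r ∷ g ∷ []) ⟩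
        t - g ∎) (Closed.-∈ c q (Closed.-∈ c ip ir))) i j

  -- Either two terms agree and one of them is redundant, or `L` lists the whole group and each term
  -- is recovered from differences of the others.
  removable : ∀ L → Spanning L → 3 ≤ length L → size ≤ length L → ∃ λ t → ∃ λ T → L ↭ t ∷ T × Spanning T
  removable L sp l₃ l with duplicate-or-distinct L
  ... | inj₂ (u , u′ , T , π , e) = u , u′ ∷ T , π , Spanning-dup e (Spanning-↭ π sp)
  removable (t ∷ p ∷ r ∷ L) sp l₃ l | inj₁ d = t , p ∷ r ∷ L , refl , distinct-removable d l sp
  removable (_ ∷ _ ∷ []) sp (s≤s (s≤s ())) l | inj₁ d
  removable (_ ∷ []) sp (s≤s ()) l | inj₁ d

-- Essential terms: sums spread over the cosets of a proper subgroup.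

least : ∀ {P : ℕ → Set} → (∀ n → Dec (P n)) → ∀ n → P n → ∃ λ k → P k × (∀ j → P j → k ≤ j)
least P? zero p = 0 , p , λ _ _ → z≤n
least {P} P? (suc n) p with P? 0
... | yes p₀ = 0 , p₀ , λ _ _ → z≤n
... | no ¬p₀ with least (λ k → P? (suc k)) n p
... | k , pk , min = suc k , pk , λ { zero q → contradiction q ¬p₀ ; (suc j) q → s≤s (min j q) }

-- Here S \ s = T lies in a coset g + H of a proper subgroup H, which T spans. Giving s the weight j
-- puts the sum into the coset c + j b + H with b = s − g, and these are distinct for j < q.
module Essential (F : FinGroup) (s : FinGroup.Carrier F) (T : List (FinGroup.Carrier F))
                 (sp : Finite.Spanning F (s ∷ T)) (hull : Hulls.ProperHull F T) where
  open FinGroup F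
  open Finite F
  open Subquotients F
  open Hulls F
  open Cyclicity F
  open ProperHull hull
  open import Relation.Binary.Reasoning.Setoid setoid
  module FH = FinGroup (subgroup H)
  module SH = Finite (subgroup H)

  t : ℕ
  t = length T

  b c : Carrier
  b = s - g
  c = triangle (suc t) g

  b∉H : ¬ Mem b
  b∉H m = ∉H (sp Mem closed g (m ∷ inCoset) outside)

  abstract
    -- Searches for the order of `b` modulo `H`, recorded as its predecessor `q₀`. As `s` and `T`
    -- span, this order is the index of `H`, and `q₀` counts the cosets besides the one for weight
    -- 0.
    q-search : ∃ λ k → Mem (suc k ⋆ b) × (∀ j → Mem (suc j ⋆ b) → k ≤ j)
    q-search = least (λ k → Mem? (suc k ⋆ b)) (size ∸ 1)
      (resp (≈-sym (≈-trans (×-congˡ (m+[n∸m]≡n 0<size)) (lagrange b))) ε∈)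

    q₀ : ℕ
    q₀ = proj₁ q-search

    q₀-mem : Mem (suc q₀ ⋆ b)
    q₀-mem = proj₁ (proj₂ q-search)

    q₀-min : ∀ j → Mem (suc j ⋆ b) → q₀ ≤ j
    q₀-min = proj₂ (proj₂ q-search)

  1≤q₀ : 1 ≤ q₀
  1≤q₀ = n≢0⇒n>0 λ e → b∉H (resp (identityʳ b) (subst (λ k → Mem (suc k ⋆ b)) e q₀-mem))

  Coset : ℕ → Carrier → Set
  Coset j x = Mem (x - c - j ⋆ b)

  record InC (j : ℕ) (x : Carrier) : Set where
    constructor _,_
    field
      inX     : X (s ∷ T) x
      inCoset : Coset j x
  open InC public using (inX) renaming (inCoset to at)

  InC-resp : ∀ {j} → Respects (InC j)
  InC-resp e (p , q) = X-resp e p , resp (∙-congʳ (∙-congʳ e)) q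

  cosets-disjoint : ∀ {i j x y} → i < j → j ≤ q₀ → Coset i x → Coset j y → x ≉ y
  cosets-disjoint {i} {j} {x} {y} i<j j≤q₀ p q e = too-small (j ∸ i) (m<n⇒0<n∸m i<j) (≤-trans (m∸n≤m j i) j≤q₀)
    (resp (begin
      x - c - i ⋆ b - (y - c - j ⋆ b) ≈⟨ ∙-congʳ (∙-congʳ (∙-congʳ e)) ⟩
      y - c - i ⋆ b - (y - c - j ⋆ b)
        ≈⟨ solve (v0 ⊖ v1 ⊖ v2 ⊖ (v0 ⊖ v1 ⊖ v3)) (v3 ⊖ v2) (y ∷ c ∷ i ⋆ b ∷ j ⋆ b ∷ []) ⟩
      j ⋆ b - i ⋆ b ≈⟨ ⋆-∸ b (<⇒≤ i<j) ⟩
      (j ∸ i) ⋆ b ∎) (-∈ p q))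
    where
    too-small : ∀ k → 0 < k → k ≤ q₀ → ¬ Mem (k ⋆ b)
    too-small (suc k) _ l m = <⇒≱ l (q₀-min k m)

  coset-of : ∀ x → ∃ λ j → j ≤ q₀ × Coset j x
  coset-of x with sp (λ y → ∃ λ k → Mem (y - k ⋆ b)) cl g
                    ((1 , resp (solve ∅ (v0 ⊖ (v0 ⊕ ∅)) (b ∷ [])) ε∈) ∷
                      All.map (λ {y} m → 0 , resp (solve v0 (v0 ⊖ ∅) (y - g ∷ [])) m) inCoset) (x - c)
    where
    cl : Closed (λ y → ∃ λ k → Mem (y - k ⋆ b))
    cl = record
      { resp = λ e (k , m) → k , resp (∙-congʳ e) m
      ; ε∈ = 0 , resp (solve ∅ (∅ ⊖ ∅) []) ε∈
      ; ∙∈ = λ {y} {z} (k , m) (l , m′) → k + l , resp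
          (≈-trans (solve (v0 ⊖ v1 ⊕ (v2 ⊖ v3)) (v0 ⊕ v2 ⊖ (v1 ⊕ v3)) (y ∷ k ⋆ b ∷ z ∷ l ⋆ b ∷ []))
            (-‿cong ≈-refl (≈-sym (×-homo-+ b k l)))) (∙∈ m m′) }
  ... | k , m = k % suc q₀ , ≤-pred (m%n<n k (suc q₀)) ,
    resp (∙-congˡ (⁻¹-cong ≈-refl)) (resp (begin
      x - c - k ⋆ b ∙ (k / suc q₀) ⋆ (suc q₀ ⋆ b) ≈⟨ ∙-cong (-‿cong ≈-refl (≈-trans (×-congˡ (m≡m%n+[m/n]*n k (suc q₀))) (×-homo-+ b (k % suc q₀) (k / suc q₀ * suc q₀)))) (×-assocˡ b (k / suc q₀) (suc q₀)) ⟩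
      x - c - ((k % suc q₀) ⋆ b ∙ (k / suc q₀ * suc q₀) ⋆ b) ∙ (k / suc q₀ * suc q₀) ⋆ b
        ≈⟨ solve (v0 ⊖ (v1 ⊕ v2) ⊕ v2) (v0 ⊖ v1) (x - c ∷ (k % suc q₀) ⋆ b ∷ (k / suc q₀ * suc q₀) ⋆ b ∷ []) ⟩
      x - c - (k % suc q₀) ⋆ b ∎) (∙∈ m (⋆∈ (k / suc q₀) q₀-mem)))

  -- After translation by `g` all terms lie in `H` except `s`, which becomes `b` and has weight |A|.
  place-coset : ∀ A B → InCoset Mem g A → InCoset Mem g B →
                Mem (wsum (A ++ s ∷ B) - triangle (length (A ++ s ∷ B)) g - length A ⋆ b)
  place-coset A B a b′ = resp (≈-sym (begin
    wsum L - triangle (length L) g - length A ⋆ b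
      ≈⟨ ∙-congʳ (∙-congʳ (wsum-translate g L)) ⟩
    wsum (map (_- g) L) ∙ triangle (length L) g - triangle (length L) g - length A ⋆ b
      ≡⟨ cong (λ M → wsum M ∙ triangle (length L) g - triangle (length L) g - length A ⋆ b) (map-++ (_- g) A (s ∷ B)) ⟩
    wsum (A′ ++ b ∷ B′) ∙ triangle (length L) g - triangle (length L) g - length A ⋆ b
      ≈⟨ ∙-congʳ (∙-congʳ (∙-congʳ (wsum-++ A′ (b ∷ B′)))) ⟩
    wsum A′ ∙ length A′ ⋆ (b ∙ sumL B′) ∙ (wsum B′ ∙ sumL B′) ∙ triangle (length L) g - triangle (length L) g - length A ⋆ b
      ≈⟨ ∙-congʳ (∙-congʳ (∙-congʳ (∙-congʳ (∙-congˡ (≈-trans (×-congˡ (length-map (_- g) A)) (⋆-distrib b (sumL B′) (length A))))))) ⟩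
    wsum A′ ∙ (length A ⋆ b ∙ length A ⋆ sumL B′) ∙ (wsum B′ ∙ sumL B′) ∙ triangle (length L) g - triangle (length L) g - length A ⋆ b
      ≈⟨ solve (v0 ⊕ (v1 ⊕ v2) ⊕ (v3 ⊕ v4) ⊕ v5 ⊖ v5 ⊖ v1) (v0 ⊕ v2 ⊕ (v3 ⊕ v4))
           (wsum A′ ∷ length A ⋆ b ∷ length A ⋆ sumL B′ ∷ wsum B′ ∷ sumL B′ ∷ triangle (length L) g ∷ []) ⟩
    wsum A′ ∙ length A ⋆ sumL B′ ∙ (wsum B′ ∙ sumL B′) ∎))
    (∙∈ (∙∈ (wsum∈ (Allₚ.map⁺ a)) (⋆∈ (length A) (sum∈ (Allₚ.map⁺ b′)))) (∙∈ (wsum∈ (Allₚ.map⁺ b′)) (sum∈ (Allₚ.map⁺ b′))))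
    where
    L = A ++ s ∷ B
    A′ = map (_- g) A
    B′ = map (_- g) B

  place : ∀ A B → A ++ B ↭ T → InC (length A) (wsum (A ++ s ∷ B))
  place A B π = (A ++ s ∷ B , σ , ≈-refl) ,
    subst (λ n → Mem (wsum (A ++ s ∷ B) - triangle n g - length A ⋆ b)) (↭-length σ) (place-coset A B (proj₁ i) (proj₂ i))
    where
    σ = trans (shift s A B) (prep s π)
    i = Allₚ.++⁻ A (All-resp-↭ (↭-sym π) inCoset)

  -- Only the tail `U` is rearranged, so `s` keeps its weight and every resulting sum stays in the
  -- same coset.
  place-X : ∀ A R {U x} → A ++ R ++ U ↭ T → X U x → InC (length A) (prefix (A ++ s ∷ R) U ∙ x)
  place-X A R {U} {x} π (L , p , e) = InC-resp {length A} (begin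
      wsum (A ++ s ∷ R ++ L)               ≡⟨ cong wsum (++-assoc A (s ∷ R) L) ⟨
      wsum ((A ++ s ∷ R) ++ L)             ≈⟨ wsum-++ (A ++ s ∷ R) L ⟩
      prefix (A ++ s ∷ R) L ∙ wsum L       ≈⟨ ∙-cong (∙-congˡ (×-congʳ (length (A ++ s ∷ R)) (sumL-↭ p))) e ⟩
      prefix (A ++ s ∷ R) U ∙ x            ∎)
    (place A (R ++ L) (trans (Perm.++⁺ˡ A (Perm.++⁺ˡ R p)) π))

  HasC : ℕ → ℕ → Set
  HasC k j = Has k (InC j)

  HasC-X : ∀ {k} A R {U} → A ++ R ++ U ↭ T → Has k (X U) → HasC k (length A)
  HasC-X A R {U} π = Has-map (prefix (A ++ s ∷ R) U ∙_) (cancelˡ _) (place-X A R π)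

  union : ∀ {a} k d → k ≤ q₀ → HasC a 0 → (∀ j → 1 ≤ j → j ≤ k → HasC d j) →
          Has (a + k * d) (λ x → ∃ λ j → j ≤ k × InC j x)
  union {a} zero d _ (xs , l , dx , ax) f = xs , subst (_≤ length xs) (sym (+-identityʳ a)) l , dx , All.map (λ p → 0 , z≤n , p) ax
  union {a} (suc k) d k≤ h₀ f with union k d (<⇒≤ k≤) h₀ (λ j p q → f j p (m≤n⇒m≤1+n q)) | f (suc k) (s≤s z≤n) ≤-refl
  ... | xs , l , dx , ax | ys , l′ , dy , ay = ys ++ xs ,
    (subst (_≤ length (ys ++ xs)) (x∙yz≈y∙xz d a (k * d)) (subst (_ ≤_) (sym (length-++ ys)) (+-mono-≤ l′ l))) ,
    AllPairsₚ.++⁺ dy dx (All.map (λ (_ , p) → All.map (λ (j , j≤k , (_ , q)) e → cosets-disjoint (s≤s j≤k) k≤ q p (≈-sym e)) ax) ay) ,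
    Allₚ.++⁺ (All.map (λ p → suc k , ≤-refl , p) ay) (All.map (λ (j , j≤k , p) → j , m≤n⇒m≤1+n j≤k , p) ax)
    where open import Algebra.Properties.CommutativeSemigroup +-commutativeSemigroup using (x∙yz≈y∙xz)

  Has-union : ∀ {a k d n} → k ≤ q₀ → HasC a 0 → (∀ j → 1 ≤ j → j ≤ k → HasC d j) → n ≤ a + k * d → Has n (X (s ∷ T))
  Has-union k≤ h₀ f l with union _ _ k≤ h₀ f
  ... | xs , l′ , d , a = xs , ≤-trans l l′ , d , All.map (λ (_ , _ , p) → inX p) a

  one : ∀ j → j ≤ t → HasC 1 j
  one j l = _ ∷ [] , s≤s z≤n , [] ∷ [] ,
    subst (λ k → InC k (wsum (take j T ++ s ∷ drop j T))) (≡.trans (length-take j T) (m≤n⇒m⊓n≡m l))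
      (place (take j T) (drop j T) (↭-reflexive (take++drop≡id j T))) ∷ []

  two-from-swap : ∀ {j} u v A B → u ≉ v → InC j (wsum (A ++ u ∷ v ∷ B)) → InC j (wsum (A ++ v ∷ u ∷ B)) → HasC 2 j
  two-from-swap u v A B u≉v p q = _ ∷ _ ∷ [] , ≤-refl ,
    ((λ e → u≉v (via (begin
        wsum (A ++ u ∷ v ∷ B) ∙ (u - v) - wsum (A ++ u ∷ v ∷ B)
          ≈⟨ solve (v0 ⊕ v1 ⊖ v0) v1 (wsum (A ++ u ∷ v ∷ B) ∷ u - v ∷ []) ⟩
        u - v ∎) (≈-trans (≈-sym (wsum-swap A u v B)) (≈-sym e)))) ∷ []) ∷ [] ∷ [] , p ∷ q ∷ []

  full-at : ∀ {j x} R {U} → T ↭ R ++ U → j ≤ length R → Coset j x →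
            (∀ y → Mem (y - triangle (length U) g) → X U y) → X (s ∷ T) x
  full-at {j} {x} R {U} π j≤R m all =
    X-resp (solve (v0 ⊕ (v1 ⊖ v0)) v1 (p ∷ x ∷ [])) (inX (place-X A R′ π′ (all (x - p) m′)))
    where
    A = take j R
    R′ = drop j R
    p = prefix (A ++ s ∷ R′) U
    π′ : A ++ R′ ++ U ↭ T
    π′ = ↭-trans (↭-reflexive (≡.trans (sym (++-assoc A R′ U)) (cong (_++ U) (take++drop≡id j R)))) (↭-sym π)
    lA : length A ≡ j
    lA = ≡.trans (length-take j R) (m≤n⇒m⊓n≡m j≤R)
    U-mem : Mem (wsum U - triangle (length U) g)
    U-mem = resp (begin
      wsum (map (_- g) U) ≈⟨ solve v0 (v0 ⊕ v1 ⊖ v1) (wsum (map (_- g) U) ∷ triangle (length U) g ∷ []) ⟩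
      wsum (map (_- g) U) ∙ triangle (length U) g - triangle (length U) g ≈⟨ ∙-congʳ (wsum-translate g U) ⟨
      wsum U - triangle (length U) g ∎) (wsum∈ (Allₚ.map⁺ (proj₂ (Allₚ.++⁻ R (All-resp-↭ π inCoset)))))
    -- Both `x` and `p ∙ wsum U` lie in the coset with number `j`, so their difference is in `H`;
    -- the remaining sum over `U` is controlled by `U-mem`.
    m′ : Mem (x - p - triangle (length U) g)
    m′ = resp (solve (v0 ⊖ v1 ⊖ v2 ⊖ (v3 ⊕ v4 ⊖ v1 ⊖ v2) ⊕ (v4 ⊖ v5)) (v0 ⊖ v3 ⊖ v5)
        (x ∷ c ∷ j ⋆ b ∷ p ∷ wsum U ∷ triangle (length U) g ∷ []))
      (∙∈ (-∈ m (subst (λ k → Coset k (p ∙ wsum U)) lA (at (place-X A R′ π′ (X-wsum U))))) U-mem)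

  -- |H| terms are set aside to fill a coset of `H`; at least `q₀` others remain, so `s` can still
  -- receive each weight from 0 to `q₀` among them and thus reach every coset.
  full : FH.size + q₀ ≤ t → Full (subgroup H) → ∀ x → X (s ∷ T) x
  full l fH x =
    let j , j≤q₀ , m = coset-of x
        R , U , π , lU , all = Full-lift fH inCoset spans (≤-trans (≤-trans (≤-reflexive (+-comm 1 FH.size)) (+-monoʳ-≤ FH.size 1≤q₀)) l)
    in full-at R π (≤-trans j≤q₀ (+-cancelˡ-≤ FH.size q₀ (length R) (≤-trans l (≤-reflexive
         (≡.trans (↭-length π) (≡.trans (length-++ R) (≡.trans (+-comm (length R) (length U)) (cong (_+ length R) lU)))))))) m all

-- Here `h` stands for |H| - 1: the coset for weight 0 contributes the bound for `H`, and each of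
-- the `q` further cosets contributes two sums.
arith₁ : ∀ h t q → 2 ≤ q → t < suc h + q → 2 + t ≤ (h ⊓ t) + q * 2
arith₁ h t q 2≤q t< = subst (2 + t ≤_) (sym (+-distribʳ-⊓ (q * 2) h t)) (⊓-glb
  (begin
    2 + t             ≤⟨ s≤s t< ⟩
    2 + (h + q)       ≤⟨ +-monoˡ-≤ (h + q) 2≤q ⟩
    q + (h + q)       ≡⟨ x∙yz≈y∙xz q h q ⟩
    h + (q + q)       ≡⟨ cong (λ k → h + k) (sym q*2) ⟩
    h + q * 2         ∎)
  (begin
    2 + t             ≤⟨ +-monoˡ-≤ t 2≤q ⟩
    q + t             ≤⟨ +-monoˡ-≤ t (m≤m+n q q) ⟩
    q + q + t         ≡⟨ +-comm (q + q) t ⟩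
    t + (q + q)       ≡⟨ cong (λ k → t + k) (sym q*2) ⟩
    t + q * 2         ∎))
  where
  open ≤-Reasoning
  open import Algebra.Properties.CommutativeSemigroup +-commutativeSemigroup using (x∙yz≈y∙xz)
  q*2 : q * 2 ≡ q + q
  q*2 = ≡.trans (*-comm q 2) (cong (λ k → q + k) (+-identityʳ q))

arith₂ : ∀ t h l → 4 ≤ t → t ≡ h → suc l ≡ t → 2 + t ≤ ((h ∸ 1) ⊓ t) + 1 * ((h ∸ 1) ⊓ l)
arith₂ .(suc l) .(suc l) l (s≤s 3≤l) ≡.refl ≡.refl
  rewrite m≤n⇒m⊓n≡m (n≤1+n l) | ⊓-idem l | +-identityʳ l = +-monoˡ-≤ l 3≤l

module EssentialBound (F : FinGroup) (s : FinGroup.Carrier F) (T : List (FinGroup.Carrier F))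
                      (sp : Finite.Spanning F (s ∷ T)) (hull : Hulls.ProperHull F T) where
  open FinGroup F
  open Finite F
  open Subquotients F
  open Hulls F
  open Cyclicity F
  open ProperHull hull
  open Essential F s T sp hull
  open import Relation.Binary.Reasoning.Setoid setoid

  -- The number `2 + t` exceeds the length of `s ∷ T` by one, a surplus that pays for a term
  -- prepended later. The last alternative is where it can be missing: index two and a subgroup of
  -- order at most two.
  Outcome : Set
  Outcome = (∀ x → X (s ∷ T) x) ⊎ Has (2 + t) (X (s ∷ T)) ⊎ (t ≡ 2 × size ≤ 4 × Has 3 (X (s ∷ T)))

  bound-0 : Bound (subgroup H) → HasC ((h ∸ 1) ⊓ t) 0
  bound-0 bH = HasC-X [] [] refl (Bound-lift bH inCoset spans)

  module _ {u v} (u≉v : u ≉ v) where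
    two-0 : ∀ {T₀} → T ↭ u ∷ v ∷ T₀ → HasC 2 0
    two-0 {T₀} π = two-from-swap u v (s ∷ []) T₀ u≉v (place [] _ (↭-sym π)) (place [] _ (trans (swap v u refl) (↭-sym π)))

    -- For weight 1 of `s` a third term `w` takes weight 0, so that `u` and `v` can stand next to
    -- each other behind `s`.
    two-1 : ∀ {w T₁} → T ↭ u ∷ v ∷ w ∷ T₁ → HasC 2 1
    two-1 {w} {T₁} π = two-from-swap u v (w ∷ s ∷ []) T₁ u≉v
      (place (w ∷ []) (u ∷ v ∷ T₁) (trans (trans (swap w u refl) (prep u (swap w v refl))) (↭-sym π)))
      (place (w ∷ []) (v ∷ u ∷ T₁) (trans (trans (prep w (swap v u refl)) (trans (swap w u refl) (prep u (swap w v refl)))) (↭-sym π)))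

    two-2+ : ∀ {T₀} i → T ↭ u ∷ v ∷ T₀ → i ≤ length T₀ → HasC 2 (2 + i)
    two-2+ {T₀} i π l = subst (λ k → HasC 2 (2 + k)) (≡.trans (length-take i T₀) (m≤n⇒m⊓n≡m l))
      (two-from-swap u v [] (take i T₀ ++ s ∷ drop i T₀) u≉v
        (place (u ∷ v ∷ take i T₀) (drop i T₀) (trans (prep u (prep v e)) (↭-sym π)))
        (place (v ∷ u ∷ take i T₀) (drop i T₀) (trans (swap v u e) (↭-sym π))))
      where e = ↭-reflexive (take++drop≡id i T₀)

    two : ∀ {w T₁} → T ↭ u ∷ v ∷ w ∷ T₁ → ∀ j → j ≤ t → HasC 2 j
    two π zero l = two-0 π
    two π (suc zero) l = two-1 π
    two π (suc (suc i)) l = two-2+ i π (≤-pred (≤-pred (subst (2 + i ≤_) (↭-length π) l)))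

  difference∈ : ∀ {u v T₀} → T ↭ u ∷ v ∷ T₀ → Mem (u - v)
  difference∈ {u} {v} π with All-resp-↭ π inCoset
  ... | mu ∷ mv ∷ _ = resp (solve (v0 ⊖ v2 ⊖ (v1 ⊖ v2)) (v0 ⊖ v1) (u ∷ v ∷ g ∷ [])) (-∈ mu mv)

  two-torsion : ∀ {u v T₀} → T ↭ u ∷ v ∷ T₀ → All (λ y → y ≈ u ⊎ y ≈ v) T → 2 ⋆ (u - v) ≈ ε → h ≤ 2
  two-torsion {u} {v} π a 2d≈ε = size-≤ (ε ∷ u - v ∷ []) λ x m → covered (span-relative inCoset spans mv Q (order-two-closed 2d≈ε) (All.map in-Q a) x m)
    where
    Q : Carrier → Set
    Q x = x ≈ ε ⊎ x ≈ u - v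
    mv : Mem (v - g)
    mv = All.lookup (All-resp-↭ π inCoset) (there (here ≡.refl))
    in-Q : ∀ {y} → y ≈ u ⊎ y ≈ v → Q (y - v)
    in-Q (inj₁ e) = inj₂ (∙-congʳ e)
    in-Q (inj₂ e) = inj₁ (x≈y⇒x-y≈ε e)
    covered : ∀ {x} → Q x → x ∈ ε ∷ u - v ∷ []
    covered (inj₁ e) = here e
    covered (inj₂ e) = there (here e)

  only-1 : ∀ {d} → HasC d 1 → ∀ j → 1 ≤ j → j ≤ 1 → HasC d j
  only-1 p (suc zero) _ _ = p
  only-1 p (suc (suc j)) _ (s≤s ())

  size-≤-2h : q₀ ≤ 1 → size ≤ h + h
  size-≤-2h q₀≤1 = subst (size ≤_) (≡.trans (length-++ (map proj₁ E)) (cong₂ _+_ (length-map proj₁ E) (length-map _ E)))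
      (distinct-length distinct (All.universal (λ x → covered x (coset-of (x ∙ c))) elems))
    where
    E = FH.elems
    E′ = map (λ e → b ∙ proj₁ e) E
    covered : ∀ x → (∃ λ j → j ≤ q₀ × Coset j (x ∙ c)) → x ∈ map proj₁ E ++ E′
    covered x (zero , _ , m) = Anyₚ.++⁺ˡ (Anyₚ.map⁺ (Any.map
      (λ {e} p → ≈-trans (solve v0 (v0 ⊕ v1 ⊖ v1 ⊖ ∅) (x ∷ c ∷ [])) p) (FH.complete (x ∙ c - c - ε , m))))
    covered x (suc zero , _ , m) = Anyₚ.++⁺ʳ (map proj₁ E) (Anyₚ.map⁺ (Any.map
      (λ {e} p → ≈-trans (solve v0 (v2 ⊕ (v0 ⊕ v1 ⊖ v1 ⊖ (v2 ⊕ ∅))) (x ∷ c ∷ b ∷ [])) (∙-congˡ p)) (FH.complete (x ∙ c - c - 1 ⋆ b , m))))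
    covered x (suc (suc j) , l , m) = contradiction (≤-trans l q₀≤1) λ { (s≤s ()) }

  -- With `s` in the middle the two sums differ by 2 (u - v), which can vanish only if |H| is at
  -- most 2.
  case-2-two : ∀ {u v} → T ↭ u ∷ v ∷ [] → 3 ≤ h → HasC 2 1
  case-2-two {u} {v} π 3≤h = wsum (u ∷ s ∷ v ∷ []) ∷ wsum (v ∷ s ∷ u ∷ []) ∷ [] , ≤-refl , (differ ∷ []) ∷ [] ∷ [] ,
      place (u ∷ []) (v ∷ []) (↭-sym π) ∷ place (v ∷ []) (u ∷ []) (trans (swap v u refl) (↭-sym π)) ∷ []
    where
    differ : wsum (u ∷ s ∷ v ∷ []) ≉ wsum (v ∷ s ∷ u ∷ [])
    differ e = <⇒≱ 3≤h (two-torsion π (All-resp-↭ (↭-sym π) (inj₁ ≈-refl ∷ inj₂ ≈-refl ∷ []))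
      (via (solve (v2 ⊕ 2 ⊛ v0 ⊖ (v2 ⊕ 2 ⊛ v1)) (2 ⊛ (v0 ⊖ v1) ⊖ ∅) (u ∷ v ∷ s ∷ []))
        (≈-trans (≈-sym (wsum₃ v s u)) (≈-trans (≈-sym e) (wsum₃ u s v)))))

  case-2 : ∀ {u v} → q₀ ≤ 1 → u ≉ v → T ↭ u ∷ v ∷ [] → Outcome
  case-2 {u} {v} q₀≤1 u≉v π = go (3 ≤? h)
    where
    go : Dec (3 ≤ h) → Outcome
    go (yes 3≤h) = inj₂ (inj₁ (subst (λ k → Has (2 + k) (X (s ∷ T))) (sym (↭-length π))
      (Has-union 1≤q₀ (two-0 u≉v π) (only-1 (case-2-two π 3≤h)) ≤-refl)))
    go (no 3≰h) = inj₂ (inj₂ (↭-length π , ≤-trans (size-≤-2h q₀≤1) (+-mono-≤ h≤2 h≤2) ,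
        Has-union 1≤q₀ (two-0 u≉v π) (only-1 (one 1 (subst (1 ≤_) (sym (↭-length π)) (s≤s z≤n)))) ≤-refl))
      where
      h≤2 : h ≤ 2
      h≤2 = ≤-pred (≰⇒> 3≰h)

  -- For |T| = |H| = 3 the bound for `H` yields only two sums in a coset, one too few in total. With
  -- `s` first, `u` takes each of the weights 1, 2, 3 among equal terms; the three sums differ
  -- because u - v is not of order two.
  case-3-equal : ∀ {u v w} → h ≡ 3 → u ≉ v → w ≈ v → T ↭ u ∷ v ∷ w ∷ [] → Has 5 (X (s ∷ T))
  case-3-equal {u} {v} {w} h≡3 u≉v w≈v π = Has-union 1≤q₀ three (only-1 (two-1 u≉v π)) ≤-refl
    where
    2d≉ε : 2 ⋆ (u - v) ≉ ε
    2d≉ε e = contradiction (subst (_≤ 2) h≡3 (two-torsion π (All-resp-↭ (↭-sym π) (inj₁ ≈-refl ∷ inj₂ ≈-refl ∷ inj₂ w≈v ∷ [])) e)) λ { (s≤s (s≤s ())) }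
    three : HasC 3 0
    three = wsum (s ∷ u ∷ v ∷ w ∷ []) ∷ wsum (s ∷ v ∷ u ∷ w ∷ []) ∷ wsum (s ∷ v ∷ w ∷ u ∷ []) ∷ [] , ≤-refl ,
      ((λ e → u≉v (≈-sym (via (solve (v0 ⊕ 2 ⊛ v1 ⊕ 3 ⊛ v2 ⊖ (v1 ⊕ 2 ⊛ v0 ⊕ 3 ⊛ v2)) (v1 ⊖ v0) (u ∷ v ∷ w ∷ []))
              (≈-trans (≈-sym (wsum₄ s u v w)) (≈-trans e (wsum₄ s v u w)))))) ∷
       (λ e → 2d≉ε (≈-trans (via (solve (v1 ⊕ 2 ⊛ v2 ⊕ 3 ⊛ v0 ⊖ (v0 ⊕ 2 ⊛ v1 ⊕ 3 ⊛ v2)) (2 ⊛ (v0 ⊖ v1) ⊖ (v2 ⊖ v1)) (u ∷ v ∷ w ∷ []))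
              (≈-trans (≈-sym (wsum₄ s v w u)) (≈-trans (≈-sym e) (wsum₄ s u v w)))) (x≈y⇒x-y≈ε w≈v))) ∷ []) ∷
      ((λ e → u≉v (≈-trans (via (solve (v1 ⊕ 2 ⊛ v2 ⊕ 3 ⊛ v0 ⊖ (v1 ⊕ 2 ⊛ v0 ⊕ 3 ⊛ v2)) (v0 ⊖ v2) (u ∷ v ∷ w ∷ []))
              (≈-trans (≈-sym (wsum₄ s v w u)) (≈-trans (≈-sym e) (wsum₄ s v u w)))) w≈v)) ∷ []) ∷ [] ∷ [] ,
      place [] (u ∷ v ∷ w ∷ []) (↭-sym π) ∷ place [] (v ∷ u ∷ w ∷ []) (trans (swap v u refl) (↭-sym π)) ∷
      place [] (v ∷ w ∷ u ∷ []) (trans (trans (prep v (swap w u refl)) (swap v u refl)) (↭-sym π)) ∷ []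

  -- With `s` at weight 1 it does not matter which term has weight 3, as 3 annihilates `H`; the
  -- three choices for weight 2 then give three sums.
  case-3-distinct : ∀ {u v w} → h ≡ 3 → u ≉ v → v ≉ w → w ≉ u → T ↭ u ∷ v ∷ w ∷ [] → Has 5 (X (s ∷ T))
  case-3-distinct {u} {v} {w} h≡3 u≉v v≉w w≉u π = Has-union 1≤q₀ (two-0 u≉v π) (only-1 three) ≤-refl
    where
    3d≈ε : ∀ {d} → Mem d → 3 ⋆ d ≈ ε
    3d≈ε {d} m = subst (λ k → k ⋆ d ≈ ε) h≡3 (subgroup-lagrange m)
    2d≉ε : ∀ {x y} → Mem (x - y) → x ≉ y → 2 ⋆ (x - y) ≉ ε
    2d≉ε {x} {y} m ne e = ne (via (solve (3 ⊛ (v0 ⊖ v1) ⊖ (2 ⊛ (v0 ⊖ v1))) (v0 ⊖ v1) (x ∷ y ∷ [])) (≈-trans (3d≈ε m) (≈-sym e)))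
    three : HasC 3 1
    three = wsum (v ∷ s ∷ u ∷ w ∷ []) ∷ wsum (u ∷ s ∷ v ∷ w ∷ []) ∷ wsum (v ∷ s ∷ w ∷ u ∷ []) ∷ [] , ≤-refl ,
      ((λ e → 2d≉ε (difference∈ π) u≉v (via (solve (v3 ⊕ 2 ⊛ v0 ⊕ 3 ⊛ v2 ⊖ (v3 ⊕ 2 ⊛ v1 ⊕ 3 ⊛ v2)) (2 ⊛ (v0 ⊖ v1) ⊖ ∅) (u ∷ v ∷ w ∷ s ∷ []))
              (≈-trans (≈-sym (wsum₄ v s u w)) (≈-trans e (wsum₄ u s v w))))) ∷
       (λ e → w≉u (via (solve (v3 ⊕ 2 ⊛ v0 ⊕ 3 ⊛ v2 ⊖ (v3 ⊕ 2 ⊛ v2 ⊕ 3 ⊛ v0)) (v2 ⊖ v0) (u ∷ v ∷ w ∷ s ∷ []))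
              (≈-trans (≈-sym (wsum₄ v s u w)) (≈-trans e (wsum₄ v s w u))))) ∷ []) ∷
      ((λ e → 2d≉ε (difference∈ π″) v≉w (≈-trans (via (solve (v3 ⊕ 2 ⊛ v1 ⊕ 3 ⊛ v2 ⊖ (v3 ⊕ 2 ⊛ v2 ⊕ 3 ⊛ v0)) (2 ⊛ (v1 ⊖ v2) ⊖ (3 ⊛ (v0 ⊖ v2))) (u ∷ v ∷ w ∷ s ∷ []))
              (≈-trans (≈-sym (wsum₄ u s v w)) (≈-trans e (wsum₄ v s w u)))) (3d≈ε (difference∈ π′)))) ∷ []) ∷ [] ∷ [] ,
      place (v ∷ []) (u ∷ w ∷ []) (trans (swap v u refl) (↭-sym π)) ∷ place (u ∷ []) (v ∷ w ∷ []) (↭-sym π) ∷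
      place (v ∷ []) (w ∷ u ∷ []) (trans (trans (prep v (swap w u refl)) (swap v u refl)) (↭-sym π)) ∷ []
      where
      π′ : T ↭ u ∷ w ∷ v ∷ []
      π′ = trans π (prep u (swap v w refl))
      π″ : T ↭ v ∷ w ∷ u ∷ []
      π″ = trans π (trans (swap u v refl) (prep v (swap u w refl)))

  case-3 : ∀ {u v w} → h ≡ 3 → u ≉ v → T ↭ u ∷ v ∷ w ∷ [] → Has 5 (X (s ∷ T))
  case-3 {u} {v} {w} h≡3 u≉v π = go (w ≈? v) (w ≈? u)
    where
    go : Dec (w ≈ v) → Dec (w ≈ u) → Has 5 (X (s ∷ T))
    go (yes e) _ = case-3-equal h≡3 u≉v e π
    go _ (yes e) = case-3-equal h≡3 (λ e → u≉v (≈-sym e)) e (trans π (swap u v refl))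
    go (no ne) (no ne′) = case-3-distinct h≡3 u≉v (λ e → ne (≈-sym e)) ne′ π

  removable-split : 3 ≤ t → h ≤ t → ∃ λ R → ∃ λ U → T ↭ R ++ U × length R ≡ 1 × SH.Spanning (map lift U)
  removable-split l l′ = from-removable (Cyclicity.removable (subgroup H) (map lift T) spans
      (subst (3 ≤_) (sym (length-map lift T)) l) (subst (h ≤_) (sym (length-map lift T)) l′))
    where
    from-inverse : ∀ {T̂} → SH.Spanning T̂ → (∃ λ R → ∃ λ U → T ↭ R ++ U × length R ≡ 1 × map lift U ≡ T̂) →
                   ∃ λ R → ∃ λ U → T ↭ R ++ U × length R ≡ 1 × SH.Spanning (map lift U)
    from-inverse sp (R , U , ρ , lR , e) = R , U , ρ , lR , subst SH.Spanning (sym e) sp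
    from-removable : (∃ λ t̂ → ∃ λ T̂ → map lift T ↭ t̂ ∷ T̂ × SH.Spanning T̂) →
                     ∃ λ R → ∃ λ U → T ↭ R ++ U × length R ≡ 1 × SH.Spanning (map lift U)
    from-removable (t̂ , T̂ , π , spT) = from-inverse spT (↭-map-++-inv lift T (t̂ ∷ []) π)

  -- For t = |H| the coset for weight 0 holds t - 1 sums. A removable term placed before `s` leaves
  -- t - 1 terms that still span, hence t - 1 sums for weight 1, and 2 (t - 1) is at least t + 2
  -- from t = 4 on.
  case-4+ : Bound (subgroup H) → 4 ≤ t → t ≡ h → Has (2 + t) (X (s ∷ T))
  case-4+ bH 4≤t t≡h = from-split (removable-split (<⇒≤ 4≤t) (≤-reflexive (sym t≡h)))
    where
    from-split : (∃ λ R → ∃ λ U → T ↭ R ++ U × length R ≡ 1 × SH.Spanning (map lift U)) → Has (2 + t) (X (s ∷ T))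
    from-split (R , U , ρ , lR , spU) = Has-union 1≤q₀ (bound-0 bH) (only-1 (subst (HasC _) lR (HasC-X R [] (↭-sym ρ)
        (Bound-lift bH (proj₂ (Allₚ.++⁻ R (All-resp-↭ ρ inCoset))) spU))))
      (arith₂ t h (length U) 4≤t t≡h (sym (≡.trans (↭-length ρ) (≡.trans (length-++ R) (cong (_+ length U) lR)))))

  t≤h-case : Bound (subgroup H) → q₀ ≤ 1 → ∀ {u v} T₀ → u ≉ v → T ↭ u ∷ v ∷ T₀ → t ≤ h → Outcome
  t≤h-case bH q₀≤1 [] u≉v π t≤h = case-2 q₀≤1 u≉v π
  t≤h-case bH q₀≤1 (w ∷ T₁) u≉v π t≤h = inj₂ (inj₁ (go T₁ π (t <? h)))
    where
    go : ∀ T₁ → T ↭ _ ∷ _ ∷ w ∷ T₁ → Dec (t < h) → Has (2 + t) (X (s ∷ T))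
    go T₁ π (yes t<h) = Has-union 1≤q₀ (bound-0 bH) (only-1 (two-1 u≉v π))
      (subst (2 + t ≤_) (cong (_+ 2) (sym (m≥n⇒m⊓n≡n (∸-monoˡ-≤ 1 t<h)))) (≤-reflexive (+-comm 2 t)))
    go [] π (no t≮h) = subst (λ k → Has (2 + k) (X (s ∷ T))) (sym (↭-length π))
      (case-3 (≡.trans (≤-antisym (≮⇒≥ t≮h) t≤h) (↭-length π)) u≉v π)
    go (_ ∷ T₂) π (no t≮h) = case-4+ bH (subst (4 ≤_) (sym (↭-length π)) (s≤s (s≤s (s≤s (s≤s z≤n))))) (≤-antisym t≤h (≮⇒≥ t≮h))

  -- For t at most `q₀` every weight of `s` opens a new coset, and one exchange gives the extra sum.
  -- For t at least |H| + `q₀` all cosets are filled. In between, two sums in each further coset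
  -- suffice if `q₀` is at least 2; index two is left to the small cases.
  essential : Bound (subgroup H) → Full (subgroup H) → ∀ {u v T₀} → u ≉ v → T ↭ u ∷ v ∷ T₀ → Outcome
  essential bH fH {T₀ = T₀} u≉v π = go₁ (t ≤? q₀)
    where
    2+T₀ : t ≡ 2 + length T₀
    2+T₀ = ↭-length π
    0<h : 0 < h
    0<h = Finite.0<size (subgroup H)
    two′ : 3 ≤ t → ∀ j → j ≤ t → HasC 2 j
    two′ 3≤t = from T₀ π 2+T₀
      where
      from : ∀ T₀ → T ↭ _ ∷ _ ∷ T₀ → t ≡ 2 + length T₀ → ∀ j → j ≤ t → HasC 2 j
      from [] _ e = contradiction (subst (3 ≤_) e 3≤t) λ { (s≤s (s≤s ())) }
      from (_ ∷ _) π _ = two u≉v π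
    go₃ : q₀ < t → t < h + q₀ → Dec (2 ≤ q₀) → Outcome
    go₃ q₀<t t< (yes 2≤q₀) = inj₂ (inj₁ (Has-union ≤-refl (bound-0 bH)
      (λ j _ l → two′ (≤-<-trans 2≤q₀ q₀<t) j (≤-trans l (<⇒≤ q₀<t)))
      (arith₁ (h ∸ 1) t q₀ 2≤q₀ (subst (λ k → t < k + q₀) (sym (m+[n∸m]≡n 0<h)) t<))))
    go₃ q₀<t t< (no 2≰q₀) = t≤h-case bH (≤-pred (≰⇒> 2≰q₀)) T₀ u≉v π (≤-pred (subst (t <_) (≡.trans (cong (λ k → h + k) (≤-antisym (≤-pred (≰⇒> 2≰q₀)) 1≤q₀)) (+-comm h 1)) t<))
    go₂ : q₀ < t → Dec (h + q₀ ≤ t) → Outcome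
    go₂ _ (yes l) = inj₁ (full l fH)
    go₂ q₀<t (no ¬l) = go₃ q₀<t (≰⇒> ¬l) (2 ≤? q₀)
    go₁ : Dec (t ≤ q₀) → Outcome
    go₁ (yes t≤q₀) = inj₂ (inj₁ (Has-union t≤q₀ (two-0 u≉v π) (λ j _ l → one j l) (≤-reflexive (cong (λ k → 2 + k) (sym (*-identityʳ t))))))
    go₁ (no t≰q₀) = go₂ (≰⇒> t≰q₀) (h + q₀ ≤? t)

-- Induction hypothesis and the removal of one term.

record Good (F : FinGroup) : Set₁ where
  field
    bound : Bound F
    full  : Full F

Smaller : FinGroup → Set₁
Smaller F = ∀ F′ → FinGroup.size F′ < FinGroup.size F → Good F′

module Dropping (F : FinGroup) where
  open FinGroup F
  open Finite F
  open Subquotients F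
  open Hulls F
  open Cyclicity F
  open import Relation.Binary.Reasoning.Setoid setoid

  Outcome : Carrier → List Carrier → Set₁
  Outcome s T = (∀ x → X (s ∷ T) x) ⊎ Has (2 + length T) (X (s ∷ T)) ⊎ (length T ≡ 2 × size ≤ 4 × Has 3 (X (s ∷ T)) × ¬ Spanning T)

  -- If `T` does not span, then `s` is essential and the coset count applies once `T` has two
  -- unequal terms. A constant `T` is kept apart, since its progression has at most |T| + 1 members
  -- and so no surplus.
  dropped : Smaller F → ∀ s p ps → Spanning (s ∷ p ∷ ps) → Spanning (p ∷ ps) ⊎ All (_≈ p) (p ∷ ps) ⊎ Outcome s (p ∷ ps)
  dropped ih s p ps sp = go (spanning-or-hull p ps)
    where
    go : Spanning (p ∷ ps) ⊎ ProperHull (p ∷ ps) → Spanning (p ∷ ps) ⊎ All (_≈ p) (p ∷ ps) ⊎ Outcome s (p ∷ ps)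
    go (inj₁ spT) = inj₁ spT
    go (inj₂ hull) = inj₂ (go′ (constant-or-pair p ps))
      where
      good : Good (subgroup (ProperHull.H hull))
      good = ih (subgroup (ProperHull.H hull)) (subgroup-size (ProperHull.H hull) (ProperHull.∉H hull))
      add : EssentialBound.Outcome F s (p ∷ ps) sp hull → Outcome s (p ∷ ps)
      add (inj₁ f) = inj₁ f
      add (inj₂ (inj₁ h)) = inj₂ (inj₁ h)
      add (inj₂ (inj₂ (e , l , h))) = inj₂ (inj₂ (e , l , h ,
        λ spT → ProperHull.∉H hull (spT _ (ProperHull.closed hull) (ProperHull.g hull) (ProperHull.inCoset hull) (ProperHull.outside hull))))
      go′ : All (_≈ p) ps ⊎ (∃ λ v → ∃ λ T → p ∷ ps ↭ p ∷ v ∷ T × p ≉ v) → All (_≈ p) (p ∷ ps) ⊎ Outcome s (p ∷ ps)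
      go′ (inj₁ a) = inj₁ (≈-refl ∷ a)
      go′ (inj₂ (v , T , π , p≉v)) = inj₂ (add (EssentialBound.essential F s (p ∷ ps) sp hull (Good.bound good) (Good.full good) p≉v π))

  singleton-spanning : ∀ {s} → Spanning (s ∷ []) → size ≤ 1
  singleton-spanning {s} sp = order-≥-size {s - s} (constant-generates sp []) 1 (s≤s z≤n) (≈-trans (identityʳ _) (inverseʳ s))

  drop-bound : Smaller F → ∀ s T → Spanning (s ∷ T) → Spanning T ⊎ Has (size ⊓ suc (length T)) (X (s ∷ T))
  drop-bound ih s [] sp = inj₂ (constant-Has {x = s} sp [])
  drop-bound ih s (p ∷ ps) sp = go (dropped ih s p ps sp)
    where
    n = suc (length (p ∷ ps))
    go : Spanning (p ∷ ps) ⊎ All (_≈ p) (p ∷ ps) ⊎ Outcome s (p ∷ ps) → Spanning (p ∷ ps) ⊎ Has (size ⊓ n) (X (s ∷ p ∷ ps))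
    go (inj₁ spT) = inj₁ spT
    go (inj₂ (inj₁ a)) = inj₂ (constant-Has sp a)
    go (inj₂ (inj₂ (inj₁ f))) = inj₂ (Has-≤ (m⊓n≤m size n) (all⇒Has f))
    go (inj₂ (inj₂ (inj₂ (inj₁ h)))) = inj₂ (Has-≤ (≤-trans (m⊓n≤n size n) (n≤1+n n)) h)
    go (inj₂ (inj₂ (inj₂ (inj₂ (e , _ , h , _))))) = inj₂ (Has-≤ (≤-trans (m⊓n≤n size n) (≤-reflexive (cong suc e))) h)

-- Periodic sets of sums and the quotient by their stabilizer.

module Periodic (F : FinGroup) (L : List (FinGroup.Carrier F)) where
  open FinGroup F
  open Finite F
  open Subquotients F

  Period : Carrier → Set
  Period k = ∀ x → X L x → X L (x ∙ k)

  private
    period-resp : Respects Period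
    period-resp e p x q = X-resp (∙-congˡ e) (p x q)

  stabilizer : DecSubgroup
  stabilizer = record
    { Mem = Period
    ; Mem? = λ k → ∀? (λ {x} {y} e f q → X-resp (∙-congʳ e) (f (X-resp (≈-sym e) q))) (λ x → X? L x →-dec X? L (x ∙ k))
    ; closed = record
      { resp = period-resp
      ; ε∈ = λ x q → X-resp (≈-sym (identityʳ x)) q
      ; ∙∈ = λ p q x r → X-resp (assoc _ _ _) (q _ (p x r)) } }

  private
    open DecSubgroup stabilizer
    module FQ = FinGroup (quotient stabilizer)
    module SQ = Finite (quotient stabilizer)

    wsum-quotient : ∀ M → FQ.wsum M ≡ wsum M
    wsum-quotient [] = ≡.refl
    wsum-quotient (x ∷ M) = cong (_∙ sumL M) (wsum-quotient M)

  -- The set of sums is a union of cosets of its stabilizer, so membership can be tested in the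
  -- quotient.
  X-quotient : ∀ {x} → FQ.X L x → X L x
  X-quotient {x} (L′ , p , e) = X-resp (solve (v0 ⊖ (v0 ⊖ v1)) v1 (wsum L′ ∷ x ∷ []))
    (⁻¹∈ (subst (λ w → Period (w - x)) (wsum-quotient L′) e) (wsum L′) (L′ , p , ≈-refl))

  -- If the sequence is longer than the quotient, the sums fill the quotient and hence the group.
  -- Otherwise the bound in the quotient is at least n - 1, and the period turns one of these sums
  -- into two.
  periodic-bound : Smaller F → Spanning L → ∀ {k} → k ≉ ε → Period k → Has (size ⊓ length L) (X L)
  periodic-bound ih sp {k} k≉ε pk = go (FQ.size <? length L)
    where
    good : Good (quotient stabilizer)
    good = ih (quotient stabilizer) (quotient-size stabilizer pk k≉ε)
    spQ : SQ.Spanning L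
    spQ = Spanning-quotient stabilizer sp
    from-full : (∃ λ R → ∃ λ T → L ↭ R ++ T × length T ≡ FQ.size × (∀ x → FQ.X T x)) → ∀ x → X L x
    from-full (R , T , π , _ , f) x = X-quotient (FQ.X-↭ (↭-sym π) (SQ.X-prefix-all R f x))
    short : length L ≤ FQ.size → length L ≤ suc ((FQ.size ∸ 1) ⊓ length L)
    short n≤q = ⊓-glb (≤-trans n≤q (m≤n+m∸n FQ.size 1)) (n≤1+n (length L))
    from-bound : length L ≤ FQ.size → SQ.Has ((FQ.size ∸ 1) ⊓ length L) (FQ.X L) → Has (length L) (X L)
    -- No sum from the quotient means that n is at most 1, and then any single sum suffices.
    from-bound n≤q ([] , l , d , a) = wsum L ∷ [] , ≤-trans (short n≤q) (s≤s l) , [] ∷ [] , X-wsum L ∷ []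
    from-bound n≤q (x ∷ xs , l , d , a) = add (distinct-mod stabilizer d pk k≉ε (s≤s z≤n))
      where
      add : (∃ λ y → y ∈ x ∷ xs × Distinct (y ∙ k ∷ x ∷ xs)) → Has (length L) (X L)
      add (y , i , d′) = y ∙ k ∷ x ∷ xs , ≤-trans (short n≤q) (s≤s l) , d′ ,
        pk y (All.lookupWith (λ p e → X-resp (≈-sym e) (X-quotient p)) a i) ∷ All.map X-quotient a
    go : Dec (FQ.size < length L) → Has (size ⊓ length L) (X L)
    go (yes q<n) = Has-≤ (m⊓n≤m size _) (all⇒Has (from-full (Good.full good L spQ q<n)))
    go (no q≮n) = Has-≤ (m⊓n≤n size _) (from-bound (≮⇒≥ q≮n) (Good.bound good L spQ))

-- Sets that are invariant under each of several differences up to one element.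

module Defects (F : FinGroup) (Z D : FinGroup.Carrier F → Set)
               (Z-resp : Finite.Respects F Z) (Z? : ∀ x → Dec (Z x))
               (D-sym : ∀ {f} → D f → D (FinGroup._⁻¹ F f)) (D-nonzero : ∀ {f} → D f → FinGroup._≉_ F f (FinGroup.ε F))
               (unique : ∀ {f x y} → D f → Z x → ¬ Z (FinGroup._∙_ F x f) → Z y → ¬ Z (FinGroup._∙_ F y f) → FinGroup._≈_ F x y) where
  open FinGroup F
  open Finite F

  -- If x - e were in `Z`, look at x - e + d. Outside `Z` it makes x - e a second defect for `d`;
  -- inside `Z` it is a second defect for `e`, because its translate by `e` is x + d.
  isolated-½ : ∀ {d e x} → D d → D e → e ≉ d → Z x → ¬ Z (x ∙ d) → ¬ Z (x ∙ e) → ¬ Z (x - e)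
  isolated-½ {d} {e} {x} Dd De e≉d Zx ¬Zd ¬Ze Z-e = go (Z? (x - e ∙ d))
    where
    go : ¬ Dec (Z (x - e ∙ d))
    go (no ¬z) = D-nonzero De (via (solve (v0 ⊖ (v0 ⊖ v1)) (v1 ⊖ ∅) (x ∷ e ∷ [])) (unique Dd Zx ¬Zd Z-e ¬z))
    go (yes z) = e≉d (via (solve (v0 ⊖ (v0 ⊖ v1 ⊕ v2)) (v1 ⊖ v2) (x ∷ e ∷ d ∷ []))
      (unique De Zx ¬Ze z (λ z′ → ¬Zd (Z-resp (solve (v0 ⊖ v1 ⊕ v2 ⊕ v1) (v0 ⊕ v2) (x ∷ e ∷ d ∷ [])) z′))))

  across : ∀ {d e x} → D d → D e → Z x → ¬ Z (x ∙ d) → Z (x ∙ e) → Z (x ∙ d ∙ e)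
  across {d} {e} {x} Dd De Zx ¬Zd Ze = decidable-stable (Z? _) λ ¬z →
    D-nonzero De (via (solve (v0 ⊕ v1 ⊖ v0) (v1 ⊖ ∅) (x ∷ e ∷ []))
      (unique Dd Ze (λ z → ¬z (Z-resp (solve (v0 ⊕ v1 ⊕ v2) (v0 ⊕ v2 ⊕ v1) (x ∷ e ∷ d ∷ [])) z)) Zx ¬Zd))

  -- In the direction `e`, either x is isolated in `Z`, or the missing point x + d is isolated in
  -- the complement. `Z` is kept abstract because both a set of sums and its complement are
  -- inserted.
  dichotomy : ∀ {d e x} → D d → D e → e ≉ d → e ≉ d ⁻¹ → Z x → ¬ Z (x ∙ d) →
              (¬ Z (x ∙ e) × ¬ Z (x - e)) ⊎ (Z (x ∙ d ∙ e) × Z (x ∙ d - e))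
  dichotomy {d} {e} {x} Dd De e≉d e≉-d Zx ¬Zd = go (Z? (x ∙ e)) (Z? (x - e))
    where
    e⁻¹≉d : e ⁻¹ ≉ d
    e⁻¹≉d p = e≉-d (≈-sym (via (solve (⊝ v0 ⊖ v1) (⊝ v1 ⊖ v0) (e ∷ d ∷ [])) p))
    go : Dec (Z (x ∙ e)) → Dec (Z (x - e)) → _
    go (no ¬z) _ = inj₁ (¬z , isolated-½ Dd De e≉d Zx ¬Zd ¬z)
    go (yes z) (no ¬z) = contradiction (Z-resp (solve (v0 ⊕ v1) (v0 ⊖ ⊝ v1) (x ∷ e ∷ [])) z) (isolated-½ Dd (D-sym De) e⁻¹≉d Zx ¬Zd ¬z)
    go (yes z) (yes z′) = inj₂ (across Dd De Zx ¬Zd z , across Dd (D-sym De) Zx ¬Zd z′)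

  -- Isolation spreads from `d` and `e` to every `f`: if the dichotomy failed to isolate x for both
  -- pairs, then x + d - f and x + e - f would both be defects for `f`, forcing d = e.
  isolated : ∀ {d e x} → D d → D e → e ≉ d → e ≉ d ⁻¹ → Z x → ¬ Z (x ∙ d) → ¬ Z (x ∙ e) → ¬ Z (x - e) →
             ∀ {f} → D f → ¬ Z (x ∙ f)
  isolated {d} {e} {x} Dd De e≉d e≉-d Zx ¬Zd ¬Ze ¬Z-e {f} Df = go (f ≈? d) (f ≈? d ⁻¹) (f ≈? e) (f ≈? e ⁻¹)
    where
    ¬Z-d : ¬ Z (x - d)
    ¬Z-d = isolated-½ De Dd (λ p → e≉d (≈-sym p)) Zx ¬Ze ¬Zd
    via-f : ∀ {f g} → f ≈ g → ¬ Z (x ∙ g) → ¬ Z (x ∙ f)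
    via-f p ¬z z = ¬z (Z-resp (∙-congˡ p) z)
    go : Dec (f ≈ d) → Dec (f ≈ d ⁻¹) → Dec (f ≈ e) → Dec (f ≈ e ⁻¹) → ¬ Z (x ∙ f)
    go (yes p) _ _ _ = via-f p ¬Zd
    go _ (yes p) _ _ = via-f p ¬Z-d
    go _ _ (yes p) _ = via-f p ¬Ze
    go _ _ _ (yes p) = via-f p ¬Z-e
    go (no f≉d) (no f≉-d) (no f≉e) (no f≉-e) = go′ (dichotomy Dd Df f≉d f≉-d Zx ¬Zd) (dichotomy De Df f≉e f≉-e Zx ¬Ze)
      where
      returns : ∀ g → ¬ Z (x ∙ g) → ¬ Z (x ∙ g - f ∙ f)
      returns g ¬z z = ¬z (Z-resp (solve (v0 ⊕ v1 ⊖ v2 ⊕ v2) (v0 ⊕ v1) (x ∷ g ∷ f ∷ [])) z)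
      go′ : (¬ Z (x ∙ f) × ¬ Z (x - f)) ⊎ (Z (x ∙ d ∙ f) × Z (x ∙ d - f)) →
            (¬ Z (x ∙ f) × ¬ Z (x - f)) ⊎ (Z (x ∙ e ∙ f) × Z (x ∙ e - f)) → ¬ Z (x ∙ f)
      go′ (inj₁ (¬z , _)) _ = ¬z
      go′ (inj₂ _) (inj₁ (¬z , _)) = ¬z
      go′ (inj₂ (_ , z)) (inj₂ (_ , z′)) = contradiction
        (via (solve (v0 ⊕ v1 ⊖ v3 ⊖ (v0 ⊕ v2 ⊖ v3)) (v1 ⊖ v2) (x ∷ e ∷ d ∷ f ∷ []))
          (unique Df z′ (returns e ¬Ze) z (returns d ¬Zd))) e≉d

-- Counterexamples with fewer terms than group elements.

module ShortSequences (F : FinGroup) (L : List (FinGroup.Carrier F)) where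
  open FinGroup F
  open Finite F
  open Cyclicity F
  open Dropping F
  open Periodic F L
  open import Relation.Binary.Reasoning.Setoid setoid

  n : ℕ
  n = length L

  D : Carrier → Set
  D f = ∃ λ u → ∃ λ v → ∃ λ T → L ↭ u ∷ v ∷ T × u ≉ v × f ≈ u - v

  D-sym : ∀ {f} → D f → D (f ⁻¹)
  D-sym (u , v , T , π , ne , p) = v , u , T , trans π (swap u v refl) , (λ e → ne (≈-sym e)) ,
    ≈-trans (⁻¹-cong p) (solve (⊝ (v0 ⊖ v1)) (v1 ⊖ v0) (u ∷ v ∷ []))

  D-nonzero : ∀ {f} → D f → f ≉ ε
  D-nonzero (u , v , T , π , ne , p) e = ne (x-y≈ε⇒x≈y (≈-trans (≈-sym p) e))

  adjacent : ∀ p ps → All (_≈ p) ps ⊎ ∃ λ A → ∃ λ a → ∃ λ b → ∃ λ B → p ∷ ps ≡ A ++ a ∷ b ∷ B × a ≉ b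
  adjacent p [] = inj₁ []
  adjacent p (r ∷ ps) with p ≈? r | adjacent r ps
  ... | no ne | _ = inj₂ ([] , p , r , ps , ≡.refl , ne)
  ... | yes e | inj₁ a = inj₁ (≈-sym e ∷ All.map (λ q → ≈-trans q (≈-sym e)) a)
  ... | yes e | inj₂ (A , a , b , B , q , ne) = inj₂ (p ∷ A , a , b , B , cong (p ∷_) q , ne)

  -- Exchanging two unequal terms with consecutive weights moves a sum by an element of D.
  neighbour : ∀ {u v T} → L ↭ u ∷ v ∷ T → u ≉ v → ∀ {x} → X L x → ∃ λ f → D f × X L (x ∙ f)
  neighbour π u≉v ([] , p , e) = contradiction (↭-length (trans p π)) λ ()
  neighbour {u} {v} π u≉v {x} (r ∷ L′ , p , e) with adjacent r L′
  ... | inj₁ a with All-resp-↭ (trans p π) (≈-refl ∷ a)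
  ...   | eu ∷ ev ∷ _ = contradiction (≈-trans eu (≈-sym ev)) u≉v
  neighbour π u≉v {x} (r ∷ L′ , p , e) | inj₂ (A , a , b , B , q , a≉b) =
    a - b , (a , b , A ++ B , trans (↭-sym p′) (trans (shift a A (b ∷ B)) (prep a (shift b A B))) , a≉b , ≈-refl) ,
    (A ++ b ∷ a ∷ B , trans (Perm.++⁺ˡ A (swap b a refl)) p′ , ≈-trans (wsum-swap A a b B) (∙-congʳ (≈-trans (reflexive (cong wsum (sym q))) e)))
    where
    p′ : A ++ a ∷ b ∷ B ↭ L
    p′ = subst (_↭ L) q p

  two-valued-sum : ∀ {u v} T → All (λ w → w ≈ v ⊎ w ≈ u) T → ∃ λ k → k ≤ length T × sumL T ≈ length T ⋆ v ∙ k ⋆ (u - v)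
  two-valued-sum [] [] = 0 , z≤n , ≈-sym (identityʳ ε)
  two-valued-sum {u} {v} (w ∷ T) (p ∷ ps) with two-valued-sum T ps | p
  ... | k , l , e | inj₁ q = k , m≤n⇒m≤1+n l , ≈-trans (∙-cong q e) (≈-sym (assoc _ _ _))
  ... | k , l , e | inj₂ q = suc k , s≤s l , ≈-trans (∙-cong q e)
        (solve (v0 ⊕ (v1 ⊕ v2)) (v3 ⊕ v1 ⊕ (v0 ⊖ v3 ⊕ v2)) (u ∷ length T ⋆ v ∷ k ⋆ (u - v) ∷ v ∷ []))

  module Counterexample (sp : Spanning L) (n<size : n < size)
                        (aperiodic : ∀ {k} → k ≉ ε → ¬ Period k)
                        (pairs : ∀ {u v T} → L ↭ u ∷ v ∷ T → u ≉ v → Has (length T) (X T))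
                        (¬Has : ¬ Has n (X L)) where

    -- Starting the remaining terms behind u, v or behind v, u yields n - 2 sums z for which z + f
    -- is a sum as well. Two different defects would raise the count to n.
    unique : ∀ {f x y} → D f → X L x → ¬ X L (x ∙ f) → X L y → ¬ X L (y ∙ f) → x ≈ y
    unique {f} {x} {y} (u , v , T , π , u≉v , f≈) Xx ¬Xx Xy ¬Xy = decidable-stable (x ≈? y) λ x≉y →
      ¬Has (go x≉y (Has-map {P = X T} {Q = λ z → X L z × X L (z ∙ f)} (prefix (u ∷ v ∷ []) T ∙_) (cancelˡ _) both (pairs π u≉v)))
      where
      both : ∀ {z} → X T z → X L (prefix (u ∷ v ∷ []) T ∙ z) × X L (prefix (u ∷ v ∷ []) T ∙ z ∙ f)
      both {z} p = X-↭ (↭-sym π) (X-prefix (u ∷ v ∷ []) p) ,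
        X-resp (≈-trans (solve (∅ ⊕ ∅ ⊕ (v0 ⊕ ∅) ⊕ v2 ⊕ v3) (∅ ⊕ ∅ ⊕ (v1 ⊕ ∅) ⊕ v2 ⊕ v3 ⊕ (v0 ⊖ v1)) (u ∷ v ∷ 2 ⋆ sumL T ∷ z ∷ [])) (∙-congˡ (≈-sym f≈)))
          (X-↭ (trans (swap v u refl) (↭-sym π)) (X-prefix (v ∷ u ∷ []) p))
      go : x ≉ y → Has (length T) (λ z → X L z × X L (z ∙ f)) → Has n (X L)
      go x≉y (xs , l , d , a) = x ∷ y ∷ xs , subst (_≤ 2 + length xs) (sym (↭-length π)) (s≤s (s≤s l)) ,
        (x≉y ∷ All.map (λ (_ , q) e → ¬Xx (X-resp (∙-congʳ (≈-sym e)) q)) a) ∷ All.map (λ (_ , q) e → ¬Xy (X-resp (∙-congʳ (≈-sym e)) q)) a ∷ d ,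
        Xx ∷ Xy ∷ All.map proj₁ a

    defect : ∀ {f} → f ≉ ε → ∃ λ x → X L x × ¬ X L (x ∙ f)
    defect {f} f≉ε with ∃? {λ x → X L x × ¬ X L (x ∙ f)} (λ e (p , q) → X-resp e p , λ r → q (X-resp (∙-congʳ (≈-sym e)) r)) (λ x → X? L x ×-dec ¬? (X? L (x ∙ f)))
    ... | yes w = w
    ... | no ¬w = contradiction (λ x p → decidable-stable (X? L (x ∙ f)) λ ¬q → ¬w (x , p , ¬q)) (aperiodic f≉ε)

    module XD = Defects F (X L) D X-resp (X? L) D-sym D-nonzero unique

    unique′ : ∀ {f x y} → D f → ¬ X L x → ¬ ¬ X L (x ∙ f) → ¬ X L y → ¬ ¬ X L (y ∙ f) → x ≈ y
    unique′ {f} {x} {y} Df ¬x x′ ¬y y′ = cancelʳ f (unique (D-sym Df) (decidable-stable (X? L _) x′) (back ¬x) (decidable-stable (X? L _) y′) (back ¬y))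
      where
      back : ∀ {x} → ¬ X L x → ¬ X L (x ∙ f - f)
      back {x} ¬x q = ¬x (X-resp (solve (v0 ⊕ v1 ⊖ v1) v0 (x ∷ f ∷ [])) q)

    module YD = Defects F (λ x → ¬ X L x) D (λ e ¬p p → ¬p (X-resp (≈-sym e) p)) (λ x → ¬? (X? L x)) D-sym D-nonzero unique′

    -- Suppose z is another missing point. Translating it by a difference of terms keeps it missing
    -- and different from y; such translations form a closed set containing all w - v, hence
    -- everything, including y - z.
    co-isolated : ∀ {y u v T} → L ↭ u ∷ v ∷ T → ¬ X L y → (∀ {f} → D f → X L (y ∙ f)) → ∀ z → ¬ X L z → z ≈ y
    co-isolated {y} {u} {v} π ¬y near z ¬z = decidable-stable (z ≈? y) λ z≉y →
      proj₂ (sp N cl v (All.tabulate in-N) (y - z) z ¬z z≉y) (solve (v0 ⊕ (v1 ⊖ v0)) v1 (z ∷ y ∷ []))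
      where
      N : Carrier → Set
      N g = ∀ z → ¬ X L z → z ≉ y → ¬ X L (z ∙ g) × z ∙ g ≉ y
      cl : Closed N
      cl = record
        { resp = λ e h z p q → (λ r → proj₁ (h z p q) (X-resp (∙-congˡ (≈-sym e)) r)) , λ r → proj₂ (h z p q) (≈-trans (∙-congˡ e) r)
        ; ε∈ = λ z p q → (λ r → p (X-resp (identityʳ z) r)) , λ r → q (≈-trans (≈-sym (identityʳ z)) r)
        ; ∙∈ = λ {a} {b} h k z p q → let p′ , q′ = h z p q ; p″ , q″ = k (z ∙ a) p′ q′ in
            (λ r → p″ (X-resp (≈-sym (assoc z a b)) r)) , λ r → q″ (≈-trans (assoc z a b) r) }
      D⊆N : ∀ {f} → D f → N f
      D⊆N {f} Df z p q = (λ r → q (unique′ Df p (λ ¬r → ¬r r) ¬y (λ ¬r → ¬r (near Df)))) ,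
        λ e → p (X-resp (≈-sym (via (solve (v0 ⊕ v1 ⊖ v2) (v0 ⊖ (v2 ⊖ v1)) (z ∷ f ∷ y ∷ [])) e)) (near (D-sym Df)))
      in-N : ∀ {w} → Any (w ≡_) L → N (w - v)
      in-N {w} i with Any-resp-↭ π i
      ... | here ≡.refl = go (u ≈? v)
        where
        go : Dec (u ≈ v) → N (u - v)
        go (yes e) = Closed.resp cl (≈-sym (x≈y⇒x-y≈ε e)) (Closed.ε∈ cl)
        go (no ne) = D⊆N (u , v , _ , π , ne , ≈-refl)
      ... | there (here ≡.refl) = Closed.resp cl (≈-sym (inverseʳ v)) (Closed.ε∈ cl)
      ... | there (there j) with extract j
      ... | w , T , ≡.refl , ρ = go (w ≈? v)
        where
        go : Dec (w ≈ v) → N (w - v)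
        go (yes e) = Closed.resp cl (≈-sym (x≈y⇒x-y≈ε e)) (Closed.ε∈ cl)
        go (no ne) = D⊆N (w , v , u ∷ T , trans π (trans (prep u (prep v ρ)) (trans (prep u (swap v w refl)) (trans (swap u w refl) (prep w (swap u v refl))))) , ne , ≈-refl)

    missing-one : ∀ {y} → (∀ z → ¬ X L z → z ≈ y) → Has n (X L)
    missing-one {y} f with extract (complete y)
    ... | y′ , zs , e , π = zs , ≤-pred (subst (n <_) (↭-length π) n<size) ,
      AllPairs.tail (Distinct-↭ π distinct) , All.map (λ ne → decidable-stable (X? L _) λ ¬z → ne (≈-trans (≈-sym e) (≈-sym (f _ ¬z)))) (AllPairs.head (Distinct-↭ π distinct))

    -- Two differences that are not equal up to sign isolate a point. If it is a sum, exchanging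
    -- neighbours reaches another sum from it; if it is missing, it is the only missing point and
    -- there are enough sums.
    contradiction-from : ∀ {d e u v T} → L ↭ u ∷ v ∷ T → u ≉ v → D d → D e → e ≉ d → ¬ (e ≉ d ⁻¹)
    contradiction-from {d} {e} π u≉v Dd De e≉d e≉-d with defect (D-nonzero Dd)
    ... | x , Xx , ¬Xd with XD.dichotomy Dd De e≉d e≉-d Xx ¬Xd
    ... | inj₁ (¬Xe , ¬X-e) with neighbour π u≉v Xx
    ... | f , Df , Xf = XD.isolated Dd De e≉d e≉-d Xx ¬Xd ¬Xe ¬X-e Df Xf
    contradiction-from {d} {e} π u≉v Dd De e≉d e≉-d | x , Xx , ¬Xd | inj₂ (Xe , X-e) =
      ¬Has (missing-one (co-isolated π ¬Xd λ Df → decidable-stable (X? L _)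
        (YD.isolated (D-sym Dd) De e≉-d (λ p → e≉d (≈-trans p (solve (⊝ ⊝ v0) v0 (d ∷ [])))) ¬Xd
          (λ ¬p → ¬p (X-resp (solve v0 (v0 ⊕ v1 ⊖ v1) (x ∷ d ∷ [])) Xx)) (λ ¬p → ¬p Xe) (λ ¬p → ¬p X-e) Df)))

-- Consequences of having fewer sums than terms, with at most |G| terms.

module Tight (F : FinGroup) (L : List (FinGroup.Carrier F)) (ih : Smaller F) (sp : Finite.Spanning F L)
             (rec : ∀ T → length T < length L → Finite.Spanning F T → Finite.Has F ((FinGroup.size F ∸ 1) ⊓ length T) (FinGroup.X F T))
             (n≤size : length L ≤ FinGroup.size F) (¬Has : ¬ Finite.Has F (length L) (FinGroup.X F L)) where
  open FinGroup F
  open Finite F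
  open Cyclicity F
  open Dropping F
  open Periodic F L
  open ShortSequences F L
  open import Relation.Binary.Reasoning.Setoid setoid

  -- An essential term would already yield enough sums, by `drop-bound`.
  removable-term : ∀ {s T} → L ↭ s ∷ T → Spanning T
  removable-term {s} {T} π = go (drop-bound ih s T (Spanning-↭ π sp))
    where
    go : Spanning T ⊎ Has (size ⊓ suc (length T)) (X (s ∷ T)) → Spanning T
    go (inj₁ spT) = spT
    go (inj₂ h) = contradiction (Has-↭ (↭-sym π) (Has-≤ (⊓-glb n≤size (≤-reflexive (↭-length π))) h)) ¬Has

  bound-rec : ∀ T → length T < n → Spanning T → Has (length T) (X T)
  bound-rec T l spT = Has-≤ (⊓-glb (∸-monoˡ-≤ 1 (≤-trans l n≤size)) ≤-refl) (rec T l spT)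

  aperiodic : ∀ {k} → k ≉ ε → ¬ Period k
  aperiodic k≉ε p = ¬Has (Has-≤ (⊓-glb n≤size ≤-refl) (periodic-bound ih sp k≉ε p))

  -- With s placed last or first, X T + (n − 1) s and X T + σ(T) both fill X L, so their difference is a period.
  sum-rest : ∀ {s T} → L ↭ s ∷ T → sumL T ≈ length T ⋆ s
  sum-rest {s} {T} π = decidable-stable (sumL T ≈? length T ⋆ s) λ ne → aperiodic (λ e → ne (x-y≈ε⇒x≈y e)) period
    where
    last : Carrier → Carrier
    last y = y ∙ length T ⋆ (s ∙ ε) ∙ (ε ∙ ε)
    π′ : T ++ s ∷ [] ↭ L
    π′ = trans (Perm.++-comm T (s ∷ [])) (↭-sym π)
    exact : Has (length T) (X T) → ∀ {x} → X L x → ∃ λ y → X T y × x ≈ last y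
    exact (xs , l , d , a) {x} p = find (¬Has⇒exact (map last xs)
      (λ h → ¬Has (Has-≤ (subst₂ _≤_ (sym (↭-length π)) (cong suc (sym (length-map last xs))) (s≤s l)) h))
      (AllPairsₚ.map⁺ (AllPairs.map (λ ne e → ne (cancelʳ _ (cancelʳ _ e))) d))
      (Allₚ.map⁺ (All.map (λ q → X-↭ π′ (X-++ q (X-wsum (s ∷ [])))) a)) p)
      where
      find : x ∈ map last xs → ∃ λ y → X T y × x ≈ last y
      find i = All.lookupWith (λ {y} q e → y , q , e) a (Anyₚ.map⁻ i)
    period : Period (sumL T - length T ⋆ s)
    period x p = go (exact (bound-rec T (≤-reflexive (sym (↭-length π))) (removable-term π)) p)
      where
      go : (∃ λ y → X T y × x ≈ last y) → X L (x ∙ (sumL T - length T ⋆ s))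
      go (y , q , e) = X-resp (begin
        prefix (s ∷ []) T ∙ y
          ≈⟨ solve (∅ ⊕ ∅ ⊕ (v0 ⊕ ∅) ⊕ v1) (v1 ⊕ v2 ⊕ (∅ ⊕ ∅) ⊕ (v0 ⊖ v2)) (sumL T ∷ y ∷ length T ⋆ s ∷ []) ⟩
        y ∙ length T ⋆ s ∙ (ε ∙ ε) ∙ (sumL T - length T ⋆ s)
          ≈⟨ ∙-congʳ (∙-congʳ (∙-congˡ (×-congʳ (length T) (identityʳ s)))) ⟨
        last y ∙ (sumL T - length T ⋆ s) ≈⟨ ∙-congʳ e ⟨
        x ∙ (sumL T - length T ⋆ s) ∎) (X-↭ (↭-sym π) (X-prefix (s ∷ []) q))

  sum-all : ∀ {s T} → L ↭ s ∷ T → sumL L ≈ n ⋆ s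
  sum-all {s} {T} π = begin
    sumL L               ≈⟨ sumL-↭ π ⟩
    s ∙ sumL T           ≈⟨ ∙-congˡ (sum-rest π) ⟩
    suc (length T) ⋆ s   ≡⟨ cong (_⋆ s) (↭-length π) ⟨
    n ⋆ s                ∎

-- Refutation of short counterexamples.

module Short (F : FinGroup) (L : List (FinGroup.Carrier F)) (ih : Smaller F) (sp : Finite.Spanning F L)
             (rec : ∀ T → length T < length L → Finite.Spanning F T → Finite.Has F ((FinGroup.size F ∸ 1) ⊓ length T) (FinGroup.X F T))
             (n<size : length L < FinGroup.size F) (¬Has : ¬ Finite.Has F (length L) (FinGroup.X F L)) where
  open FinGroup F
  open Finite F
  open Cyclicity F
  open Dropping F
  open Periodic F L
  open ShortSequences F L
  open Tight F L ih sp rec (<⇒≤ n<size) ¬Has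
  open import Relation.Binary.Reasoning.Setoid setoid

  -- If `u` were essential after the removal of `v`, the surplus sum would make up for `v`. A
  -- constant remainder p makes u - p a generator, yet `sum-all` shows that n < |G| annihilates it.
  spanning-pair : ∀ {u v T} → L ↭ u ∷ v ∷ T → Spanning T
  spanning-pair {u} {v} {[]} π = contradiction n<size (≤⇒≯ (≤-trans
    (singleton-spanning (removable-term (trans π (swap u v refl)))) (subst (1 ≤_) (sym (↭-length π)) (s≤s z≤n))))
  spanning-pair {u} {v} {p ∷ ps} π = go (dropped ih u p ps (removable-term (trans π (swap u v refl))))
    where
    πv : v ∷ u ∷ p ∷ ps ↭ L
    πv = trans (swap v u refl) (↭-sym π)
    go : Spanning (p ∷ ps) ⊎ All (_≈ p) (p ∷ ps) ⊎ Outcome u (p ∷ ps) → Spanning (p ∷ ps)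
    go (inj₁ spT) = spT
    go (inj₂ (inj₁ a)) = contradiction n<size (≤⇒≯ (order-≥-size (constant-generates (removable-term (trans π (swap u v refl))) a) n
      (subst (0 <_) (sym (↭-length π)) (s≤s z≤n)) (begin
        n ⋆ (u - p)              ≈⟨ ⋆-distrib u (p ⁻¹) n ⟩
        n ⋆ u ∙ n ⋆ (p ⁻¹)       ≈⟨ ∙-congˡ (⋆-⁻¹ n p) ⟩
        n ⋆ u - n ⋆ p            ≈⟨ x≈y⇒x-y≈ε (≈-trans (≈-sym (sum-all π)) (sum-all (trans π (trans (prep u (swap v p refl)) (swap u p refl))))) ⟩
        ε                        ∎)))
    go (inj₂ (inj₂ (inj₁ f))) = contradiction (Has-≤ (<⇒≤ n<size) (all⇒Has (λ x → X-↭ πv (X-prefix-all (v ∷ []) f x)))) ¬Has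
    go (inj₂ (inj₂ (inj₂ (inj₁ h)))) = contradiction (Has-≤ (≤-reflexive (↭-length π)) (Has-↭ πv (Has-prefix (v ∷ []) h))) ¬Has
    -- Here n = 4, which is not below a group order of at most 4.
    go (inj₂ (inj₂ (inj₂ (inj₂ (e , s≤4 , _))))) = contradiction (<-≤-trans n<size s≤4)
      (≤⇒≯ (≤-reflexive (sym (≡.trans (↭-length π) (cong (λ k → 2 + k) e)))))

  3≤n : 3 ≤ n
  3≤n = go L refl
    where
    go : ∀ M → L ↭ M → 3 ≤ n
    go [] π = contradiction (Has-≤ (≤-reflexive (↭-length π)) ([] , z≤n , [] , [])) ¬Has
    go (a ∷ []) π = contradiction (Has-≤ (≤-reflexive (↭-length π)) (wsum L ∷ [] , ≤-refl , [] ∷ [] , X-wsum L ∷ [])) ¬Has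
    go (a ∷ b ∷ []) π = contradiction (≤-trans (≤-trans (≤-reflexive (sym (↭-length π))) (<⇒≤ n<size)) (singleton-spanning (removable-term π))) λ { (s≤s ()) }
    go (a ∷ b ∷ c ∷ M) π = subst (3 ≤_) (sym (↭-length π)) (s≤s (s≤s (s≤s z≤n)))

  open Counterexample sp n<size aperiodic
    (λ {u} {v} {T} π _ → bound-rec T (subst (length T <_) (sym (↭-length π)) (m≤n⇒m≤1+n ≤-refl)) (spanning-pair π)) ¬Has

  module _ {u v T} (π : L ↭ u ∷ v ∷ T) (u≉v : u ≉ v) where
    private
      d = u - v

    -- A term of this kind supplies a second difference w - v, not equal to d up to sign, as
    -- `contradiction-from` requires.
    New : Carrier → Set
    New w = (w - v ≉ ε) × (w - v ≉ d) × (w - v ≉ d ⁻¹)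

    new? : ∀ w → Dec (New w)
    new? w = ¬? (w - v ≈? ε) ×-dec ¬? (w - v ≈? d) ×-dec ¬? (w - v ≈? d ⁻¹)

    Old : Carrier → Set
    Old w = w - v ≈ ε ⊎ w - v ≈ d ⊎ w - v ≈ d ⁻¹

    ¬new⇒old : ∀ {w} → ¬ New w → Old w
    ¬new⇒old {w} ¬new = go (w - v ≈? ε) (w - v ≈? d) (w - v ≈? d ⁻¹)
      where
      go : Dec (w - v ≈ ε) → Dec (w - v ≈ d) → Dec (w - v ≈ d ⁻¹) → Old w
      go (yes p) _ _ = inj₁ p
      go _ (yes p) _ = inj₂ (inj₁ p)
      go _ _ (yes p) = inj₂ (inj₂ p)
      go (no p) (no q) (no r) = contradiction (p , q , r) ¬new

    Dd : D d
    Dd = u , v , T , π , u≉v , ≈-refl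

    no-new : ¬ Any New T
    no-new i with extract i
    ... | w , T′ , (p , q , r) , ρ = contradiction-from π u≉v Dd
      (w , v , u ∷ T′ , trans π (trans (prep u (prep v ρ)) (trans (prep u (swap v w refl)) (trans (swap u w refl) (prep w (swap u v refl))))) ,
        (λ e → p (x≈y⇒x-y≈ε e)) , ≈-refl) q r

    generates : All Old T → Generates d
    generates a = sp _ (multiples-closed d) v (All-resp-↭ (↭-sym π) ((1 , ≈-sym (identityʳ d)) ∷ (0 , inverseʳ v) ∷ All.map multiple a))
      where
      multiple : ∀ {w} → Old w → ∃ λ k → w - v ≈ k ⋆ d
      multiple (inj₁ e) = 0 , e
      multiple (inj₂ (inj₁ e)) = 1 , ≈-trans e (≈-sym (identityʳ d))
      multiple (inj₂ (inj₂ e)) = Closed.resp (multiples-closed d) (≈-sym e) (Closed.⁻¹∈ (multiples-closed d) (1 , ≈-sym (identityʳ d)))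

    -- The only remaining third value is w = v - d, and then w - u = -2d is a second difference. It
    -- equals d only if 3d = 0, which bounds the order of the group by 3, and it equals -d only if w
    -- = v.
    third : All Old T → ¬ Any (λ w → (w ≉ v) × (w ≉ u)) T
    third a i with extract i
    ... | w , T′ , (w≉v , w≉u) , ρ = go (All.head (All-resp-↭ ρ a))
      where
      Dw : D (w - u)
      Dw = w , u , v ∷ T′ , trans π (trans (prep u (prep v ρ)) (trans (prep u (swap v w refl)) (swap u w refl))) , w≉u , ≈-refl
      go : ¬ Old w
      go (inj₁ e) = w≉v (x-y≈ε⇒x≈y e)
      go (inj₂ (inj₁ e)) = w≉u (cancelʳ _ e)
      go (inj₂ (inj₂ e)) = contradiction-from π u≉v Dd Dw
        (λ e′ → contradiction n<size (≤⇒≯ (≤-trans (order-≥-size (generates a) 3 (s≤s z≤n)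
          (≈-trans (solve (3 ⊛ (v0 ⊖ v1)) (v2 ⊖ v1 ⊖ ⊝ (v0 ⊖ v1) ⊖ (v2 ⊖ v0 ⊖ (v0 ⊖ v1))) (u ∷ v ∷ w ∷ []))
            (≈-trans (-‿cong (x≈y⇒x-y≈ε e) (x≈y⇒x-y≈ε e′)) (inverseʳ ε)))) 3≤n)))
        (λ e′ → w≉v (via (solve (v2 ⊖ v0 ⊖ ⊝ (v0 ⊖ v1)) (v2 ⊖ v1) (u ∷ v ∷ w ∷ [])) e′))

    -- With k terms of `T` counted as u and the others as v, the sum of `L` is n v + (k + 1) d. By
    -- `sum-all` it is n v, so the generator d is annihilated by k + 1 < n.
    two-valued : All Old T → ¬ All (λ w → w ≈ v ⊎ w ≈ u) T
    two-valued a b with two-valued-sum T b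
    ... | k , l , e = contradiction (≤-trans n<size (order-≥-size (generates a) (suc k) (s≤s z≤n) (begin
        suc k ⋆ d
          ≈⟨ solve (v0 ⊖ v1 ⊕ v2) (v0 ⊕ (v1 ⊕ (v3 ⊕ v2)) ⊖ (v1 ⊕ (v1 ⊕ v3))) (u ∷ v ∷ k ⋆ d ∷ length T ⋆ v ∷ []) ⟩
        u ∙ (v ∙ (length T ⋆ v ∙ k ⋆ d)) - (2 + length T) ⋆ v
          ≈⟨ -‿cong (∙-congˡ (∙-congˡ (≈-sym e))) (≈-sym (×-congˡ (↭-length π))) ⟩
        u ∙ (v ∙ sumL T) - n ⋆ v ≈⟨ x≈y⇒x-y≈ε (≈-trans (≈-sym (sumL-↭ π)) (sum-all (trans π (swap u v refl)))) ⟩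
        ε ∎))) (<⇒≱ (s≤s (≤-trans (s≤s l) (≤-trans (n≤1+n _) (≤-reflexive (sym (↭-length π)))))))

    no-pair : ⊥
    no-pair = go (Any.any? new? T) (Any.any? (λ w → ¬? (w ≈? v) ×-dec ¬? (w ≈? u)) T)
      where
      split : ∀ {w} → ¬ ((w ≉ v) × (w ≉ u)) → Dec (w ≈ v) → Dec (w ≈ u) → w ≈ v ⊎ w ≈ u
      split _ (yes e) _ = inj₁ e
      split _ _ (yes e) = inj₂ e
      split ¬p (no p) (no q) = contradiction (p , q) ¬p
      go : Dec (Any New T) → ¬ Dec (Any (λ w → (w ≉ v) × (w ≉ u)) T)
      go (yes i) _ = no-new i
      go (no ¬i) (yes j) = third (All.map ¬new⇒old (Allₚ.¬Any⇒All¬ T ¬i)) j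
      go (no ¬i) (no ¬j) = two-valued (All.map ¬new⇒old (Allₚ.¬Any⇒All¬ T ¬i)) (All.map (λ {w} ¬p → split ¬p (w ≈? v) (w ≈? u)) (Allₚ.¬Any⇒All¬ T ¬j))

  absurd : ⊥
  absurd = go L refl
    where
    go : ∀ M → ¬ (L ↭ M)
    go [] π = contradiction (subst (3 ≤_) (↭-length π) 3≤n) λ ()
    go (p ∷ ps) π = go′ (constant-or-pair p ps)
      where
      go′ : ¬ (All (_≈ p) ps ⊎ ∃ λ v → ∃ λ T → p ∷ ps ↭ p ∷ v ∷ T × p ≉ v)
      go′ (inj₁ a) = <⇒≱ (<-≤-trans n<size (order-≥-size (constant-generates (Spanning-↭ π sp) a) 1 (s≤s z≤n) (≈-trans (identityʳ _) (inverseʳ p)))) (≤-trans (s≤s z≤n) 3≤n)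
      go′ (inj₂ (v , T , ρ , p≉v)) = no-pair (trans π ρ) p≉v

-- The induction step for the bound and for the filling of the group.

module Main (F : FinGroup) where
  open FinGroup F
  open Finite F
  open Dropping F
  open Cyclicity F

  -- The inner induction on the length provides the bound over the same group after one or two terms
  -- are removed.
  bound-by-length : Smaller F → ∀ k L → length L ≤ k → Spanning L → Has ((size ∸ 1) ⊓ length L) (X L)
  bound-by-length ih zero [] _ _ = [] , ≤-trans (m⊓n≤n (size ∸ 1) 0) z≤n , [] , []
  bound-by-length ih (suc k) L l sp = go (length L <? size)
    where
    rec : ∀ T → length T < length L → Spanning T → Has ((size ∸ 1) ⊓ length T) (X T)
    rec T l′ = bound-by-length ih k T (≤-pred (≤-trans l′ l))
    long : ∀ L → size ≤ length L → Spanning L → (∀ T → length T < length L → Spanning T → Has ((size ∸ 1) ⊓ length T) (X T)) → Has (size ∸ 1) (X L)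
    long [] s≤ _ _ = contradiction (<-≤-trans 0<size s≤) λ ()
    long (s ∷ T) s≤ sp rec = go′ (drop-bound ih s T sp)
      where
      go′ : Spanning T ⊎ Has (size ⊓ suc (length T)) (X (s ∷ T)) → Has (size ∸ 1) (X (s ∷ T))
      go′ (inj₁ spT) = Has-prefix (s ∷ []) (Has-≤ (⊓-glb ≤-refl (∸-monoˡ-≤ 1 s≤)) (rec T ≤-refl spT))
      go′ (inj₂ h) = Has-≤ (⊓-glb (m∸n≤m size 1) (≤-trans (m∸n≤m size 1) s≤)) h
    go : Dec (length L < size) → Has ((size ∸ 1) ⊓ length L) (X L)
    go (yes n<size) = Has-≤ (m⊓n≤n (size ∸ 1) _) (decidable-stable (Has? X-resp (X? L) (length L)) (λ ¬Has → Short.absurd F L ih sp rec n<size ¬Has))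
    go (no n≮size) = Has-≤ (m⊓n≤m (size ∸ 1) _) (long L (≮⇒≥ n≮size) sp rec)

  bound : Smaller F → Bound F
  bound ih L = bound-by-length ih (length L) L ≤-refl

  module Exceptional (ih : Smaller F) (L : List Carrier) (sp : Spanning L) (n≡size : length L ≡ size) (¬all : ¬ (∀ x → X L x)) where
    ¬Has-n : ¬ Has (length L) (X L)
    ¬Has-n h = ¬all (Has-size⇒all X-resp (subst (λ k → Has k (X L)) n≡size h))

    open Tight F L ih sp (λ T _ → bound ih T) (≤-reflexive n≡size) ¬Has-n public

    sum-zero : ∀ {s T} → L ↭ s ∷ T → sumL L ≈ ε
    sum-zero {s} π = ≈-trans (sum-all π) (≈-trans (×-congˡ n≡size) (lagrange s))

  -- More than |G| terms contain a repetition, and one copy can be removed. If exactly |G| terms are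
  -- then left and fail, their sum is 0; replacing a different term by the removed copy changes the
  -- sum, so the new sequence cannot fail too.
  full-by-length : Smaller F → ∀ k L → length L ≤ suc (size + k) → size < length L → Spanning L →
    ∃ λ R → ∃ λ T → L ↭ R ++ T × length T ≡ size × (∀ x → X T x)
  full-by-length ih k L l size< sp = go (duplicate-or-distinct L)
    where
    Goal = ∃ λ R → ∃ λ T → L ↭ R ++ T × length T ≡ size × (∀ x → X T x)
    module _ {u u′ T} (π : L ↭ u ∷ u′ ∷ T) (e : u ≈ u′) where
      spM : Spanning (u′ ∷ T)
      spM = Spanning-dup e (Spanning-↭ π sp)
      longer : ∀ k → length L ≤ suc (size + k) → size < length (u′ ∷ T) → Goal
      longer zero l size<′ = contradiction (≤-trans (≤-reflexive (sym (↭-length π))) (≤-trans l (≤-reflexive (cong suc (+-identityʳ size))))) (<⇒≱ (s≤s size<′))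
      longer (suc k) l size<′ = add (full-by-length ih k (u′ ∷ T) (≤-pred (subst₂ _≤_ (↭-length π) (cong suc (+-suc size k)) l)) size<′ spM)
        where
        add : (∃ λ R → ∃ λ U → u′ ∷ T ↭ R ++ U × length U ≡ size × (∀ x → X U x)) → Goal
        add (R , U , ρ , lU , f) = u ∷ R , U , trans π (prep u ρ) , lU , f
      module _ (n≡size : length (u′ ∷ T) ≡ size) where
        repair : ¬ (∀ x → X (u′ ∷ T) x) → Goal
        repair ¬all = pick (constant-or-pair u′ T)
          where
          open Exceptional ih (u′ ∷ T) spM n≡size ¬all
          pick : All (_≈ u′) T ⊎ (∃ λ w → ∃ λ V → u′ ∷ T ↭ u′ ∷ w ∷ V × u′ ≉ w) → Goal
          pick (inj₁ a) = contradiction (Has-size⇒all X-resp (subst (λ k → Has k (X (u′ ∷ T))) (≡.trans (cong (size ⊓_) n≡size) (⊓-idem size)) (constant-Has spM a))) ¬all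
          pick (inj₂ (w , V , ρ , u′≉w)) = w ∷ [] , u ∷ u′ ∷ V , πw , ≡.trans (sym (↭-length ρ)) n≡size ,
              decidable-stable (∀? X-resp (X? (u ∷ u′ ∷ V))) λ ¬all′ → u′≉w (≈-trans (≈-sym e) (via
                (solve (v0 ⊕ (v1 ⊕ v2) ⊖ (v1 ⊕ (v3 ⊕ v2))) (v0 ⊖ v3) (u ∷ u′ ∷ sumL V ∷ w ∷ []))
                (≈-trans (Exceptional.sum-zero ih (u ∷ u′ ∷ V) spW (≡.trans (sym (↭-length ρ)) n≡size) ¬all′ refl)
                  (≈-sym (≈-trans (sumL-↭ (↭-sym ρ)) (sum-zero refl))))))
            where
            πw : L ↭ w ∷ u ∷ u′ ∷ V
            πw = trans π (trans (prep u (trans ρ (swap u′ w refl))) (swap u w refl))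
            spW : Spanning (u ∷ u′ ∷ V)
            spW = Spanning-∷ (removable-term (trans ρ (swap u′ w refl)))
        exact : Dec (∀ x → X (u′ ∷ T) x) → Goal
        exact (yes f) = u ∷ [] , u′ ∷ T , π , n≡size , f
        exact (no ¬f) = repair ¬f
      from-dup : Dec (size < length (u′ ∷ T)) → Goal
      from-dup (yes size<′) = longer k l size<′
      from-dup (no ¬size<) = exact n≡size (∀? X-resp (X? (u′ ∷ T)))
        where
        n≡size : length (u′ ∷ T) ≡ size
        n≡size = ≤-antisym (≮⇒≥ ¬size<) (≤-pred (subst (size <_) (↭-length π) size<))
    go : Distinct L ⊎ (∃ λ u → ∃ λ u′ → ∃ λ T → L ↭ u ∷ u′ ∷ T × u ≈ u′) → Goal
    go (inj₁ d) = contradiction (distinct-≤-size d) (<⇒≱ size<)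
    go (inj₂ (u , u′ , T , π , e)) = from-dup π e (size <? length (u′ ∷ T))

  good-step : Smaller F → Good F
  good-step ih = record
    { bound = bound ih
    ; full = λ L sp size< → full-by-length ih (length L) L (≤-trans (m≤n+m (length L) size) (n≤1+n _)) size< sp }

good : ∀ F → Good F
good F = go (suc (FinGroup.size F)) F ≤-refl
  where
  go : ∀ k F → FinGroup.size F < k → Good F
  go zero F ()
  go (suc k) F (s≤s l) = Main.good-step F λ F′ l′ → go k F′ (≤-trans l′ l)

-- Sums of blocks of two, three or four terms.

module _ {A : Set} {a b c : A} {T : List A} where
  σ132 : a ∷ c ∷ b ∷ T ↭ a ∷ b ∷ c ∷ T
  σ132 = prep a (swap c b refl)

  σ213 : b ∷ a ∷ c ∷ T ↭ a ∷ b ∷ c ∷ T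
  σ213 = swap b a refl

  σ231 : b ∷ c ∷ a ∷ T ↭ a ∷ b ∷ c ∷ T
  σ231 = trans (prep b (swap c a refl)) (swap b a refl)

  σ312 : c ∷ a ∷ b ∷ T ↭ a ∷ b ∷ c ∷ T
  σ312 = trans (swap c a refl) (prep a (swap c b refl))

  σ321 : c ∷ b ∷ a ∷ T ↭ a ∷ b ∷ c ∷ T
  σ321 = trans (prep c (swap b a refl)) σ312

module Blocks (F : FinGroup) where
  open FinGroup F
  open Finite F
  open import Relation.Binary.Reasoning.Setoid setoid

  -- The sets x - P and Q are too large to be disjoint.
  sumset : ∀ {a b P Q} → Has a P → Has b Q → size < a + b → ∀ x → ∃ λ p → ∃ λ q → P p × Q q × p ∙ q ≈ x
  sumset {P = P} {Q} (xs , l , d , ax) (ys , l′ , d′ , ay) big x = go (Any.any? (λ p → (x - p) ∈? ys) xs)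
    where
    go : Dec (Any (λ p → (x - p) ∈ ys) xs) → ∃ λ p → ∃ λ q → P p × Q q × p ∙ q ≈ x
    go (yes i) = All.lookupWith (λ {p} Pp j → All.lookupWith (λ {q} Qq e → p , q , Pp , Qq ,
      ≈-trans (∙-congˡ (≈-sym e)) (solve (v0 ⊕ (v1 ⊖ v0)) v1 (p ∷ x ∷ []))) ay j) ax i
    go (no ¬i) = contradiction (<-≤-trans big (≤-trans (+-mono-≤ l l′) (≤-trans (≤-reflexive
        (≡.trans (cong (_+ length ys) (sym (length-map (λ p → x - p) xs))) (sym (length-++ (map (λ p → x - p) xs)))))
        (distinct-≤-size (AllPairsₚ.++⁺ (AllPairsₚ.map⁺ (AllPairs.map (λ {p} {q} ne e →
            ne (≈-sym (via (solve (v2 ⊖ v0 ⊖ (v2 ⊖ v1)) (v1 ⊖ v0) (p ∷ q ∷ x ∷ [])) e))) d)) d′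
          (Allₚ.map⁺ (All.map (Allₚ.¬Any⇒All¬ ys) (Allₚ.¬Any⇒All¬ xs ¬i)))))))) (<-irrefl ≡.refl)

  X₃ : ∀ {L x y z} → x ∷ y ∷ z ∷ [] ↭ L → X L (y ∙ 2 ⋆ z)
  X₃ {x = x} {y} {z} π = x ∷ y ∷ z ∷ [] , π , wsum₃ x y z

  X₄ : ∀ {L w x y z} → w ∷ x ∷ y ∷ z ∷ [] ↭ L → X L (x ∙ 2 ⋆ y ∙ 3 ⋆ z)
  X₄ {w = w} {x} {y} {z} π = w ∷ x ∷ y ∷ z ∷ [] , π , wsum₄ w x y z

  two-sums : ∀ {u v} → u ≉ v → Has 2 (X (u ∷ v ∷ []))
  two-sums {u} {v} u≉v = v ∷ u ∷ [] , ≤-refl , ((λ e → u≉v (≈-sym e)) ∷ []) ∷ [] ∷ [] ,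
    (u ∷ v ∷ [] , refl , solve (∅ ⊕ ∅ ⊕ (v0 ⊕ ∅)) v0 (v ∷ [])) ∷
    (v ∷ u ∷ [] , swap v u refl , solve (∅ ⊕ ∅ ⊕ (v0 ⊕ ∅)) v0 (u ∷ [])) ∷ []

  -- With v = 0, u = d the six sums are d, 2d, w, 2w, w + 2d, 2w + d.
  module Hexagon {u v w : Carrier} (u≉v : u ≉ v) (w≉v : w ≉ v) (w≉u : w ≉ u) where
    private
      d = u - v
      L : List Carrier
      L = u ∷ v ∷ w ∷ []

    generic : 2 ⋆ d ≉ ε → w - v ≉ 2 ⋆ d → w - v ≉ d ⁻¹ → Has 4 (X L)
    generic 2d≉ε w≉2d w≉-d = (w ∙ 2 ⋆ v) ∷ (w ∙ 2 ⋆ u) ∷ (u ∙ 2 ⋆ v) ∷ (v ∙ 2 ⋆ u) ∷ [] , ≤-refl ,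
      ((λ e → 2d≉ε (≈-sym (via (solve (v2 ⊕ 2 ⊛ v1 ⊖ (v2 ⊕ 2 ⊛ v0)) (∅ ⊖ (2 ⊛ (v0 ⊖ v1))) ρ) e))) ∷
       (λ e → w≉u (cancelʳ _ e)) ∷
       (λ e → w≉2d (via (solve (v2 ⊕ 2 ⊛ v1 ⊖ (v1 ⊕ 2 ⊛ v0)) (v2 ⊖ v1 ⊖ (2 ⊛ (v0 ⊖ v1))) ρ) e)) ∷ []) ∷
      ((λ e → w≉-d (via (solve (v2 ⊕ 2 ⊛ v0 ⊖ (v0 ⊕ 2 ⊛ v1)) (v2 ⊖ v1 ⊖ ⊝ (v0 ⊖ v1)) ρ) e)) ∷
       (λ e → w≉v (cancelʳ _ e)) ∷ []) ∷
      ((λ e → u≉v (≈-sym (via (solve (v0 ⊕ 2 ⊛ v1 ⊖ (v1 ⊕ 2 ⊛ v0)) (v1 ⊖ v0) ρ) e))) ∷ []) ∷ [] ∷ [] ,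
      X₃ σ132 ∷ X₃ σ231 ∷ X₃ σ312 ∷ X₃ σ321 ∷ []
      where ρ = u ∷ v ∷ w ∷ []

    doubled : 3 ⋆ d ≉ ε → 4 ⋆ d ≉ ε → 2 ⋆ d ≉ ε → w - v ≈ 2 ⋆ d → Has 4 (X L)
    doubled 3d 4d 2d e₀ = (u ∙ 2 ⋆ v) ∷ (v ∙ 2 ⋆ u) ∷ (v ∙ 2 ⋆ w) ∷ (u ∙ 2 ⋆ w) ∷ [] , ≤-refl ,
      ((λ e → u≉v (≈-sym (via (solve (v0 ⊕ 2 ⊛ v1 ⊖ (v1 ⊕ 2 ⊛ v0)) (v1 ⊖ v0) ρ) e))) ∷
       (λ e → 3d (≈-trans (≈-trans (solve (3 ⊛ (v0 ⊖ v1)) (⊝ (v0 ⊕ 2 ⊛ v1 ⊖ (v1 ⊕ 2 ⊛ v2)) ⊖ (2 ⊛ (v2 ⊖ v1 ⊖ (2 ⊛ (v0 ⊖ v1))))) ρ)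
             (-‿cong (⁻¹-cong (x≈y⇒x-y≈ε e)) (×-congʳ 2 (x≈y⇒x-y≈ε e₀)))) zero′)) ∷
       (λ e → 4d (≈-trans (≈-trans (solve (4 ⊛ (v0 ⊖ v1)) (⊝ (v0 ⊕ 2 ⊛ v1 ⊖ (v0 ⊕ 2 ⊛ v2)) ⊖ (2 ⊛ (v2 ⊖ v1 ⊖ (2 ⊛ (v0 ⊖ v1))))) ρ)
             (-‿cong (⁻¹-cong (x≈y⇒x-y≈ε e)) (×-congʳ 2 (x≈y⇒x-y≈ε e₀)))) zero′)) ∷ []) ∷
      ((λ e → 2d (≈-trans (≈-trans (solve (2 ⊛ (v0 ⊖ v1)) (⊝ (v1 ⊕ 2 ⊛ v0 ⊖ (v1 ⊕ 2 ⊛ v2)) ⊖ (2 ⊛ (v2 ⊖ v1 ⊖ (2 ⊛ (v0 ⊖ v1))))) ρ)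
             (-‿cong (⁻¹-cong (x≈y⇒x-y≈ε e)) (×-congʳ 2 (x≈y⇒x-y≈ε e₀)))) zero′)) ∷
       (λ e → 3d (≈-trans (≈-trans (solve (3 ⊛ (v0 ⊖ v1)) (⊝ (v1 ⊕ 2 ⊛ v0 ⊖ (v0 ⊕ 2 ⊛ v2)) ⊖ (2 ⊛ (v2 ⊖ v1 ⊖ (2 ⊛ (v0 ⊖ v1))))) ρ)
             (-‿cong (⁻¹-cong (x≈y⇒x-y≈ε e)) (×-congʳ 2 (x≈y⇒x-y≈ε e₀)))) zero′)) ∷ []) ∷
      ((λ e → u≉v (≈-sym (cancelʳ _ e))) ∷ []) ∷ [] ∷ [] ,
      X₃ σ312 ∷ X₃ σ321 ∷ X₃ refl ∷ X₃ σ213 ∷ []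
      where
      ρ = u ∷ v ∷ w ∷ []
      zero′ : ε ⁻¹ - 2 ⋆ ε ≈ ε
      zero′ = solve (⊝ ∅ ⊖ (2 ⊛ ∅)) ∅ []

    opposite : 3 ⋆ d ≉ ε → 4 ⋆ d ≉ ε → 2 ⋆ d ≉ ε → w - v ≈ d ⁻¹ → Has 4 (X L)
    opposite 3d 4d 2d e₀ = (u ∙ 2 ⋆ v) ∷ (v ∙ 2 ⋆ u) ∷ (w ∙ 2 ⋆ v) ∷ (v ∙ 2 ⋆ w) ∷ [] , ≤-refl ,
      ((λ e → u≉v (≈-sym (via (solve (v0 ⊕ 2 ⊛ v1 ⊖ (v1 ⊕ 2 ⊛ v0)) (v1 ⊖ v0) ρ) e))) ∷
       (λ e → w≉u (≈-sym (cancelʳ _ e))) ∷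
       (λ e → 3d (≈-trans (≈-trans (solve (3 ⊛ (v0 ⊖ v1)) (v0 ⊕ 2 ⊛ v1 ⊖ (v1 ⊕ 2 ⊛ v2) ⊕ 2 ⊛ (v2 ⊖ v1 ⊖ ⊝ (v0 ⊖ v1))) ρ)
             (∙-cong (x≈y⇒x-y≈ε e) (×-congʳ 2 (x≈y⇒x-y≈ε e₀)))) zero′)) ∷ []) ∷
      ((λ e → 3d (≈-trans (≈-trans (solve (3 ⊛ (v0 ⊖ v1)) (v1 ⊕ 2 ⊛ v0 ⊖ (v2 ⊕ 2 ⊛ v1) ⊕ 1 ⊛ (v2 ⊖ v1 ⊖ ⊝ (v0 ⊖ v1))) ρ)
             (∙-cong (x≈y⇒x-y≈ε e) (×-congʳ 1 (x≈y⇒x-y≈ε e₀)))) zero″)) ∷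
       (λ e → 4d (≈-trans (≈-trans (solve (4 ⊛ (v0 ⊖ v1)) (v1 ⊕ 2 ⊛ v0 ⊖ (v1 ⊕ 2 ⊛ v2) ⊕ 2 ⊛ (v2 ⊖ v1 ⊖ ⊝ (v0 ⊖ v1))) ρ)
             (∙-cong (x≈y⇒x-y≈ε e) (×-congʳ 2 (x≈y⇒x-y≈ε e₀)))) zero′)) ∷ []) ∷
      ((λ e → w≉v (≈-sym (via (solve (v2 ⊕ 2 ⊛ v1 ⊖ (v1 ⊕ 2 ⊛ v2)) (v1 ⊖ v2) ρ) e))) ∷ []) ∷ [] ∷ [] ,
      X₃ σ312 ∷ X₃ σ321 ∷ X₃ σ132 ∷ X₃ refl ∷ []
      where
      ρ = u ∷ v ∷ w ∷ []
      zero′ : ε ∙ 2 ⋆ ε ≈ ε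
      zero′ = solve (∅ ⊕ 2 ⊛ ∅) ∅ []
      zero″ : ε ∙ 1 ⋆ ε ≈ ε
      zero″ = solve (∅ ⊕ 1 ⊛ ∅) ∅ []

    -- Put v = 0 and e = w - v. In general e, e + 2d, d, 2d are four different sums. They collide
    -- for e = 2d or e = -d, where d, 2d, 4d, 5d or d, 2d, -d, -2d take over; these coincide only if
    -- d has a very small order.
    hexagon : ¬ Has 4 (X L) → 2 ⋆ d ≈ ε ⊎ ((3 ⋆ d ≈ ε ⊎ 4 ⋆ d ≈ ε) × (w - v ≈ 2 ⋆ d ⊎ w - v ≈ d ⁻¹))
    hexagon ¬4 = go (2 ⋆ d ≈? ε) (w - v ≈? 2 ⋆ d) (w - v ≈? d ⁻¹) (3 ⋆ d ≈? ε) (4 ⋆ d ≈? ε)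
      where
      go : Dec (2 ⋆ d ≈ ε) → Dec (w - v ≈ 2 ⋆ d) → Dec (w - v ≈ d ⁻¹) → Dec (3 ⋆ d ≈ ε) → Dec (4 ⋆ d ≈ ε) →
           2 ⋆ d ≈ ε ⊎ ((3 ⋆ d ≈ ε ⊎ 4 ⋆ d ≈ ε) × (w - v ≈ 2 ⋆ d ⊎ w - v ≈ d ⁻¹))
      go (yes e) _ _ _ _ = inj₁ e
      go (no _) (yes e) _ (yes f) _ = inj₂ (inj₁ f , inj₁ e)
      go (no _) (yes e) _ _ (yes f) = inj₂ (inj₂ f , inj₁ e)
      go (no _) _ (yes e) (yes f) _ = inj₂ (inj₁ f , inj₂ e)
      go (no _) _ (yes e) _ (yes f) = inj₂ (inj₂ f , inj₂ e)
      go (no 2d) (yes e) _ (no 3d) (no 4d) = contradiction (doubled 3d 4d 2d e) ¬4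
      go (no 2d) (no _) (yes e) (no 3d) (no 4d) = contradiction (opposite 3d 4d 2d e) ¬4
      go (no 2d) (no p) (no q) _ _ = contradiction (generic 2d p q) ¬4

  module TwoTorsion {u v w : Carrier} (u≉v : u ≉ v) (w≉v : w ≉ v) (w≉u : w ≉ u)
                    (2d : 2 ⋆ (u - v) ≈ ε) (2e : 2 ⋆ (w - v) ≈ ε) where
    private
      d = u - v
      e = w - v

    three-sums : Has 3 (X (u ∷ v ∷ w ∷ []))
    three-sums = (u ∙ 2 ⋆ v) ∷ (w ∙ 2 ⋆ v) ∷ (v ∙ 2 ⋆ u) ∷ [] , ≤-refl ,
      ((λ p → w≉u (≈-sym (cancelʳ _ p))) ∷
       (λ p → u≉v (≈-sym (via (solve (v0 ⊕ 2 ⊛ v1 ⊖ (v1 ⊕ 2 ⊛ v0)) (v1 ⊖ v0) ρ) p))) ∷ []) ∷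
      ((λ p → w≉v (x-y≈ε⇒x≈y (≈-trans (via (solve (v2 ⊕ 2 ⊛ v1 ⊖ (v1 ⊕ 2 ⊛ v0)) (v2 ⊖ v1 ⊖ (2 ⊛ (v0 ⊖ v1))) ρ) p) 2d))) ∷ []) ∷ [] ∷ [] ,
      X₃ σ312 ∷ X₃ σ132 ∷ X₃ σ321 ∷ []
      where ρ = u ∷ v ∷ w ∷ []

    -- The translation to v = 0 costs (0 + 1 + 2 + 3) v. After it only the odd weights 1 and 3
    -- count, so the sums are those of two of the elements 0, d, e, f; five of them are listed.
    five-sums : ∀ {z} → z ≉ v → z ≉ u → z ≉ w → z - v ≉ d ∙ e → 2 ⋆ (z - v) ≈ ε → Has 5 (X (u ∷ v ∷ w ∷ z ∷ []))
    five-sums {z} z≉v z≉u z≉w f≉d+e 2f = Has-map (6 ⋆ v ∙_) (cancelˡ _) id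
      (d ∷ e ∷ f ∷ d ∙ e ∷ d ∙ f ∷ [] , ≤-refl ,
       ((λ p → w≉u (≈-sym (cancelʳ _ p))) ∷ (λ p → z≉u (≈-sym (cancelʳ _ p))) ∷ (λ p → e≉ε (≈-sym (cancelˡ d (≈-trans (identityʳ d) p)))) ∷ (λ p → f≉ε (≈-sym (cancelˡ d (≈-trans (identityʳ d) p)))) ∷ []) ∷
       ((λ p → z≉w (≈-sym (cancelʳ _ p))) ∷ (λ p → d≉ε (≈-sym (cancelʳ e (≈-trans (identityˡ e) p)))) ∷
        (λ p → f≉d+e (≈-sym (≈-trans (via (solve (v1 ⊖ (v0 ⊕ v2)) (v0 ⊕ v1 ⊖ (v2 ⊕ 2 ⊛ v0)) (d ∷ e ∷ f ∷ [])) p) (≈-trans (∙-congˡ 2d) (identityʳ f))))) ∷ []) ∷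
       (f≉d+e ∷ (λ p → d≉ε (≈-sym (cancelʳ f (≈-trans (identityˡ f) p)))) ∷ []) ∷
       ((λ p → z≉w (≈-sym (cancelʳ _ (cancelˡ d p)))) ∷ []) ∷ [] ∷ [] ,
       X-resp (shifted (solve (v0 ⊕ 2 ⊛ v3 ⊕ 3 ⊛ v1) (6 ⊛ v1 ⊕ (v0 ⊖ v1) ⊕ (0 ⊛ (v0 ⊖ v1) ⊕ 0 ⊛ (v2 ⊖ v1) ⊕ 2 ⊛ (v3 ⊖ v1))) ρ) (zeros ≈-refl ≈-refl 2f)) (X₄ {w = w} π₁) ∷
       X-resp (shifted (solve (v2 ⊕ 2 ⊛ v3 ⊕ 3 ⊛ v1) (6 ⊛ v1 ⊕ (v2 ⊖ v1) ⊕ (0 ⊛ (v0 ⊖ v1) ⊕ 0 ⊛ (v2 ⊖ v1) ⊕ 2 ⊛ (v3 ⊖ v1))) ρ) (zeros ≈-refl ≈-refl 2f)) (X₄ {w = u} π₂) ∷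
       X-resp (shifted (solve (v3 ⊕ 2 ⊛ v2 ⊕ 3 ⊛ v1) (6 ⊛ v1 ⊕ (v3 ⊖ v1) ⊕ (0 ⊛ (v0 ⊖ v1) ⊕ 2 ⊛ (v2 ⊖ v1) ⊕ 0 ⊛ (v3 ⊖ v1))) ρ) (zeros ≈-refl 2e ≈-refl)) (X₄ {w = u} π₃) ∷
       X-resp (shifted (solve (v0 ⊕ 2 ⊛ v3 ⊕ 3 ⊛ v2) (6 ⊛ v1 ⊕ (v0 ⊖ v1 ⊕ (v2 ⊖ v1)) ⊕ (0 ⊛ (v0 ⊖ v1) ⊕ 2 ⊛ (v2 ⊖ v1) ⊕ 2 ⊛ (v3 ⊖ v1))) ρ) (zeros ≈-refl 2e 2f)) (X₄ {w = v} π₄) ∷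
       X-resp (shifted (solve (v0 ⊕ 2 ⊛ v2 ⊕ 3 ⊛ v3) (6 ⊛ v1 ⊕ (v0 ⊖ v1 ⊕ (v3 ⊖ v1)) ⊕ (0 ⊛ (v0 ⊖ v1) ⊕ 2 ⊛ (v2 ⊖ v1) ⊕ 2 ⊛ (v3 ⊖ v1))) ρ) (zeros ≈-refl 2e 2f)) (X₄ {w = v} π₅) ∷ [])
      where
      f = z - v
      ρ = u ∷ v ∷ w ∷ z ∷ []
      d≉ε : d ≉ ε
      d≉ε p = u≉v (x-y≈ε⇒x≈y p)
      e≉ε : e ≉ ε
      e≉ε p = w≉v (x-y≈ε⇒x≈y p)
      f≉ε : f ≉ ε
      f≉ε p = z≉v (x-y≈ε⇒x≈y p)
      zeros : ∀ {a b c} → a ≈ ε → b ≈ ε → c ≈ ε → a ∙ b ∙ c ≈ ε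
      zeros p q r = ≈-trans (∙-cong (∙-cong p q) r) (solve (∅ ⊕ ∅ ⊕ ∅) ∅ [])
      shifted : ∀ {x y o} → x ≈ y ∙ o → o ≈ ε → x ≈ y
      shifted p q = ≈-trans p (≈-trans (∙-congˡ q) (identityʳ _))
      π₁ : w ∷ u ∷ z ∷ v ∷ [] ↭ u ∷ v ∷ w ∷ z ∷ []
      π₁ = trans (prep w (prep u (swap z v refl))) σ312
      π₂ : u ∷ w ∷ z ∷ v ∷ [] ↭ u ∷ v ∷ w ∷ z ∷ []
      π₂ = trans (swap u w refl) π₁
      π₃ : u ∷ z ∷ w ∷ v ∷ [] ↭ u ∷ v ∷ w ∷ z ∷ []
      π₃ = trans (prep u (swap z w refl)) π₂
      π₄ : v ∷ u ∷ z ∷ w ∷ [] ↭ u ∷ v ∷ w ∷ z ∷ []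
      π₄ = trans (prep v (prep u (swap z w refl))) σ213
      π₅ : v ∷ u ∷ w ∷ z ∷ [] ↭ u ∷ v ∷ w ∷ z ∷ []
      π₅ = σ213

-- Sequences of |G| terms that do not fill the group.

module Classification (F : FinGroup) (L : List (FinGroup.Carrier F)) (sp : Finite.Spanning F L)
                      (n≡size : length L ≡ FinGroup.size F) (¬all : ¬ (∀ x → FinGroup.X F L x)) where
  open FinGroup F
  open Finite F
  open Cyclicity F
  open Dropping F
  open Blocks F
  open ShortSequences F L using (two-valued-sum)
  open import Relation.Binary.Reasoning.Setoid setoid

  ih : Smaller F
  ih F′ _ = good F′

  open Main.Exceptional F ih L sp n≡size ¬all

  size≡ : ∀ {M} → L ↭ M → size ≡ length M
  size≡ π = ≡.trans (sym n≡size) (↭-length π)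

  size≰ : ∀ {M k} → L ↭ M → k < length M → ¬ (size ≤ k)
  size≰ π l = <⇒≱ (subst (_ <_) (sym (size≡ π)) l)

  -- A block and its complement are arranged independently; by pigeonhole, more than |G| sums in
  -- total would fill the group.
  block : ∀ {a b} B {T} → B ++ T ↭ L → Has a (X B) → Has b (X T) → length (B ++ T) < a + b → ⊥
  block B {T} π hB hT big = ¬all λ x → go x (sumset hB hT (subst (_< _) (sym (size≡ (↭-sym π))) big) (x - length B ⋆ sumL T))
    where
    go : ∀ x → (∃ λ p → ∃ λ q → X B p × X T q × p ∙ q ≈ x - length B ⋆ sumL T) → X L x
    go x (p , q , Xp , Xq , e) = X-resp (begin
        p ∙ length B ⋆ sumL T ∙ q ≈⟨ solve (v0 ⊕ v1 ⊕ v2) (v0 ⊕ v2 ⊕ v1) (p ∷ length B ⋆ sumL T ∷ q ∷ []) ⟩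
        p ∙ q ∙ length B ⋆ sumL T ≈⟨ ∙-congʳ e ⟩
        x - length B ⋆ sumL T ∙ length B ⋆ sumL T ≈⟨ solve (v0 ⊖ v1 ⊕ v1) v0 (x ∷ length B ⋆ sumL T ∷ []) ⟩
        x ∎) (X-↭ π (X-++ Xp Xq))

  -- The two ways in which the removal of an unequal pair can fail to leave a spanning rest. The
  -- constant rest leads to the cyclic sequence, the rest of two terms to the Klein group or again
  -- to the cyclic one.
  Exception : Set₁
  Exception = ∃ λ u → ∃ λ v → ∃ λ p → ∃ λ ps → L ↭ u ∷ v ∷ p ∷ ps × u ≉ v ×
    (All (_≈ p) (p ∷ ps) ⊎ (length (p ∷ ps) ≡ 2 × ¬ Spanning (p ∷ ps)))

  pair : ∀ {u v T} → L ↭ u ∷ v ∷ T → u ≉ v → Spanning T ⊎ Exception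
  pair {u} {v} {[]} π _ = contradiction (singleton-spanning (removable-term (trans π (swap u v refl)))) (size≰ π ≤-refl)
  pair {u} {v} {p ∷ ps} π u≉v = go (dropped ih u p ps (removable-term (trans π (swap u v refl))))
    where
    πv : v ∷ u ∷ p ∷ ps ↭ L
    πv = trans (swap v u refl) (↭-sym π)
    go : Spanning (p ∷ ps) ⊎ All (_≈ p) (p ∷ ps) ⊎ Outcome u (p ∷ ps) → Spanning (p ∷ ps) ⊎ Exception
    go (inj₁ spT) = inj₁ spT
    go (inj₂ (inj₁ a)) = inj₂ (u , v , p , ps , π , u≉v , inj₁ a)
    go (inj₂ (inj₂ (inj₁ f))) = contradiction (λ x → X-↭ πv (X-prefix-all (v ∷ []) f x)) ¬all
    go (inj₂ (inj₂ (inj₂ (inj₁ h)))) = contradiction (Has-≤ (≤-reflexive (↭-length π)) (Has-↭ πv (Has-prefix (v ∷ []) h))) ¬Has-n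
    go (inj₂ (inj₂ (inj₂ (inj₂ (e , _ , _ , ¬sp))))) = inj₂ (u , v , p , ps , π , u≉v , inj₂ (e , ¬sp))

  -- `Spanning` quantifies over predicates and is not decided by itself. Instead `pair` is run on
  -- every arrangement of `L`, which either finds an exception or proves spanning for all pairs.
  GoodStart : List Carrier → Set₁
  GoodStart M = ∀ {u v T} → M ≡ u ∷ v ∷ T → u ≉ v → Spanning T

  check : ∀ M → M ↭ L → GoodStart M ⊎ Exception
  check [] π = inj₁ λ ()
  check (_ ∷ []) π = inj₁ λ ()
  check (u ∷ v ∷ T) π with u ≈? v
  ... | yes e = inj₁ λ { ≡.refl u≉v → contradiction e u≉v }
  ... | no u≉v with pair (↭-sym π) u≉v
  ... | inj₁ spT = inj₁ λ { ≡.refl _ → spT }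
  ... | inj₂ e = inj₂ e

  check-all : ∀ {Ms} → All (_↭ L) Ms → All GoodStart Ms ⊎ Exception
  check-all [] = inj₁ []
  check-all {M ∷ _} (π ∷ πs) with check M π | check-all πs
  ... | inj₂ e | _ = inj₂ e
  ... | inj₁ _ | inj₂ e = inj₂ e
  ... | inj₁ g | inj₁ gs = inj₁ (g ∷ gs)

  module NoException (pairs : ∀ {u v T} → L ↭ u ∷ v ∷ T → u ≉ v → Spanning T) where

    -- An essential `w` would come with a surplus, which together with the two sums of the block u,
    -- v exceeds |G|. If the rest is constant, equal to p, then u - p, v - p and w - p each generate
    -- the group, and this is refuted by the number of copies of p.
    triple : ∀ {u v w T} → L ↭ u ∷ v ∷ w ∷ T → u ≉ v → w ≉ v → w ≉ u → Spanning T
    triple {u} {v} {w} {[]} π u≉v w≉v w≉u = contradiction (singleton-spanning (pairs π u≉v)) (size≰ π (s≤s (s≤s z≤n)))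
    triple {u} {v} {w} {p ∷ ps} π u≉v w≉v w≉u = go (dropped ih w p ps (pairs π u≉v))
      where
      constant : All (_≈ p) (p ∷ ps) → ⊥
      constant (_ ∷ a) = go′ ps a π
        where
        gen-u : Generates (u - p)
        gen-u = constant-generates (pairs (trans π (trans (swap u v refl) (prep v (swap u w refl)))) (λ e → w≉v (≈-sym e))) (≈-refl ∷ a)
        gen-v : Generates (v - p)
        gen-v = constant-generates (pairs (trans π (trans (prep u (swap v w refl)) refl)) (λ e → w≉u (≈-sym e))) (≈-refl ∷ a)
        gen-w : Generates (w - p)
        gen-w = constant-generates (pairs π u≉v) (≈-refl ∷ a)
        small : ∀ {x k} → Generates x → 0 < k → k < 4 → k ⋆ x ≉ ε
        small gen 0<k k<4 e = size≰ π (<-≤-trans k<4 (s≤s (s≤s (s≤s (s≤s z≤n))))) (order-≥-size gen _ 0<k e)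
        ≉p : ∀ {x} → Generates (x - p) → x ≉ p
        ≉p gen e = small gen (s≤s z≤n) (s≤s (s≤s z≤n)) (≈-trans (identityʳ _) (x≈y⇒x-y≈ε e))
        go′ : ∀ ps → All (_≈ p) ps → L ↭ u ∷ v ∷ w ∷ p ∷ ps → ⊥
        -- The group has order 4 and is listed by u, v, w, p. The element p + 2 (u - p) is none of
        -- them, since each of the first three differs from p by a generator.
        go′ [] _ π = doubled (distinct-cover four (All.universal complete _) (≤-reflexive (size≡ π)) (complete (p ∙ 2 ⋆ (u - p))))
          where
          four : Distinct (u ∷ v ∷ w ∷ p ∷ [])
          four = (u≉v ∷ (λ e → w≉u (≈-sym e)) ∷ ≉p gen-u ∷ []) ∷ ((λ e → w≉v (≈-sym e)) ∷ ≉p gen-v ∷ []) ∷ (≉p gen-w ∷ []) ∷ [] ∷ []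
          4a≈ε : 4 ⋆ (u - p) ≈ ε
          4a≈ε = ≈-trans (×-congˡ (sym (size≡ π))) (lagrange (u - p))
          twice : ∀ {x} → Generates (x - p) → ¬ (p ∙ 2 ⋆ (u - p) ≈ x)
          twice {x} gen e = small gen (s≤s z≤n) (s≤s (s≤s (s≤s z≤n))) (≈-trans
            (solve (2 ⊛ (v2 ⊖ v1)) (4 ⊛ (v0 ⊖ v1) ⊖ (2 ⊛ (v1 ⊕ 2 ⊛ (v0 ⊖ v1) ⊖ v2))) (u ∷ p ∷ x ∷ []))
            (≈-trans (-‿cong 4a≈ε (×-congʳ 2 (x≈y⇒x-y≈ε e))) (solve (∅ ⊖ (2 ⊛ ∅)) ∅ [])))
          doubled : ¬ (p ∙ 2 ⋆ (u - p) ∈ u ∷ v ∷ w ∷ p ∷ [])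
          doubled (here e) = ≉p gen-u (via (solve (v1 ⊕ 2 ⊛ (v0 ⊖ v1) ⊖ v0) (v0 ⊖ v1) (u ∷ p ∷ [])) e)
          doubled (there (here e)) = twice gen-v e
          doubled (there (there (here e))) = twice gen-w e
          doubled (there (there (there (here e)))) = small gen-u (s≤s z≤n) (s≤s (s≤s (s≤s z≤n)))
            (via (solve (v1 ⊕ 2 ⊛ (v0 ⊖ v1) ⊖ v1) (2 ⊛ (v0 ⊖ v1) ⊖ ∅) (u ∷ p ∷ [])) e)
        -- The block u, p, v is split off; the second copy `r` of p keeps the rest spanning, and
        -- four sums of the block would be too many.
        go′ (r ∷ rs) (r≈p ∷ a) π = by-order (Hexagon.hexagon (≉p gen-u) (≉p gen-v) (λ e → u≉v (≈-sym e))
            (λ h → block (u ∷ p ∷ v ∷ []) (↭-sym π′) h (bound-rec (w ∷ r ∷ rs) (short π′) spT) (≤-refl)))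
          where
          π′ : L ↭ u ∷ p ∷ v ∷ w ∷ r ∷ rs
          π′ = trans π (prep u (trans (prep v (swap w p refl)) (swap v p refl)))
          short : ∀ {M a b c} → L ↭ a ∷ b ∷ c ∷ M → length M < length L
          short ρ = subst (_ <_) (sym (↭-length ρ)) (m≤n⇒m≤1+n (m≤n⇒m≤1+n ≤-refl))
          spT : Spanning (w ∷ r ∷ rs)
          spT = Spanning-↭ (swap r w refl) (Spanning-dup (≈-sym r≈p) (Spanning-↭ (trans (swap w p refl) (prep p (swap w r refl)))
                  (pairs π u≉v)))
          by-order : ¬ (2 ⋆ (u - p) ≈ ε ⊎ ((3 ⋆ (u - p) ≈ ε ⊎ 4 ⋆ (u - p) ≈ ε) × (v - p ≈ 2 ⋆ (u - p) ⊎ v - p ≈ (u - p) ⁻¹)))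
          by-order (inj₁ e) = size≰ π (s≤s (s≤s (s≤s z≤n))) (order-≥-size gen-u 2 (s≤s z≤n) e)
          by-order (inj₂ (inj₁ e , _)) = size≰ π (s≤s (s≤s (s≤s (s≤s z≤n)))) (order-≥-size gen-u 3 (s≤s z≤n) e)
          by-order (inj₂ (inj₂ e , _)) = size≰ π (s≤s (s≤s (s≤s (s≤s (s≤s z≤n))))) (order-≥-size gen-u 4 (s≤s z≤n) e)
      go : Spanning (p ∷ ps) ⊎ All (_≈ p) (p ∷ ps) ⊎ Outcome w (p ∷ ps) → Spanning (p ∷ ps)
      go (inj₁ spT) = spT
      go (inj₂ (inj₁ a)) = ⊥-elim (constant a)
      go (inj₂ (inj₂ (inj₁ f))) = contradiction (λ x → X-↭ (↭-sym π) (X-prefix-all (u ∷ v ∷ []) f x)) ¬all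
      go (inj₂ (inj₂ (inj₂ (inj₁ h)))) = ⊥-elim (block (u ∷ v ∷ []) (↭-sym π) (two-sums u≉v) h ≤-refl)
      go (inj₂ (inj₂ (inj₂ (inj₂ (e , s≤4 , _))))) = contradiction s≤4 (size≰ π (subst (λ k → 4 < 3 + k) (sym e) ≤-refl))

    5≤size : ∀ {u v w T} → L ↭ u ∷ v ∷ w ∷ T → u ≉ v → w ≉ v → w ≉ u → 5 ≤ size
    5≤size {T = []} π a b c = contradiction (singleton-spanning (pairs π a)) (size≰ π (s≤s (s≤s z≤n)))
    5≤size {T = _ ∷ []} π a b c = contradiction (singleton-spanning (triple π a b c)) (size≰ π (s≤s (s≤s z≤n)))
    5≤size {T = _ ∷ _ ∷ _} π a b c = subst (5 ≤_) (sym (size≡ π)) (s≤s (s≤s (s≤s (s≤s (s≤s z≤n)))))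

    no-four : ∀ {u v w T} → L ↭ u ∷ v ∷ w ∷ T → u ≉ v → w ≉ v → w ≉ u → ¬ Has 4 (X (u ∷ v ∷ w ∷ []))
    no-four {u} {v} {w} {T} π a b c h = block (u ∷ v ∷ w ∷ []) (↭-sym π) h
      (bound-rec T (subst (length T <_) (sym (↭-length π)) (m≤n⇒m≤1+n (m≤n⇒m≤1+n ≤-refl))) (triple π a b c)) ≤-refl

    module _ {u v T} (π : L ↭ u ∷ v ∷ T) (u≉v : u ≉ v) where
      private
        d = u - v

      Third : Carrier → Set
      Third w = (w ≉ v) × (w ≉ u)

      third? : ∀ w → Dec (Third w)
      third? w = ¬? (w ≈? v) ×-dec ¬? (w ≈? u)

      two-valued : ¬ All (λ w → w ≈ v ⊎ w ≈ u) T
      two-valued a with two-valued-sum T a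
      ... | k , l , e = size≰ π (s≤s (s≤s l)) (order-≥-size gen (suc k) (s≤s z≤n) (begin
          suc k ⋆ d
            ≈⟨ solve (v0 ⊖ v1 ⊕ v2) (v0 ⊕ (v1 ⊕ (v3 ⊕ v2)) ⊖ (v1 ⊕ (v1 ⊕ v3))) (u ∷ v ∷ k ⋆ d ∷ length T ⋆ v ∷ []) ⟩
          u ∙ (v ∙ (length T ⋆ v ∙ k ⋆ d)) - (2 + length T) ⋆ v
            ≈⟨ -‿cong (∙-congˡ (∙-congˡ (≈-sym e))) (≈-trans (×-congˡ (sym (size≡ π))) (lagrange v)) ⟩
          u ∙ (v ∙ sumL T) - ε ≈⟨ ∙-congʳ (≈-trans (≈-sym (sumL-↭ π)) (sum-zero π)) ⟩
          ε - ε ≈⟨ inverseʳ ε ⟩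
          ε ∎))
        where
        in-multiples : ∀ {w} → w ≈ v ⊎ w ≈ u → ∃ λ k → w - v ≈ k ⋆ d
        in-multiples (inj₁ e) = 0 , x≈y⇒x-y≈ε e
        in-multiples (inj₂ e) = 1 , ≈-trans (∙-congʳ e) (≈-sym (identityʳ d))
        gen : Generates d
        gen = sp _ (multiples-closed d) v (All-resp-↭ (↭-sym π) (in-multiples (inj₂ ≈-refl) ∷ in-multiples (inj₁ ≈-refl) ∷ All.map in-multiples a))

      classify : ∀ w → w ≈ v ⊎ w ≈ u ⊎ Third w
      classify w = go (w ≈? v) (w ≈? u)
        where
        go : Dec (w ≈ v) → Dec (w ≈ u) → w ≈ v ⊎ w ≈ u ⊎ Third w
        go (yes e) _ = inj₁ e
        go _ (yes e) = inj₂ (inj₁ e)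
        go (no p) (no q) = inj₂ (inj₂ (p , q))

      third-exists : Any Third T
      third-exists = decidable-stable (Any.any? third? T) λ ¬i → two-valued (All.map (λ {w} ¬t → go ¬t (classify w)) (Allₚ.¬Any⇒All¬ T ¬i))
        where
        go : ∀ {w} → ¬ Third w → w ≈ v ⊎ w ≈ u ⊎ Third w → w ≈ v ⊎ w ≈ u
        go _ (inj₁ e) = inj₁ e
        go _ (inj₂ (inj₁ e)) = inj₂ e
        go ¬t (inj₂ (inj₂ t)) = contradiction t ¬t

      at-third : ∀ {w} → Any (w ≡_) T → Third w →
                 2 ⋆ d ≈ ε ⊎ ((3 ⋆ d ≈ ε ⊎ 4 ⋆ d ≈ ε) × (w - v ≈ 2 ⋆ d ⊎ w - v ≈ d ⁻¹))
      at-third i (w≉v , w≉u) with extract i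
      ... | w , T′ , ≡.refl , ρ = Hexagon.hexagon u≉v w≉v w≉u (no-four (trans π (prep u (prep v ρ))) u≉v w≉v w≉u)

      -- Otherwise the hexagon forces every third term into v + 2d or v - d. Then d generates the
      -- group and is annihilated by 3 or 4, against |G| being at least 5.
      2-torsion : 2 ⋆ d ≈ ε
      2-torsion = decidable-stable (2 ⋆ d ≈? ε) λ 2d≉ε → absurd 2d≉ε (extract third-exists)
        where
        absurd : 2 ⋆ d ≉ ε → ¬ (∃ λ w → ∃ λ T′ → Third w × T ↭ w ∷ T′)
        absurd 2d≉ε (w , T′ , t@(w≉v , w≉u) , ρ) = go (at-third (Any-resp-↭ (↭-sym ρ) (here ≡.refl)) t)
          where
          multiple : ∀ {x} → x - v ≈ 2 ⋆ d ⊎ x - v ≈ d ⁻¹ → ∃ λ k → x - v ≈ k ⋆ d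
          multiple (inj₁ e) = 2 , e
          multiple (inj₂ e) = Closed.resp (multiples-closed d) (≈-sym e) (Closed.⁻¹∈ (multiples-closed d) (1 , ≈-sym (identityʳ d)))
          in-multiples : ∀ {x} → Any (x ≡_) T → x ≈ v ⊎ x ≈ u ⊎ Third x → ∃ λ k → x - v ≈ k ⋆ d
          in-multiples _ (inj₁ e) = 0 , x≈y⇒x-y≈ε e
          in-multiples _ (inj₂ (inj₁ e)) = 1 , ≈-trans (∙-congʳ e) (≈-sym (identityʳ d))
          in-multiples i (inj₂ (inj₂ t)) = go′ (at-third i t)
            where
            go′ : ∀ {x} → 2 ⋆ d ≈ ε ⊎ ((3 ⋆ d ≈ ε ⊎ 4 ⋆ d ≈ ε) × (x - v ≈ 2 ⋆ d ⊎ x - v ≈ d ⁻¹)) → ∃ λ k → x - v ≈ k ⋆ d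
            go′ (inj₁ e) = contradiction e 2d≉ε
            go′ (inj₂ (_ , m)) = multiple m
          gen : Generates d
          gen = sp _ (multiples-closed d) v (All-resp-↭ (↭-sym π) ((1 , ≈-sym (identityʳ d)) ∷ (0 , inverseʳ v) ∷
            All.tabulate (λ {x} i → in-multiples i (classify x))))
          5≤ : 5 ≤ size
          5≤ = 5≤size (trans π (prep u (prep v ρ))) u≉v w≉v w≉u
          go : ¬ (2 ⋆ d ≈ ε ⊎ ((3 ⋆ d ≈ ε ⊎ 4 ⋆ d ≈ ε) × (w - v ≈ 2 ⋆ d ⊎ w - v ≈ d ⁻¹)))
          go (inj₁ e) = 2d≉ε e
          go (inj₂ (inj₁ e , _)) = <⇒≱ 5≤ (m≤n⇒m≤1+n (order-≥-size gen 3 (s≤s z≤n) e))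
          go (inj₂ (inj₂ e , _)) = <⇒≱ 5≤ (order-≥-size gen 4 (s≤s z≤n) e)

    torsion : ∀ {x y T} → L ↭ x ∷ y ∷ T → 2 ⋆ (x - y) ≈ ε
    torsion {x} {y} π = go (x ≈? y)
      where
      go : Dec (x ≈ y) → 2 ⋆ (x - y) ≈ ε
      go (yes e) = ≈-trans (×-congʳ 2 (x≈y⇒x-y≈ε e)) (⋆-ε 2)
      go (no ne) = 2-torsion π ne

    module _ {u v w T} (π : L ↭ u ∷ v ∷ w ∷ T) (u≉v : u ≉ v) (w≉v : w ≉ v) (w≉u : w ≉ u) where
      private
        d = u - v
        e = w - v
        K : List Carrier
        K = ε ∷ d ∷ e ∷ d ∙ e ∷ []
        2d : 2 ⋆ d ≈ ε
        2d = torsion π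
        2e : 2 ⋆ e ≈ ε
        2e = torsion (trans π (trans (swap u v refl) (trans (prep v (swap u w refl)) (swap v w refl))))
        open TwoTorsion u≉v w≉v w≉u 2d 2e

      -- Such a `z` gives the block u, v, w, z five sums. Together with the n - 4 sums of a spanning
      -- rest this is more than |G|; if `z` is essential, the three sums of u, v, w and the surplus
      -- are used instead.
      no-fourth : ∀ {z U} → T ↭ z ∷ U → ¬ ((z - v) ∈ K) → ⊥
      no-fourth {z} {U} ρ z∉K = from U π′
        where
        π′ : L ↭ u ∷ v ∷ w ∷ z ∷ U
        π′ = trans π (prep u (prep v (prep w ρ)))
        from : ∀ U → L ↭ u ∷ v ∷ w ∷ z ∷ U → ⊥
        from [] π′ = size≰ π′ (s≤s (s≤s z≤n)) (singleton-spanning (triple π′ u≉v w≉v w≉u))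
        from (p ∷ ps) π′ = go (dropped ih z p ps (triple π′ u≉v w≉v w≉u))
          where
          five : Has 5 (X (u ∷ v ∷ w ∷ z ∷ []))
          five = five-sums (λ q → z∉K (here (x≈y⇒x-y≈ε q))) (λ q → z∉K (there (here (∙-congʳ q)))) (λ q → z∉K (there (there (here (∙-congʳ q)))))
            (λ q → z∉K (there (there (there (here q))))) (torsion (trans π′ (trans (prep u (prep v (swap w z refl))) (trans (prep u (swap v z refl)) (trans (swap u z refl) (prep z (swap u v refl)))))))
          2zp : 2 ⋆ (z - p) ≈ ε
          2zp = torsion (trans π′ (Perm.++-comm (u ∷ v ∷ w ∷ []) (z ∷ p ∷ ps)))
          go : ¬ (Spanning (p ∷ ps) ⊎ All (_≈ p) (p ∷ ps) ⊎ Outcome z (p ∷ ps))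
          go (inj₁ spT) = block (u ∷ v ∷ w ∷ z ∷ []) (↭-sym π′) five
            (bound-rec (p ∷ ps) (subst (length (p ∷ ps) <_) (sym (↭-length π′)) (m≤n⇒m≤1+n (m≤n⇒m≤1+n (m≤n⇒m≤1+n ≤-refl)))) spT) ≤-refl
          go (inj₂ (inj₁ a)) = size≰ π′ (s≤s (s≤s (s≤s z≤n))) (order-≥-size (constant-generates (triple π′ u≉v w≉v w≉u) a) 2 (s≤s z≤n) 2zp)
          go (inj₂ (inj₂ (inj₁ f))) = ¬all λ x → X-↭ (↭-sym π′) (X-prefix-all (u ∷ v ∷ w ∷ []) f x)
          go (inj₂ (inj₂ (inj₂ (inj₁ h)))) = block (u ∷ v ∷ w ∷ []) (↭-sym π′) three-sums h ≤-refl
          go (inj₂ (inj₂ (inj₂ (inj₂ (q , s≤4 , _))))) = size≰ π′ (subst (λ k → 4 < 4 + k) (sym q) (s≤s (s≤s (s≤s (s≤s (s≤s z≤n)))))) s≤4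

      -- The group would be generated by two elements annihilated by 2 and so have at most four
      -- elements.
      all-in-K : ¬ All (λ z → (z - v) ∈ K) T
      all-in-K a = <⇒≱ (5≤size π u≉v w≉v w≉u) (distinct-length distinct (All.universal covered elems))
        where
        P : Carrier → Set
        P x = ∃ λ j → ∃ λ k → x ≈ j ⋆ d ∙ k ⋆ e
        cl : Closed P
        cl = record
          { resp = λ q (j , k , r) → j , k , ≈-trans (≈-sym q) r
          ; ε∈ = 0 , 0 , ≈-sym (identityʳ ε)
          ; ∙∈ = λ (j , k , q) (j′ , k′ , r) → j + j′ , k + k′ , ≈-trans (∙-cong q r)
              (≈-trans (solve (v0 ⊕ v1 ⊕ (v2 ⊕ v3)) (v0 ⊕ v2 ⊕ (v1 ⊕ v3)) (j ⋆ d ∷ k ⋆ e ∷ j′ ⋆ d ∷ k′ ⋆ e ∷ []))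
                (≈-sym (∙-cong (×-homo-+ d j j′) (×-homo-+ e k k′)))) }
        K⊆P : ∀ {x} → x ∈ K → P x
        K⊆P (here q) = 0 , 0 , ≈-trans q (≈-sym (identityʳ ε))
        K⊆P (there (here q)) = 1 , 0 , ≈-trans q (solve v0 (v0 ⊕ ∅ ⊕ ∅) (d ∷ []))
        K⊆P (there (there (here q))) = 0 , 1 , ≈-trans q (solve v0 (∅ ⊕ (v0 ⊕ ∅)) (e ∷ []))
        K⊆P (there (there (there (here q)))) = 1 , 1 , ≈-trans q (solve (v0 ⊕ v1) (v0 ⊕ ∅ ⊕ (v1 ⊕ ∅)) (d ∷ e ∷ []))
        P-all : ∀ x → P x
        P-all = sp P cl v (All-resp-↭ (↭-sym π) (K⊆P (there (here ≈-refl)) ∷ K⊆P (here (inverseʳ v)) ∷ K⊆P (there (there (here ≈-refl))) ∷ All.map K⊆P a))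
        bits : ∀ {x} j k → j < 2 → k < 2 → x ≈ j ⋆ d ∙ k ⋆ e → x ∈ K
        bits 0 0 _ _ q = here (≈-trans q (identityʳ ε))
        bits 1 0 _ _ q = there (here (≈-trans q (solve (v0 ⊕ ∅ ⊕ ∅) v0 (d ∷ []))))
        bits 0 1 _ _ q = there (there (here (≈-trans q (solve (∅ ⊕ (v0 ⊕ ∅)) v0 (e ∷ [])))))
        bits 1 1 _ _ q = there (there (there (here (≈-trans q (solve (v0 ⊕ ∅ ⊕ (v1 ⊕ ∅)) (v0 ⊕ v1) (d ∷ e ∷ []))))))
        bits (suc (suc _)) _ (s≤s (s≤s ())) _ _
        bits _ (suc (suc _)) _ (s≤s (s≤s ())) _
        covered : ∀ x → x ∈ K
        covered x = go (P-all x)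
          where
          go : P x → x ∈ K
          go (j , k , q) = bits (j % 2) (k % 2) (m%n<n j 2) (m%n<n k 2) (≈-trans q (∙-cong (⋆-mod 2 2d j) (⋆-mod 2 2e k)))

      no-triple : ⊥
      no-triple = go (Any.any? (λ z → ¬? ((z - v) ∈? K)) T)
        where
        go : ¬ Dec (Any (λ z → ¬ ((z - v) ∈ K)) T)
        go (yes i) = found (extract i)
          where
          found : ¬ (∃ λ z → ∃ λ U → ¬ ((z - v) ∈ K) × T ↭ z ∷ U)
          found (z , U , z∉K , ρ) = no-fourth ρ z∉K
        go (no ¬i) = all-in-K (All.map (λ {z} ¬¬q → decidable-stable ((z - v) ∈? K) ¬¬q) (Allₚ.¬Any⇒All¬ T ¬i))

    absurd : ⊥
    absurd = go L refl
      where
      go : ∀ M → ¬ (L ↭ M)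
      go [] π = contradiction (subst (0 <_) (size≡ π) 0<size) λ ()
      go (p ∷ ps) π = go′ (constant-or-pair p ps)
        where
        go′ : ¬ (All (_≈ p) ps ⊎ ∃ λ v → ∃ λ T → p ∷ ps ↭ p ∷ v ∷ T × p ≉ v)
        go′ (inj₁ a) = ¬Has-n (Has-↭ (↭-sym π) (Has-≤ (⊓-glb (≤-reflexive n≡size) (≤-reflexive (↭-length π))) (constant-Has (Spanning-↭ π sp) a)))
        go′ (inj₂ (v , T , ρ , p≉v)) = found (extract (third-exists (trans π ρ) p≉v))
          where
          found : ¬ (∃ λ w → ∃ λ T′ → ((w ≉ v) × (w ≉ p)) × T ↭ w ∷ T′)
          found (w , T′ , (w≉v , w≉p) , τ) = no-triple (trans π (trans ρ (prep p (prep v τ)))) p≉v w≉v w≉p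

  exception : Exception
  exception = go (check-all (arrangements-sound L))
    where
    go : All GoodStart (arrangements L) ⊎ Exception → Exception
    go (inj₂ e) = e
    go (inj₁ gs) = ⊥-elim (NoException.absurd (λ π u≉v → All.lookup gs (arrangements-complete L (↭-sym π)) ≡.refl u≉v))

  CyclicCase : Set
  CyclicCase = ∃ λ u → ∃ λ v → ∃ λ p → ∃ λ ps → L ↭ u ∷ v ∷ p ∷ ps × All (_≈ p) (p ∷ ps) × Generates (u - p) ×
    v ≈ p - (u - p) × (∀ z → z ≉ triangle size p → X L z)

  KleinCase : Set
  KleinCase = ∃ λ u → ∃ λ v → ∃ λ p → ∃ λ r → L ↭ u ∷ v ∷ p ∷ r ∷ [] × Distinct (u ∷ v ∷ p ∷ r ∷ []) ×
    2 ⋆ (r - p) ≈ ε × 2 ⋆ (u - p) ≈ ε × (∀ z → z ≉ ε → X L z)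

  -- The sum of all terms and n p both vanish, which forces v = p - g. With v first, moving u
  -- through the copies of p gives the offsets g, 2g, ..., (n - 1) g from `triangle size p`, so only
  -- the offset 0 can be missing.
  cyclic-case : ∀ {u v p ps} → L ↭ u ∷ v ∷ p ∷ ps → All (_≈ p) (p ∷ ps) → CyclicCase
  cyclic-case {u} {v} {p} {ps} π a = u , v , p , ps , π , a , gen , v≈ , sums
    where
    T = p ∷ ps
    g = u - p
    πv : L ↭ v ∷ u ∷ T
    πv = trans π (swap u v refl)
    gen : Generates g
    gen = constant-generates (removable-term πv) a
    v≈ : v ≈ p - g
    v≈ = via (begin
      u ∙ (v ∙ sumL T) - (2 + length T) ⋆ p ≈⟨ ∙-congʳ (∙-congˡ (∙-congˡ (constant-sum a))) ⟩
      u ∙ (v ∙ length T ⋆ p) - (p ∙ (p ∙ length T ⋆ p))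
        ≈⟨ solve (v0 ⊕ (v1 ⊕ v3) ⊖ (v2 ⊕ (v2 ⊕ v3))) (v1 ⊖ (v2 ⊖ (v0 ⊖ v2))) (u ∷ v ∷ p ∷ length T ⋆ p ∷ []) ⟩
      v - (p - g) ∎)
      (≈-trans (≈-sym (sumL-↭ π)) (≈-trans (sum-zero π) (≈-sym (≈-trans (×-congˡ (sym (size≡ π))) (lagrange p)))))
    value : ∀ k → prefix (v ∷ []) (u ∷ T) ∙ (wsum (u ∷ T) ∙ k ⋆ g) ≈ triangle size p ∙ suc k ⋆ g
    value k = begin
      prefix (v ∷ []) (u ∷ T) ∙ (wsum T ∙ sumL T ∙ k ⋆ g)
        ≈⟨ solve (∅ ⊕ ∅ ⊕ (v0 ⊕ v1 ⊕ ∅) ⊕ (v2 ⊕ v1 ⊕ v3)) (v2 ⊕ v1 ⊕ (v4 ⊕ v1) ⊕ (v0 ⊖ v4 ⊕ v3)) (u ∷ sumL T ∷ wsum T ∷ k ⋆ g ∷ p ∷ []) ⟩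
      wsum T ∙ sumL T ∙ (p ∙ sumL T) ∙ (g ∙ k ⋆ g)
        ≈⟨ ∙-congʳ (∙-cong (∙-cong (constant-wsum a) sumT) (∙-congˡ sumT)) ⟩
      triangle (2 + length T) p ∙ suc k ⋆ g ≡⟨ cong (λ n → triangle n p ∙ suc k ⋆ g) (size≡ π) ⟨
      triangle size p ∙ suc k ⋆ g ∎
      where
      sumT : sumL T ≈ sumL (replicate (length T) p)
      sumT = ≈-trans (constant-sum a) (≈-sym (sumL-replicate (length T) p))
    multiple : ∀ k → suc k < size → X L (triangle size p ∙ suc k ⋆ g)
    multiple k l = X-resp (value k) (X-↭ (↭-sym πv) (X-prefix (v ∷ []) (constant-X T a k (≤-pred (≤-pred (subst (suc k <_) (size≡ π) l))))))
    sums : ∀ z → z ≉ triangle size p → X L z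
    sums z ne = go (gen (z - triangle size p))
      where
      c = triangle size p
      instance _ = size-nonZero
      go : (∃ λ k → z - c ≈ k ⋆ g) → X L z
      go (k , e) = at (k % size) (m%n<n k size) (≈-trans e (⋆-mod size (lagrange g) k))
        where
        at : ∀ k → k < size → z - c ≈ k ⋆ g → X L z
        at zero _ e = contradiction (x-y≈ε⇒x≈y e) ne
        at (suc k) l e = X-resp (≈-trans (∙-congˡ (≈-sym e)) (solve (v0 ⊕ (v1 ⊖ v0)) v1 (c ∷ z ∷ []))) (multiple k l)

  -- In a group of order 4, p and r fail to span only if x = r - p has order two. As every term is
  -- removable, u and v lie in the other coset of {0, x}, so v = u + x, and the vanishing sum of all
  -- terms gives 2 (u - p) = 0.
  klein-case : ∀ {u v p r} → L ↭ u ∷ v ∷ p ∷ r ∷ [] → u ≉ v → p ≉ r → ¬ Spanning (p ∷ r ∷ []) → KleinCase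
  klein-case {u} {v} {p} {r} π u≉v p≉r ¬sp = u , v , p , r , π , four , 2x≈ε , 2a≈ε , sums
    where
    x = r - p
    a = u - p
    4⋆ : ∀ y → 4 ⋆ y ≈ ε
    4⋆ y = ≈-trans (×-congˡ (sym (size≡ π))) (lagrange y)
    x≉ε : x ≉ ε
    x≉ε e = p≉r (≈-sym (x-y≈ε⇒x≈y e))
    2x≈ε : 2 ⋆ x ≈ ε
    2x≈ε = decidable-stable (2 ⋆ x ≈? ε) λ 2x≉ε → ¬sp (spanning 2x≉ε)
      where
      order : 2 ⋆ x ≉ ε → ∀ k → 0 < k → k ⋆ x ≈ ε → 4 ≤ k
      order 2x≉ε 1 _ e = contradiction (≈-trans (≈-sym (identityʳ x)) e) x≉ε
      order 2x≉ε 2 _ e = contradiction e 2x≉ε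
      order 2x≉ε 3 _ e = contradiction (via (solve (4 ⊛ v0 ⊖ (3 ⊛ v0)) (v0 ⊖ ∅) (x ∷ [])) (≈-trans (4⋆ x) (≈-sym e))) x≉ε
      order 2x≉ε (suc (suc (suc (suc k)))) _ e = s≤s (s≤s (s≤s (s≤s z≤n)))
      spanning : 2 ⋆ x ≉ ε → Spanning (p ∷ r ∷ [])
      spanning 2x≉ε P c g (ip ∷ ir ∷ []) y = found (distinct-cover {applyUpTo (_⋆ x) 4}
          (AllPairsₚ.applyUpTo⁺₁ (_⋆ x) 4 (⋆-injective (order 2x≉ε))) (All.universal complete _) (≤-reflexive (size≡ π)) (complete y))
        where
        Px : P x
        Px = Closed.resp c (solve (v1 ⊖ v2 ⊖ (v0 ⊖ v2)) (v1 ⊖ v0) (p ∷ r ∷ g ∷ [])) (Closed.-∈ c ir ip)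
        found : y ∈ applyUpTo (_⋆ x) 4 → P y
        found i = All.lookupWith (λ q e → Closed.resp c (≈-sym e) q) (Allₚ.applyUpTo⁺₁ (_⋆ x) 4 (λ {k} _ → Closed.⋆∈ c k Px)) i
    outside : ∀ {y z} → L ↭ z ∷ y ∷ p ∷ r ∷ [] → (y ≉ p) × (y ≉ r)
    outside {y} {z} ρ = (λ e → trapped (inj₁ (x≈y⇒x-y≈ε e))) , (λ e → trapped (inj₂ (∙-congʳ e)))
      where
      Q : Carrier → Set
      Q y = y ≈ ε ⊎ y ≈ x
      trapped : ¬ Q (y - p)
      trapped q = size≰ π (s≤s (s≤s (s≤s z≤n))) (distinct-length {ys = ε ∷ x ∷ []} distinct (All.universal (λ z → in-list (removable-term ρ Q (order-two-closed 2x≈ε) p (q ∷ inj₁ (inverseʳ p) ∷ inj₂ ≈-refl ∷ []) z)) elems))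
        where
        in-list : ∀ {z} → Q z → z ∈ ε ∷ x ∷ []
        in-list (inj₁ e) = here e
        in-list (inj₂ e) = there (here e)
    πv : L ↭ v ∷ u ∷ p ∷ r ∷ []
    πv = trans π (swap u v refl)
    four : Distinct (u ∷ v ∷ p ∷ r ∷ [])
    four = (u≉v ∷ proj₁ (outside πv) ∷ proj₂ (outside πv) ∷ []) ∷ (proj₁ (outside π) ∷ proj₂ (outside π) ∷ []) ∷ (p≉r ∷ []) ∷ [] ∷ []
    cover : ∀ y → y ∈ u ∷ v ∷ p ∷ r ∷ []
    cover y = distinct-cover four (All.universal complete _) (≤-reflexive (size≡ π)) (complete y)
    v≈u+x : v ≈ u ∙ x
    v≈u+x = go (cover (u ∙ x))
      where
      go : u ∙ x ∈ u ∷ v ∷ p ∷ r ∷ [] → v ≈ u ∙ x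
      go (here e) = contradiction (via (solve (v0 ⊕ v1 ⊖ v0) (v1 ⊖ ∅) (u ∷ x ∷ [])) e) x≉ε
      go (there (here e)) = ≈-sym e
      go (there (there (here e))) = contradiction (≈-trans (≈-sym (≈-trans (∙-congˡ 2x≈ε) (identityʳ u))) (via (solve (v0 ⊕ (v2 ⊖ v1) ⊖ v1) (v0 ⊕ 2 ⊛ (v2 ⊖ v1) ⊖ v2) (u ∷ p ∷ r ∷ [])) e)) (proj₂ (outside πv))
      go (there (there (there (here e)))) = contradiction (via (solve (v0 ⊕ (v2 ⊖ v1) ⊖ v2) (v0 ⊖ v1) (u ∷ p ∷ r ∷ [])) e) (proj₁ (outside πv))
    2a≈ε : 2 ⋆ a ≈ ε
    2a≈ε = ≈-trans (solve (2 ⊛ (v0 ⊖ v1)) (v0 ⊕ (v3 ⊕ (v1 ⊕ (v2 ⊕ ∅))) ⊖ (v3 ⊖ (v0 ⊕ (v2 ⊖ v1))) ⊖ (4 ⊛ v1) ⊖ (2 ⊛ (v2 ⊖ v1))) (u ∷ p ∷ r ∷ v ∷ []))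
      (≈-trans (-‿cong (-‿cong (-‿cong (≈-trans (≈-sym (sumL-↭ π)) (sum-zero π)) (x≈y⇒x-y≈ε v≈u+x)) (4⋆ p)) 2x≈ε)
        (solve (∅ ⊖ ∅ ⊖ ∅ ⊖ ∅) ∅ []))
    2⋆p-diff : ∀ {y} → y ∈ u ∷ v ∷ p ∷ r ∷ [] → 2 ⋆ (y - p) ≈ ε
    2⋆p-diff (here e) = ≈-trans (×-congʳ 2 (∙-congʳ e)) 2a≈ε
    2⋆p-diff {y} (there (here e)) = ≈-trans (×-congʳ 2 (∙-congʳ (≈-trans e v≈u+x)))
      (≈-trans (solve (2 ⊛ (v0 ⊕ v1 ⊖ v2)) (2 ⊛ (v0 ⊖ v2) ⊕ 2 ⊛ v1) (u ∷ x ∷ p ∷ [])) (≈-trans (∙-cong 2a≈ε 2x≈ε) (identityʳ ε)))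
    2⋆p-diff (there (there (here e))) = ≈-trans (×-congʳ 2 (x≈y⇒x-y≈ε e)) (⋆-ε 2)
    2⋆p-diff (there (there (there (here e)))) = ≈-trans (×-congʳ 2 (∙-congʳ e)) 2x≈ε
    2⋆ : ∀ y → 2 ⋆ y ≈ ε
    2⋆ y = ≈-trans (×-congʳ 2 (solve v0 (v0 ⊕ v1 ⊖ v1) (y ∷ p ∷ []))) (2⋆p-diff (cover (y ∙ p)))
    sum-with-p : ∀ {w y j} → L ↭ w ∷ p ∷ y ∷ j ∷ [] → X L (j - p)
    -- Since 2 annihilates the group, only the terms of weights 1 and 3 count.
    sum-with-p {w} {y} {j} ρ = X-resp (≈-trans
        (solve (v0 ⊕ 2 ⊛ v1 ⊕ 3 ⊛ v2) (v2 ⊖ v0 ⊕ 2 ⊛ v0 ⊕ 2 ⊛ v1 ⊕ 2 ⊛ v2) (p ∷ y ∷ j ∷ []))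
        (≈-trans (∙-cong (∙-cong (∙-congˡ (2⋆ p)) (2⋆ y)) (2⋆ j)) (solve (v0 ⊕ ∅ ⊕ ∅ ⊕ ∅) v0 (j - p ∷ []))))
      (X₄ {w = w} (↭-sym ρ))
    sums : ∀ z → z ≉ ε → X L z
    sums z z≉ε = go (cover (z ∙ p))
      where
      minus-p : ∀ {j} → z ∙ p ≈ j → j - p ≈ z
      minus-p {j} e = ≈-trans (∙-congʳ (≈-sym e)) (solve (v0 ⊕ v1 ⊖ v1) v0 (z ∷ p ∷ []))
      go : z ∙ p ∈ u ∷ v ∷ p ∷ r ∷ [] → X L z
      go (here e) = X-resp (minus-p e) (sum-with-p {v} {r} {u} (trans πv (prep v (trans (swap u p refl) (prep p (swap u r refl))))))
      go (there (here e)) = X-resp (minus-p e) (sum-with-p {u} {r} {v} (trans π (prep u (trans (swap v p refl) (prep p (swap v r refl))))))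
      go (there (there (here e))) = contradiction (via (solve (v0 ⊕ v1 ⊖ v1) (v0 ⊖ ∅) (z ∷ p ∷ [])) e) z≉ε
      go (there (there (there (here e)))) = X-resp (minus-p e) (sum-with-p {u} {v} {r} (trans π (prep u (swap v p refl))))

  classification : CyclicCase ⊎ KleinCase
  classification = go exception
    where
    go : Exception → CyclicCase ⊎ KleinCase
    go (u , v , p , ps , π , u≉v , inj₁ a) = inj₁ (cyclic-case π a)
    go (u , v , p , [] , π , u≉v , inj₂ (() , _))
    go (u , v , p , r ∷ [] , π , u≉v , inj₂ (_ , ¬sp)) = decide (p ≈? r)
      where
      decide : Dec (p ≈ r) → CyclicCase ⊎ KleinCase
      decide (yes e) = inj₁ (cyclic-case π (≈-refl ∷ ≈-sym e ∷ []))
      decide (no p≉r) = inj₂ (klein-case π u≉v p≉r ¬sp)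
    go (u , v , p , _ ∷ _ ∷ _ , π , u≉v , inj₂ (() , _))

-- From arrangements of lists to permutations of indices.

module _ {n : ℕ} where
  Enumerates : List (Fin n) → Set
  Enumerates js = allFin n ↭ js

  ≢-sym : ∀ {i j : Fin n} → i ≢ j → j ≢ i
  ≢-sym ne e = ne (sym e)

  enumeration-unique : ∀ {js} → Enumerates js → AllPairs _≢_ js
  enumeration-unique p = AllPairs-↭ ≢-sym p (AllPairsₚ.tabulate⁺ id)

  lookup-injective : ∀ {js : List (Fin n)} → AllPairs _≢_ js → ∀ {k l} → lookup js k ≡ lookup js l → k ≡ l
  lookup-injective u {k} {l} e = decidable-stable (k Finₚ.≟ l) λ ne → AllPairs-lookup ≢-sym u k l ne e

  -- The permutation sends an index to its position in `js`, because the position of a term is what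
  -- determines its weight.
  enumeration-permutation : ∀ {js} → Enumerates js → (e : length js ≡ n) →
    ∃ λ (τ : Permutation′ n) → ∀ k → toℕ (τ ⟨$⟩ʳ lookup js k) ≡ toℕ k
  enumeration-permutation {js} p e = permutation position element position-element element-position ,
      λ k → ≡.trans (Finₚ.toℕ-cast e _) (cong toℕ (lookup-injective (enumeration-unique p) (sym (Anyₚ.lookup-index (mem (lookup js k))))))
    where
    mem : ∀ i → i ∈ₚ js
    mem i = Any-resp-↭ p (∈-allFin i)
    position element : Fin n → Fin n
    position i = cast e (Any.index (mem i))
    element k = lookup js (cast (sym e) k)
    position-element : ∀ k → position (element k) ≡ k
    position-element k = Finₚ.toℕ-injective (≡.trans (Finₚ.toℕ-cast e _)
      (≡.trans (cong toℕ (lookup-injective (enumeration-unique p) (sym (Anyₚ.lookup-index (mem (element k)))))) (Finₚ.toℕ-cast (sym e) k)))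
    element-position : ∀ i → element (position i) ≡ i
    element-position i = ≡.trans (cong (lookup js) (Finₚ.toℕ-injective (≡.trans (Finₚ.toℕ-cast (sym e) _) (Finₚ.toℕ-cast e _))))
      (sym (Anyₚ.lookup-index (mem i)))

triangle-number : ℕ → ℕ
triangle-number zero = 0
triangle-number (suc n) = triangle-number n + n

triangle-number-double : ∀ n → triangle-number n * 2 ≡ n * (n ∸ 1)
triangle-number-double zero = ≡.refl
triangle-number-double (suc zero) = ≡.refl
triangle-number-double (suc (suc n)) = begin
  (triangle-number (suc n) + suc n) * 2    ≡⟨ *-distribʳ-+ 2 (triangle-number (suc n)) (suc n) ⟩
  triangle-number (suc n) * 2 + suc n * 2  ≡⟨ cong (_+ suc n * 2) (triangle-number-double (suc n)) ⟩
  suc n * n + suc n * 2                    ≡⟨ *-distribˡ-+ (suc n) n 2 ⟨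
  suc n * (n + 2)                          ≡⟨ cong (suc n *_) (+-comm n 2) ⟩
  suc n * suc (suc n)                      ≡⟨ *-comm (suc n) (suc (suc n)) ⟩
  suc (suc n) * suc n                      ∎
  where open ≡.≡-Reasoning

triangle-number-half : ∀ n → (n * (n ∸ 1)) / 2 ≡ triangle-number n
triangle-number-half n = ≡.trans (cong (_/ 2) (sym (triangle-number-double n))) (m*n/n≡m (triangle-number n) 2)

module Transfer (G : AbelianGroup 0ℓ 0ℓ) where
  open WeightedSums G
  open Notions G
  open Algebra.Properties.CommutativeMonoid.Sum commutativeMonoid using (sum; sum-permute; sum-cong-≋)
  open import Relation.Binary.Reasoning.Setoid setoid

  ·-cong : ∀ z {x y} → x ≈ y → z · x ≈ z · y
  ·-cong (+ n) e = ×-congʳ n e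
  ·-cong -[1+ n ] e = ⁻¹-cong (×-congʳ (suc n) e)

  ·-ε : ∀ z → z · ε ≈ ε
  ·-ε (+ n) = ⋆-ε n
  ·-ε -[1+ n ] = ≈-trans (⁻¹-cong (⋆-ε (suc n))) (solve (⊝ ∅) ∅ [])

  ·-distrib : ∀ z x y → z · (x ∙ y) ≈ z · x ∙ z · y
  ·-distrib (+ n) x y = ⋆-distrib x y n
  ·-distrib -[1+ n ] x y = ≈-trans (⁻¹-cong (⋆-distrib x y (suc n))) (solve (⊝ (v0 ⊕ v1)) (⊝ v0 ⊖ v1) (suc n ⋆ x ∷ suc n ⋆ y ∷ []))

  ·-suc : ∀ z x → (z ℤ.+ + 1) · x ≈ z · x ∙ x
  ·-suc (+ n) x = ≈-trans (×-congˡ (+-comm n 1)) (comm x (n ⋆ x))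
  ·-suc -[1+ zero ] x = solve ∅ (⊝ (v0 ⊕ ∅) ⊕ v0) (x ∷ [])
  ·-suc -[1+ suc n ] x = solve (⊝ v1) (⊝ (v0 ⊕ v1) ⊕ v0) (x ∷ suc n ⋆ x ∷ [])

  -- The tail carries weights starting at a + 1, and the extra unit on each of its terms is the
  -- summand `sumL` in the recursion of `wsum`.
  sum-consec : ∀ {A : Set} (f : A → Carrier) a js →
               sum (λ k → consec a k · f (lookup js k)) ≈ a · sumL (map f js) ∙ wsum (map f js)
  sum-consec f a [] = ≈-sym (≈-trans (identityʳ _) (·-ε a))
  sum-consec f a (j ∷ js) = begin
    (a ℤ.+ + 0) · x ∙ sum (λ k → (a ℤ.+ + suc (toℕ k)) · f (lookup js k))
      ≈⟨ ∙-cong (reflexive (cong (_· x) (ℤₚ.+-identityʳ a)))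
           (sum-cong-≋ (λ k → reflexive (cong (_· f (lookup js k)) (sym (ℤₚ.+-assoc a (+ 1) (+ toℕ k)))))) ⟩
    a · x ∙ sum (λ k → consec (a ℤ.+ + 1) k · f (lookup js k)) ≈⟨ ∙-congˡ (sum-consec f (a ℤ.+ + 1) js) ⟩
    a · x ∙ ((a ℤ.+ + 1) · sumL xs ∙ wsum xs)                ≈⟨ ∙-congˡ (∙-congʳ (·-suc a (sumL xs))) ⟩
    a · x ∙ (a · sumL xs ∙ sumL xs ∙ wsum xs)
      ≈⟨ solve (v0 ⊕ (v1 ⊕ v2 ⊕ v3)) (v0 ⊕ v1 ⊕ (v3 ⊕ v2)) (a · x ∷ a · sumL xs ∷ sumL xs ∷ wsum xs ∷ []) ⟩
    a · x ∙ a · sumL xs ∙ (wsum xs ∙ sumL xs)                ≈⟨ ∙-congʳ (·-distrib a x (sumL xs)) ⟨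
    a · (x ∙ sumL xs) ∙ (wsum xs ∙ sumL xs)                  ∎
    where
    x = f j
    xs = map f js

  ∈⊙-resp : ∀ {n} (W : Fin n → ℤ) (S : Fin n → Carrier) {x y} → x ≈ y → x ∈⊙ (W , S) → y ∈⊙ (W , S)
  ∈⊙-resp W S e (τ , p) = τ , ≈-trans (≈-sym e) p

  -- An arrangement of the terms comes from an arrangement `js` of the indices; reindexing the sum
  -- by `js` turns the weights into consecutive ones.
  X⇒∈⊙ : ∀ {n} (S : Fin n → Carrier) a {x} → X (map S (allFin n)) x → (a · sumL (map S (allFin n)) ∙ x) ∈⊙ (consec a , S)
  X⇒∈⊙ {n} S a {x} (L′ , p , e) = from (↭-map-inv S (↭-sym p))
    where
    from : (∃ λ js → L′ ≡ map S js × allFin n ↭ js) → (a · sumL (map S (allFin n)) ∙ x) ∈⊙ (consec a , S)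
    from (js , ≡.refl , q) = build (enumeration-permutation q len)
      where
      len : length js ≡ n
      len = ≡.trans (sym (↭-length q)) (length-tabulate id)
      build : (∃ λ (τ : Permutation′ n) → ∀ k → toℕ (τ ⟨$⟩ʳ lookup js k) ≡ toℕ k) → (a · sumL (map S (allFin n)) ∙ x) ∈⊙ (consec a , S)
      build (τ , τ-lookup) = τ , (begin
        a · sumL (map S (allFin n)) ∙ x ≈⟨ ∙-cong (·-cong a (sumL-↭ (↭-sym p))) (≈-sym e) ⟩
        a · sumL (map S js) ∙ wsum (map S js) ≈⟨ weights ⟨
        sum (λ k → h (lookup js k)) ≈⟨ sum-permute h π′ ⟨
        sum h ∎)
        where
        h : Fin n → Carrier
        h i = consec a (τ ⟨$⟩ʳ i) · S i
        π′ : Permutation (length js) n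
        π′ = permutation (lookup js) (λ i → Any.index (mem i)) (λ i → sym (Anyₚ.lookup-index (mem i)))
               (λ k → lookup-injective (enumeration-unique q) (sym (Anyₚ.lookup-index (mem (lookup js k)))))
          where
          mem : ∀ i → i ∈ₚ js
          mem i = Any-resp-↭ q (∈-allFin i)
        weights : sum (λ k → h (lookup js k)) ≈ a · sumL (map S js) ∙ wsum (map S js)
        weights = ≈-trans (sum-cong-≋ (λ k → reflexive (cong (λ w → (a ℤ.+ + w) · S (lookup js k)) (τ-lookup k)))) (sum-consec S a js)

  triangle-⋆ : ∀ n g → triangle n g ≈ triangle-number n ⋆ g
  triangle-⋆ zero g = ≈-refl
  triangle-⋆ (suc n) g = ≈-trans (∙-cong (triangle-⋆ n g) (sumL-replicate n g)) (≈-sym (×-homo-+ g (triangle-number n) n))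

module _ (G : AbelianGroup 0ℓ 0ℓ) (F : IsFinite G) where
  open IsFinite F
  open WeightedSums G

  finGroup : FinGroup
  finGroup .FinGroup.G = G
  finGroup .FinGroup._≈?_ x y =
    map′ (λ e → ≈-trans (≈-sym (proj₂ (enum-sur x))) (≈-trans (reflexive (cong enum e)) (proj₂ (enum-sur y))))
         (λ e → enum-inj _ _ (≈-trans (proj₂ (enum-sur x)) (≈-trans e (≈-sym (proj₂ (enum-sur y))))))
         (proj₁ (enum-sur x) Finₚ.≟ proj₁ (enum-sur y))
  finGroup .FinGroup.elems = tabulate enum
  finGroup .FinGroup.distinct = AllPairsₚ.tabulate⁺ (λ ne e → ne (enum-inj _ _ e))
  finGroup .FinGroup.complete x = Anyₚ.tabulate⁺ (proj₁ (enum-sur x)) (≈-sym (proj₂ (enum-sur x)))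

  finGroup-size : FinGroup.size finGroup ≡ size
  finGroup-size = length-tabulate enum

-- Recognising the Klein four-group.

module Klein (F : FinGroup) (x a : FinGroup.Carrier F)
             (size≡4 : FinGroup.size F ≡ 4)
             (2x : FinGroup._≈_ F (FinGroup._⋆_ F 2 x) (FinGroup.ε F)) (2a : FinGroup._≈_ F (FinGroup._⋆_ F 2 a) (FinGroup.ε F))
             (x≉ε : FinGroup._≉_ F x (FinGroup.ε F)) (a≉ε : FinGroup._≉_ F a (FinGroup.ε F)) (x≉a : FinGroup._≉_ F x a) where
  open FinGroup F
  open Finite F
  open import Relation.Binary.Reasoning.Setoid setoid

  pick : Bool → Carrier → Carrier
  pick true y = y
  pick false y = ε

  pick-xor : ∀ {y} → 2 ⋆ y ≈ ε → ∀ α β → pick (α xor β) y ≈ pick α y ∙ pick β y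
  pick-xor 2y false β = ≈-sym (identityˡ _)
  pick-xor 2y true false = ≈-sym (identityʳ _)
  pick-xor {y} 2y true true = ≈-sym (≈-trans (∙-congˡ (≈-sym (identityʳ y))) 2y)

  -- The required isomorphism is the inverse of this map, which is injective by its trivial kernel
  -- and surjective because the group has four elements.
  ψ : Bool × Bool → Carrier
  ψ (α , β) = pick α x ∙ pick β a

  add : Bool × Bool → Bool × Bool → Bool × Bool
  add (α , β) (γ , δ) = α xor γ , β xor δ

  ψ-add : ∀ s t → ψ (add s t) ≈ ψ s ∙ ψ t
  ψ-add (α , β) (γ , δ) = ≈-trans (∙-cong (pick-xor 2x α γ) (pick-xor 2a β δ))
    (solve (v0 ⊕ v1 ⊕ (v2 ⊕ v3)) (v0 ⊕ v2 ⊕ (v1 ⊕ v3)) (pick α x ∷ pick γ x ∷ pick β a ∷ pick δ a ∷ []))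

  x∙a≉ε : x ∙ a ≉ ε
  x∙a≉ε e = x≉a (≈-sym (≈-trans (≈-sym (identityˡ a)) (≈-trans (∙-congʳ (≈-sym 2x)) (≈-trans
    (solve (2 ⊛ v0 ⊕ v1) (v0 ⊕ (v0 ⊕ v1)) (x ∷ a ∷ [])) (≈-trans (∙-congˡ e) (identityʳ x))))))

  ψ-kernel : ∀ s → ψ s ≈ ε → s ≡ (false , false)
  ψ-kernel (false , false) _ = ≡.refl
  ψ-kernel (true , false) e = contradiction (≈-trans (≈-sym (identityʳ x)) e) x≉ε
  ψ-kernel (false , true) e = contradiction (≈-trans (≈-sym (identityˡ a)) e) a≉ε
  ψ-kernel (true , true) e = contradiction e x∙a≉ε

  xor-false : ∀ α β → α xor β ≡ false → α ≡ β
  xor-false false false _ = ≡.refl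
  xor-false true true _ = ≡.refl

  add-self : ∀ s → add s s ≡ (false , false)
  add-self (α , β) = cong₂ _,_ (xor-same α) (xor-same β)

  ψ-injective : ∀ {s t} → ψ s ≈ ψ t → s ≡ t
  ψ-injective {s} {t} e = cong₂ _,_ (xor-false _ _ (cong proj₁ zero-sum)) (xor-false _ _ (cong proj₂ zero-sum))
    where
    zero-sum : add s t ≡ (false , false)
    zero-sum = ψ-kernel (add s t) (≈-trans (ψ-add s t) (≈-trans (∙-congʳ e) (≈-trans (≈-sym (ψ-add t t))
      (≈-trans (reflexive (cong ψ (add-self t))) (identityʳ ε)))))

  abstract
    ψ-surjective : ∀ z → ∃ λ s → ψ s ≈ z
    ψ-surjective z = from (distinct-cover {map ψ all-bits} (AllPairsₚ.map⁺ (AllPairs.map (λ {s} {t} ne e → ne (ψ-injective {s} {t} e)) bits-unique))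
        (All.universal complete _) (≤-reflexive size≡4) (complete z))
      where
      all-bits : List (Bool × Bool)
      all-bits = (false , false) ∷ (true , false) ∷ (false , true) ∷ (true , true) ∷ []
      bits-unique : AllPairs _≢_ all-bits
      bits-unique = ((λ ()) ∷ (λ ()) ∷ (λ ()) ∷ []) ∷ ((λ ()) ∷ (λ ()) ∷ []) ∷ ((λ ()) ∷ []) ∷ [] ∷ []
      from : z ∈ map ψ all-bits → ∃ λ s → ψ s ≈ z
      from (here e) = (false , false) , ≈-sym e
      from (there (here e)) = (true , false) , ≈-sym e
      from (there (there (here e))) = (false , true) , ≈-sym e
      from (there (there (there (here e)))) = (true , true) , ≈-sym e

  isoC2⊕C2 : Notions.IsoC2⊕C2 G
  isoC2⊕C2 = φ , φ-cong , (λ y z e → ≈-trans (≈-sym (ψφ y)) (≈-trans (reflexive (cong ψ e)) (ψφ z))) , (λ s → ψ s , φψ s) , φ-hom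
    where
    φ : Carrier → Bool × Bool
    φ z = proj₁ (ψ-surjective z)
    ψφ : ∀ z → ψ (φ z) ≈ z
    ψφ z = proj₂ (ψ-surjective z)
    φ-cong : ∀ y z → y ≈ z → φ y ≡ φ z
    φ-cong y z e = ψ-injective {φ y} {φ z} (≈-trans (ψφ y) (≈-trans e (≈-sym (ψφ z))))
    φψ : ∀ s → φ (ψ s) ≡ s
    φψ s = ψ-injective {φ (ψ s)} {s} (ψφ (ψ s))
    φ-hom : ∀ y z → φ (y ∙ z) ≡ add (φ y) (φ z)
    φ-hom y z = ψ-injective {φ (y ∙ z)} {add (φ y) (φ z)}
      (≈-trans (ψφ (y ∙ z)) (≈-trans (∙-cong (≈-sym (ψφ y)) (≈-sym (ψφ z))) (≈-sym (ψ-add (φ y) (φ z)))))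

-- The three assertions for a given sequence.

module Sequence (G : AbelianGroup 0ℓ 0ℓ) (F : IsFinite G) (n : ℕ) (S : Fin n → AbelianGroup.Carrier G) (a : ℤ)
                (¬coset : ¬ Notions.InCosetOfProperSubgroup G S) where
  FG : FinGroup
  FG = finGroup G F
  open FinGroup FG hiding (G)
  open Finite FG
  open Hulls FG
  open Cyclicity FG
  open Notions G
  open Transfer G
  open import Relation.Binary.Reasoning.Setoid setoid

  m : ℕ
  m = IsFinite.size F

  size≡m : size ≡ m
  size≡m = finGroup-size G F

  L : List Carrier
  L = map S (allFin n)

  length-L : length L ≡ n
  length-L = ≡.trans (length-map S (allFin n)) (length-tabulate id)

  S∈L : ∀ i → S i ∈ₚ L
  S∈L i = ∈-map⁺ S (∈-allFin i)

  subgroup-closed : ∀ {P} → Closed P → IsSubgroup P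
  subgroup-closed c = record { resp = Closed.resp c ; has-ε = Closed.ε∈ c ; closed = Closed.∙∈ c ; inv = Closed.⁻¹∈ c }

  ε-closed : Closed (_≈ ε)
  ε-closed = record { resp = λ e p → ≈-trans (≈-sym e) p ; ε∈ = ≈-refl ; ∙∈ = λ p q → ≈-trans (∙-cong p q) (identityʳ ε) }

  -- The hypothesis is negative, but a nonempty list either spans or has an explicit proper hull.
  -- For the empty list the trivial subgroup is proper as soon as there is a nonzero element.
  spanning : Spanning L
  spanning = go L ≡.refl
    where
    go : ∀ M → L ≡ M → Spanning M
    go [] e P c g i x = decide (x ≈? ε)
      where
      no-index : ∀ {A : Set} → Fin n → A
      no-index i = contradiction (subst (S i ∈ₚ_) e (S∈L i)) λ ()
      decide : Dec (x ≈ ε) → P x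
      decide (yes x≈ε) = Closed.resp c (≈-sym x≈ε) (Closed.ε∈ c)
      decide (no x≉ε) = contradiction ((_≈ ε) , subgroup-closed ε-closed , (x , x≉ε) , ε , λ i → no-index i) ¬coset
    go (p ∷ ps) e = from (spanning-or-hull p ps)
      where
      from : Spanning (p ∷ ps) ⊎ ProperHull (p ∷ ps) → Spanning (p ∷ ps)
      from (inj₁ sp) = sp
      from (inj₂ hull) = contradiction (Mem , subgroup-closed closed , (outside , ∉H) , g , λ i → All.lookup inCoset (subst (S i ∈ₚ_) e (S∈L i))) ¬coset
        where open ProperHull hull

  _∈WS : Carrier → Set
  x ∈WS = x ∈⊙ (consec a , S)

  ∈WS-resp : ∀ {x y} → x ≈ y → x ∈WS → y ∈WS
  ∈WS-resp = ∈⊙-resp (consec a) S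

  X⇒∈WS : ∀ {x} → X L x → (a · sumL L ∙ x) ∈WS
  X⇒∈WS = X⇒∈⊙ S a

  all⇒∈WS : (∀ x → X L x) → ∀ x → x ∈WS
  all⇒∈WS f x = ∈WS-resp (solve (v0 ⊕ (v1 ⊖ v0)) v1 (a · sumL L ∷ x ∷ [])) (X⇒∈WS (f (x - a · sumL L)))

  Has⇒AtLeast : ∀ {k} → Has k (X L) → AtLeast k _∈WS
  Has⇒AtLeast (xs , l , d , p) = (λ i → a · sumL L ∙ lookup xs (inject≤ i l)) ,
    (λ i j e → Finₚ.inject≤-injective l l i j (decidable-stable (inject≤ i l Finₚ.≟ inject≤ j l)
      λ ne → AllPairs-lookup (λ ne e → ne (≈-sym e)) d _ _ ne (cancelˡ _ e))) ,
    λ i → X⇒∈WS (All.lookup p (∈-lookup (inject≤ i l)))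

  part₁ : AtLeast ((m ∸ 1) ⊓ n) _∈WS
  part₁ = Has⇒AtLeast (subst₂ (λ k l → Has ((k ∸ 1) ⊓ l) (X L)) size≡m length-L (Good.bound (good FG) L spanning))

  subsequence : ∀ {k} (zs : List (Fin n)) → length zs ≡ k → AllPairs _≢_ zs → ∃ λ (ι : Fin k → Fin n) →
                (∀ i j → ι i ≡ ι j → i ≡ j) × map S zs ≡ map (λ i → S (ι i)) (allFin k)
  subsequence zs ≡.refl u = lookup zs , (λ i j → lookup-injective u) ,
    ≡.trans (cong (map S) (sym (tabulate-lookup zs))) (≡.trans (map-tabulate (lookup zs) S) (sym (map-tabulate id (λ i → S (lookup zs i)))))

  AllPairs-drop : ∀ {xs ys : List (Fin n)} → AllPairs _≢_ (xs ++ ys) → AllPairs _≢_ ys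
  AllPairs-drop {[]} d = d
  AllPairs-drop {_ ∷ xs} (_ ∷ d) = AllPairs-drop {xs} d

  part₂ : suc m ≤ n → (∀ x → x ∈WS) × (∃ λ (ι : Fin m → Fin n) → (∀ i j → ι i ≡ ι j → i ≡ j) ×
            (∀ x → x ∈⊙ (consec (+ 0) , (λ i → S (ι i)))))
  part₂ m<n = from (Good.full (good FG) L spanning (subst₂ _<_ (sym size≡m) (sym length-L) m<n))
    where
    Goal₂ = ∃ λ (ι : Fin m → Fin n) → (∀ i j → ι i ≡ ι j → i ≡ j) × (∀ x → x ∈⊙ (consec (+ 0) , (λ i → S (ι i))))
    from : (∃ λ R → ∃ λ T → L ↭ R ++ T × length T ≡ size × (∀ x → X T x)) → (∀ x → x ∈WS) × Goal₂
    from (R , T , π , lT , f) = all⇒∈WS (λ x → X-↭ (↭-sym π) (X-prefix-all R f x)) , indices (↭-map-++-inv S (allFin n) R π)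
      where
      indices : (∃ λ ys → ∃ λ zs → allFin n ↭ ys ++ zs × length ys ≡ length R × map S zs ≡ T) → Goal₂
      indices (ys , zs , q , _ , e) = build (subsequence zs (≡.trans (sym (length-map S zs)) (≡.trans (cong length e) (≡.trans lT size≡m)))
          (AllPairs-drop {ys} (enumeration-unique q)))
        where
        build : (∃ λ (ι : Fin m → Fin n) → (∀ i j → ι i ≡ ι j → i ≡ j) × map S zs ≡ map (λ i → S (ι i)) (allFin m)) → Goal₂
        build (ι , inj , e′) = ι , inj , λ x → ∈⊙-resp (consec (+ 0)) (λ i → S (ι i)) (identityˡ x) (X⇒∈⊙ (λ i → S (ι i)) (+ 0) (subst (λ M → X M x) (≡.trans (sym e) e′) (f x)))

  module Exact (n≡m : n ≡ m) (¬all : ¬ (∀ x → x ∈WS)) where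
    n≡size : length L ≡ size
    n≡size = ≡.trans length-L (≡.trans n≡m (sym size≡m))

    ¬allX : ¬ (∀ x → X L x)
    ¬allX f = ¬all (all⇒∈WS f)

    open Classification FG L spanning n≡size ¬allX using (CyclicCase; KleinCase; classification; size≡; ih)

    -- In the exceptional situation the sum of all terms is 0, so the starting value `a` of the
    -- weights has no effect and the missing element is the same for every `a`.
    X⇒∈WS′ : ∀ {s T x} → L ↭ s ∷ T → X L x → x ∈WS
    X⇒∈WS′ {x = x} π p = ∈WS-resp (≈-trans (∙-congʳ (≈-trans (·-cong a (Main.Exceptional.sum-zero FG ih L spanning n≡size ¬allX π)) (·-ε a))) (identityˡ x)) (X⇒∈WS p)

    missing : ∀ {c s T} → L ↭ s ∷ T → (∀ z → z ≉ c → X L z) → ∀ x → (x ∈WS → ¬ x ≈ c) × (¬ x ≈ c → x ∈WS)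
    missing {c} π f x = (λ p e → ¬all λ z → at z (∈WS-resp e p) (z ≈? c)) , λ ne → X⇒∈WS′ π (f x ne)
      where
      at : ∀ z → c ∈WS → Dec (z ≈ c) → z ∈WS
      at z p (yes e) = ∈WS-resp (≈-sym e) p
      at z p (no ne) = X⇒∈WS′ π (f z ne)

    m≡ : ∀ {M} → L ↭ M → m ≡ length M
    m≡ π = ≡.trans (sym size≡m) (size≡ π)

    Conclusion-i Conclusion-ii : Set
    Conclusion-i = IsoC2⊕C2 × (m ≡ 4) × (∀ i j → S i ≈ S j → i ≡ j) ×
               (∀ x → (x ∈⊙ (consec a , S) → ¬ x ≈ ε) × (¬ x ≈ ε → x ∈⊙ (consec a , S)))
    Conclusion-ii = Cyclic ×
               (∃ λ g → ∃ λ g' → HasOrder g m ×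
                  (∃ λ i → ∃ λ j → (i ≢ j) × (S i ≈ g' ∙ g) × (S j ≈ g' ∙ g ⁻¹) ×
                     (∀ k → k ≢ i → k ≢ j → S k ≈ g')) ×
                  (∀ x → (x ∈⊙ (consec a , S) → ¬ x ≈ (+ ((m * (m ∸ 1)) / 2)) · g') ×
                         (¬ x ≈ (+ ((m * (m ∸ 1)) / 2)) · g' → x ∈⊙ (consec a , S))) ×
                  (∀ x → IsGenerator x → x ∈⊙ (consec a , S)))

    klein : KleinCase → Conclusion-i
    klein (u , v , p , r , π , d@((_ ∷ u≉p ∷ u≉r ∷ []) ∷ _ ∷ (p≉r ∷ []) ∷ _) , 2x , 2a , f) =
      Klein.isoC2⊕C2 FG (r - p) (u - p) (size≡ π) 2x 2a (λ e → p≉r (≈-sym (x-y≈ε⇒x≈y e))) (λ e → u≉p (x-y≈ε⇒x≈y e)) (λ e → u≉r (≈-sym (cancelʳ _ e))) ,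
      m≡ π , injective , missing π f
      where
      L-distinct : AllPairs (λ i j → S i ≉ S j) (allFin n)
      L-distinct = AllPairsₚ.map⁻ (Distinct-↭ (↭-sym π) d)
      injective : ∀ i j → S i ≈ S j → i ≡ j
      injective i j e = decidable-stable (i Finₚ.≟ j) λ ne → separate L-distinct (∈-allFin i) (∈-allFin j) ne e
        where
        separate : ∀ {js i j} → AllPairs (λ i j → S i ≉ S j) js → i ∈ₚ js → j ∈ₚ js → i ≢ j → S i ≉ S j
        separate (a ∷ d) (here ≡.refl) (here ≡.refl) ne = contradiction ≡.refl ne
        separate (a ∷ d) (here ≡.refl) (there k) ne = All.lookup a k
        separate (a ∷ d) (there k) (here ≡.refl) ne = λ e → All.lookup a k (≈-sym e)
        separate (a ∷ d) (there k) (there l) ne = separate d k l ne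

    generator : ∀ {x} → IsGenerator x → Generates x
    generator {x} gen y = from (gen y)
      where
      from : (∃ λ z → y ≈ z · x) → ∃ λ k → y ≈ k ⋆ x
      from (+ k , e) = k , e
      from (-[1+ k ] , e) = Closed.resp (multiples-closed x) (≈-sym e) (Closed.⁻¹∈ (multiples-closed x) (suc k , ≈-refl))

    cyclic : CyclicCase → 3 ≤ m × Conclusion-ii
    cyclic (u , v , p , ps , π , a≈ , gen , v≈ , f) = 3≤m , (g , λ y → + proj₁ (gen y) , proj₂ (gen y)) , g , p , order ,
        positions (↭-map-inv S π) , missing-c , λ x gen-x → proj₂ (missing-c x) (not-generator x gen-x)
      where
      g = u - p
      3≤m : 3 ≤ m
      3≤m = subst (3 ≤_) (sym (m≡ π)) (s≤s (s≤s (s≤s z≤n)))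
      order : HasOrder g m
      order = <-≤-trans (s≤s z≤n) 3≤m , ≈-trans (×-congˡ (sym size≡m)) (lagrange g) ,
        λ j 0<j e → subst (_≤ j) size≡m (order-≥-size gen j 0<j e)
      positions : (∃ λ ks → u ∷ v ∷ p ∷ ps ≡ map S ks × allFin n ↭ ks) →
        ∃ λ i → ∃ λ j → (i ≢ j) × (S i ≈ p ∙ g) × (S j ≈ p ∙ g ⁻¹) × (∀ k → k ≢ i → k ≢ j → S k ≈ p)
      positions (i ∷ j ∷ ks , e , q) = i , j , All.head (AllPairs.head (enumeration-unique q)) ,
          ≈-trans (reflexive (sym (∷-injectiveˡ e))) (solve v0 (v1 ⊕ (v0 ⊖ v1)) (u ∷ p ∷ [])) ,
          ≈-trans (reflexive (sym (∷-injectiveˡ (∷-injectiveʳ e)))) v≈ ,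
          λ k k≢i k≢j → rest (Any-resp-↭ q (∈-allFin k)) k≢i k≢j
        where
        rest : ∀ {k} → k ∈ₚ i ∷ j ∷ ks → k ≢ i → k ≢ j → S k ≈ p
        rest (here e) k≢i _ = contradiction e k≢i
        rest (there (here e)) _ k≢j = contradiction e k≢j
        rest (there (there l)) _ _ = All.lookup (Allₚ.map⁻ (subst (All (_≈ p)) (∷-injectiveʳ (∷-injectiveʳ e)) a≈)) l
      c = (+ ((m * (m ∸ 1)) / 2)) · p
      triangle≈c : triangle size p ≈ c
      triangle≈c = ≈-trans (triangle-⋆ size p) (×-congˡ (≡.trans (cong triangle-number size≡m) (sym (triangle-number-half m))))
      missing-c : ∀ x → (x ∈WS → ¬ x ≈ c) × (¬ x ≈ c → x ∈WS)
      missing-c = missing π λ z ne → f z λ e → ne (≈-trans e triangle≈c)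
      2c≈ε : 2 ⋆ c ≈ ε
      2c≈ε = begin
        2 ⋆ c                            ≈⟨ ×-congʳ 2 (≈-trans (≈-sym triangle≈c) (triangle-⋆ size p)) ⟩
        2 ⋆ (triangle-number size ⋆ p)   ≈⟨ ×-assocˡ p 2 (triangle-number size) ⟩
        (2 * triangle-number size) ⋆ p   ≡⟨ cong (_⋆ p) (≡.trans (*-comm 2 (triangle-number size)) (≡.trans (triangle-number-double size) (*-comm size (size ∸ 1)))) ⟩
        ((size ∸ 1) * size) ⋆ p          ≈⟨ ×-assocˡ p (size ∸ 1) size ⟨
        (size ∸ 1) ⋆ (size ⋆ p)          ≈⟨ ≈-trans (×-congʳ (size ∸ 1) (lagrange p)) (⋆-ε (size ∸ 1)) ⟩
        ε                                ∎
      -- The missing element is annihilated by 2, since m (m - 1) p = 0, whereas a generator has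
      -- order m, which is at least 3.
      not-generator : ∀ x → IsGenerator x → ¬ x ≈ c
      not-generator x gen-x e = <⇒≱ 3≤m (subst (_≤ 2) size≡m (order-≥-size (generator gen-x) 2 (s≤s z≤n) (≈-trans (×-congʳ 2 e) 2c≈ε)))

    part₃ : (3 ≤ m) × (Conclusion-i ⊎ Conclusion-ii)
    part₃ = from classification
      where
      from : CyclicCase ⊎ KleinCase → (3 ≤ m) × (Conclusion-i ⊎ Conclusion-ii)
      from (inj₁ c) = proj₁ (cyclic c) , inj₂ (proj₂ (cyclic c))
      from (inj₂ k@(_ , _ , _ , _ , π , _)) = subst (3 ≤_) (sym (m≡ π)) (s≤s (s≤s (s≤s z≤n))) , inj₁ (klein k)

theorem1p1 : (G : AbelianGroup 0ℓ 0ℓ) (F : IsFinite G) →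
  let open AbelianGroup G
      open Notions G
      m = IsFinite.size F
  in (n : ℕ) (S : Fin n → Carrier) (a : ℤ) →
     ¬ InCosetOfProperSubgroup S →
     -- (1) |W ⊙ S| ≥ min(|G| - 1, |S|)
     AtLeast ((m ∸ 1) ⊓ n) (λ x → x ∈⊙ (consec a , S))
     -- (2) |S| ≥ |G| + 1 gives W ⊙ S = G, witnessed by a subsequence S' with |S'| = |G| and W' = 0,1,...,|G|-1
     × (suc m ≤ n →
          (∀ x → x ∈⊙ (consec a , S)) ×
          (∃ λ (ι : Fin m → Fin n) → (∀ i j → ι i ≡ ι j → i ≡ j) ×
             (∀ x → x ∈⊙ (consec (+ 0) , (λ i → S (ι i))))))
     -- (3) |S| = |G| and W ⊙ S ≠ G
     × (n ≡ m → ¬ (∀ x → x ∈⊙ (consec a , S)) →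
          (3 ≤ m) ×
          ( -- (i)
            (IsoC2⊕C2 × (m ≡ 4) × (∀ i j → S i ≈ S j → i ≡ j) ×
             (∀ x → (x ∈⊙ (consec a , S) → ¬ x ≈ ε) × (¬ x ≈ ε → x ∈⊙ (consec a , S))))
          ⊎ -- (ii)
            (Cyclic ×
             (∃ λ g → ∃ λ g' → HasOrder g m ×
                (∃ λ i → ∃ λ j → (i ≢ j) × (S i ≈ g' ∙ g) × (S j ≈ g' ∙ g ⁻¹) ×
                   (∀ k → k ≢ i → k ≢ j → S k ≈ g')) ×
                (∀ x → (x ∈⊙ (consec a , S) → ¬ x ≈ (+ ((m * (m ∸ 1)) / 2)) · g') ×
                       (¬ x ≈ (+ ((m * (m ∸ 1)) / 2)) · g' → x ∈⊙ (consec a , S))) ×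
                (∀ x → IsGenerator x → x ∈⊙ (consec a , S))))))
theorem1p1 G F n S a ¬coset = part₁ , part₂ , Exact.part₃
  where open Sequence G F n S a ¬coset
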